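{- For every fixed choice of a real number $\epsilon>0$ and an integer $r\ge 2$, there exists an algorithm $\mathcal{A}(\epsilon,r)$ that finds, in time polynomial in the size of the input, a perfect matching in any given $r$-uniform bipartite hypergraph $H=(A,B,E)$ satisfying \[\tau(E_S) > (2r-3+\epsilon)(|S|-1)\quad \text{for all } S\subseteq A.\]
   Context: An $r$-uniform bipartite hypergraph $H=(A,B,E)$ is a (finite) hypergraph whose vertex set is partitioned into two sets $A$ and $B$ such that every edge $e\in E$ satisfies $|e\cap A|=1$ and $|e\cap B|=r-1$. The bipartition $(A,B)$ is given to the algorithm as part of the input. A perfect matching in $H$ is a collection of pairwise disjoint edges such that every vertex of $A$ is contained in exactly one edge of the collection (vertices of $B$ need not be covered). For $S\subseteq A$, $E_S:=\{e\in E : |e\cap S|=1\}$ is the set of edges incident to $S$. For $F\subseteq E$, $\tau(F)$ is the smallest cardinality of a subset of $B$ that hits all edges of $F$, where $R\subseteq B$ hits $F$ if $R\cap e\ne\emptyset$ for every $e\in F$. The running time is polynomial for each fixed pair $(\epsilon,r)$; the polynomial may depend on $\epsilon$ and $r$. -}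

module Defs where

open import Data.Bool using (Bool; true; false)
import Data.Bool as Bool
open import Data.Fin using (Fin)
open import Data.Fin.Subset using (Subset; _∩_; ∣_∣; Nonempty; Empty)
import Data.Fin.Subset as Subset
open import Data.Integer using (ℤ)
open import Data.List using (List; []; _∷_; map; replicate)
open import Data.List.Membership.Propositional using (_∈_)
open import Data.List.Relation.Unary.All using (All)
open import Data.List.Relation.Unary.AllPairs using (AllPairs)
open import Data.List.Relation.Unary.Unique.Propositional using (Unique)
open import Data.Nat using (ℕ; zero; suc; _+_; _*_; _∸_; _≤_; _≡ᵇ_; _⊔_)
import Data.Nat.Properties as ℕₚ
open import Data.Product using (∃; ∃!; _×_; _,_; proj₁; proj₂)
open import Data.Rational using (ℚ; 0ℚ; 1ℚ; ½)
import Data.Rational as ℚ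
import Data.Rational.Properties as ℚₚ
open import Data.Rational.Solver using (module +-*-Solver)
import Data.Vec as Vec
open import Level using (0ℓ)
open import Relation.Binary.PropositionalEquality
open import Relation.Unary using (Pred)

record ℝ : Set where
  constructor mkℝ
  field
    seq    : ℕ → ℚ
    cauchy : ∀ δ → 0ℚ ℚ.< δ →
             ∃ λ N → ∀ m n → N ≤ m → N ≤ n →
             ℚ.∣ seq m ℚ.- seq n ∣ ℚ.< δ

open ℝ public

fromℚ : ℚ → ℝ
fromℚ q .seq _ = q
fromℚ q .cauchy δ 0<δ = 0 , λ _ _ _ _ →
  subst (λ d → ℚ.∣ d ∣ ℚ.< δ) (sym (ℚₚ.+-inverseʳ q)) 0<δ

fromℤ : ℤ → ℝ
fromℤ z = fromℚ (z ℚ./ 1)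

private
  half-pos : ∀ {δ} → 0ℚ ℚ.< δ → 0ℚ ℚ.< ½ ℚ.* δ
  half-pos {δ} 0<δ =
    subst (ℚ._< ½ ℚ.* δ) (ℚₚ.*-zeroʳ ½) (ℚₚ.*-monoʳ-<-pos ½ 0<δ)

  half+half : ∀ δ → ½ ℚ.* δ ℚ.+ ½ ℚ.* δ ≡ δ
  half+half δ =
    trans (sym (ℚₚ.*-distribʳ-+ δ ½ ½)) (ℚₚ.*-identityˡ δ)

  sub-interchange : ∀ a b c d →
    (a ℚ.+ b) ℚ.- (c ℚ.+ d) ≡ (a ℚ.- c) ℚ.+ (b ℚ.- d)
  sub-interchange = solve 4
    (λ a b c d → (a :+ b) :- (c :+ d) := (a :- c) :+ (b :- d)) refl
    where open +-*-Solver

  sub-distrib : ∀ a b q → (a ℚ.* q) ℚ.- (b ℚ.* q) ≡ (a ℚ.- b) ℚ.* q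
  sub-distrib = solve 3
    (λ a b q → (a :* q) :- (b :* q) := (a :- b) :* q) refl
    where open +-*-Solver

infixl 6 _+ℝ_
infixl 7 _·_
infix 4 _<ℝ_

_+ℝ_ : ℝ → ℝ → ℝ
(x +ℝ y) .seq n = x .seq n ℚ.+ y .seq n
(x +ℝ y) .cauchy δ 0<δ
  with x .cauchy (½ ℚ.* δ) (half-pos 0<δ)
     | y .cauchy (½ ℚ.* δ) (half-pos 0<δ)
... | M , p | N , q = M ⊔ N , λ m n M⊔N≤m M⊔N≤n →
  let xm = x .seq m ; xn = x .seq n ; ym = y .seq m ; yn = y .seq n in
  begin-strict
    ℚ.∣ (xm ℚ.+ ym) ℚ.- (xn ℚ.+ yn) ∣
      ≡⟨ cong ℚ.∣_∣ (sub-interchange xm ym xn yn) ⟩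
    ℚ.∣ (xm ℚ.- xn) ℚ.+ (ym ℚ.- yn) ∣
      ≤⟨ ℚₚ.∣p+q∣≤∣p∣+∣q∣ (xm ℚ.- xn) (ym ℚ.- yn) ⟩
    ℚ.∣ xm ℚ.- xn ∣ ℚ.+ ℚ.∣ ym ℚ.- yn ∣
      <⟨ ℚₚ.+-mono-<
           (p m n (ℕₚ.m⊔n≤o⇒m≤o M N M⊔N≤m) (ℕₚ.m⊔n≤o⇒m≤o M N M⊔N≤n))
           (q m n (ℕₚ.m⊔n≤o⇒n≤o M N M⊔N≤m) (ℕₚ.m⊔n≤o⇒n≤o M N M⊔N≤n)) ⟩
    ½ ℚ.* δ ℚ.+ ½ ℚ.* δ
      ≡⟨ half+half δ ⟩
    δ ∎
  where open ℚₚ.≤-Reasoning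

_·_ : ℝ → ℤ → ℝ
(x · z) .seq n = x .seq n ℚ.* (z ℚ./ 1)
(x · z) .cauchy δ 0<δ = N , λ m n N≤m N≤n →
  let d = x .seq m ℚ.- x .seq n in
  begin-strict
    ℚ.∣ x .seq m ℚ.* q ℚ.- x .seq n ℚ.* q ∣
      ≡⟨ cong ℚ.∣_∣ (sub-distrib (x .seq m) (x .seq n) q) ⟩
    ℚ.∣ d ℚ.* q ∣
      ≡⟨ ℚₚ.∣p*q∣≡∣p∣*∣q∣ d q ⟩
    ℚ.∣ d ∣ ℚ.* ℚ.∣ q ∣
      ≤⟨ ℚₚ.*-monoˡ-≤-nonNeg ℚ.∣ d ∣ {{ℚₚ.∣-∣-nonNeg d}} ∣q∣≤b ⟩
    ℚ.∣ d ∣ ℚ.* b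
      <⟨ ℚₚ.*-monoˡ-<-pos b (close m n N≤m N≤n) ⟩
    (δ ℚ.* ℚ.1/ b) ℚ.* b
      ≡⟨ ℚₚ.*-assoc δ (ℚ.1/ b) b ⟩
    δ ℚ.* (ℚ.1/ b ℚ.* b)
      ≡⟨ cong (δ ℚ.*_) (ℚₚ.*-inverseˡ b) ⟩
    δ ℚ.* 1ℚ
      ≡⟨ ℚₚ.*-identityʳ δ ⟩
    δ ∎
  where
  open ℚₚ.≤-Reasoning
  q b : ℚ
  q = z ℚ./ 1
  b = ℚ.∣ q ∣ ℚ.+ 1ℚ
  0<b : 0ℚ ℚ.< b
  0<b = ℚₚ.+-mono-≤-< (ℚₚ.0≤∣p∣ q) (ℚₚ.positive⁻¹ 1ℚ)
  instance
    b-pos : ℚ.Positive b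
    b-pos = ℚ.positive 0<b
    b-nonZero : ℚ.NonZero b
    b-nonZero = ℚₚ.pos⇒nonZero b
    1/b-pos : ℚ.Positive (ℚ.1/ b)
    1/b-pos = ℚₚ.1/pos⇒pos b
  ∣q∣≤b : ℚ.∣ q ∣ ℚ.≤ b
  ∣q∣≤b = subst (ℚ._≤ b) (ℚₚ.+-identityʳ ℚ.∣ q ∣)
    (ℚₚ.+-monoʳ-≤ ℚ.∣ q ∣ (ℚₚ.nonNegative⁻¹ 1ℚ))
  0<δ/b : 0ℚ ℚ.< δ ℚ.* ℚ.1/ b
  0<δ/b = subst (ℚ._< δ ℚ.* ℚ.1/ b) (ℚₚ.*-zeroˡ (ℚ.1/ b))
    (ℚₚ.*-monoˡ-<-pos (ℚ.1/ b) 0<δ)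
  N = proj₁ (x .cauchy _ 0<δ/b)
  close = proj₂ (x .cauchy _ 0<δ/b)

-- The gap δ has to be uniform in n: eventual strict inequality of the
-- terms alone would not separate the limits.
_<ℝ_ : ℝ → ℝ → Set
x <ℝ y = ∃ λ δ → 0ℚ ℚ.< δ ×
  ∃ λ N → ∀ n → N ≤ n → x .seq n ℚ.+ δ ℚ.≤ y .seq n

-- A set of vertices of A ⊎ B, with A = Fin a and B = Fin b, is given by
-- its intersections with A and with B.
Edge : ℕ → ℕ → Set
Edge a b = Subset a × Subset b

record BipartiteHypergraph (r : ℕ) : Set where
  field
    a b     : ℕ
    edges   : List (Edge a b)
    unique  : Unique edges
    uniform : All (λ e → ∣ proj₁ e ∣ ≡ 1 × ∣ proj₂ e ∣ ≡ r ∸ 1) edges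

module _ {r : ℕ} (H : BipartiteHypergraph r) where
  open BipartiteHypergraph H

  EdgeSet : Set₁
  EdgeSet = Pred (Edge a b) 0ℓ

  incident : Subset a → EdgeSet
  incident S e = e ∈ edges × ∣ proj₁ e ∩ S ∣ ≡ 1

  Hits : Subset b → EdgeSet → Set
  Hits R F = ∀ e → F e → Nonempty (R ∩ proj₂ e)

  -- τ(F) = k.  Such a k exists for every set F of edges as soon as r ≥ 2.
  IsTransversalNumber : EdgeSet → ℕ → Set
  IsTransversalNumber F k =
    (∃ λ R → Hits R F × ∣ R ∣ ≡ k) × (∀ R → Hits R F → k ≤ ∣ R ∣)

  Disjoint : Edge a b → Edge a b → Set
  Disjoint e f = Empty (proj₁ e ∩ proj₁ f) × Empty (proj₂ e ∩ proj₂ f)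

  record IsPerfectMatching (M : List (Edge a b)) : Set where
    field
      subset   : All (_∈ edges) M
      disjoint : AllPairs Disjoint M
      covers   : ∀ (v : Fin a) → ∃! _≡_ (λ e → e ∈ M × v Subset.∈ proj₁ e)

-- Algorithms are programs of Jones' language WHILE on binary trees.
-- Each constructor, selector, test and variable access takes one step, as
-- trees are shared pointers that are never modified.  Up to polynomials this
-- agrees with time on Turing machines (N. D. Jones, Computability and
-- Complexity from a Programming Perspective, MIT Press 1997).

data Tree : Set where
  nil  : Tree
  cons : Tree → Tree → Tree

size : Tree → ℕ
size nil        = 1
size (cons s t) = suc (size s + size t)

left right : Tree → Tree
left nil         = nil
left (cons s _)  = s
right nil        = nil
right (cons _ t) = t

Var : Set
Var = ℕ

data Expr : Set where
  var   : Var → Expr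
  nil   : Expr
  cons  : Expr → Expr → Expr
  hd tl : Expr → Expr

infix  6 _≔_
infixr 5 _⨾_

data Command : Set where
  _≔_           : Var → Expr → Command
  _⨾_           : Command → Command → Command
  if_then_else_ : Expr → Command → Command → Command
  while_loop_   : Expr → Command → Command

Store : Set
Store = Var → Tree

_[_↦_] : Store → Var → Tree → Store
(σ [ x ↦ t ]) y = Bool.if x ≡ᵇ y then t else σ y

eval : Expr → Store → Tree
eval (var x)    σ = σ x
eval nil        σ = nil
eval (cons e f) σ = cons (eval e σ) (eval f σ)
eval (hd e)     σ = left (eval e σ)
eval (tl e)     σ = right (eval e σ)

cost : Expr → ℕ
cost (var x)    = 1
cost nil        = 1
cost (cons e f) = suc (cost e + cost f)
cost (hd e)     = suc (cost e)
cost (tl e)     = suc (cost e)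

-- ⟨ c , σ ⟩⇓⟨ σ′ , t ⟩: started in σ, the command c halts in σ′ after t
-- steps.  As a test, nil is false and every other tree is true.
data ⟨_,_⟩⇓⟨_,_⟩ : Command → Store → Store → ℕ → Set where

  assign : ∀ {x e σ} →
    ⟨ x ≔ e , σ ⟩⇓⟨ σ [ x ↦ eval e σ ] , suc (cost e) ⟩

  sequence : ∀ {c d σ σ′ σ″ t u} →
    ⟨ c , σ ⟩⇓⟨ σ′ , t ⟩ → ⟨ d , σ′ ⟩⇓⟨ σ″ , u ⟩ →
    ⟨ c ⨾ d , σ ⟩⇓⟨ σ″ , t + u ⟩

  if-true : ∀ {e c d σ σ′ t v w} → eval e σ ≡ cons v w →
    ⟨ c , σ ⟩⇓⟨ σ′ , t ⟩ →
    ⟨ if e then c else d , σ ⟩⇓⟨ σ′ , suc (cost e) + t ⟩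

  if-false : ∀ {e c d σ σ′ t} → eval e σ ≡ nil →
    ⟨ d , σ ⟩⇓⟨ σ′ , t ⟩ →
    ⟨ if e then c else d , σ ⟩⇓⟨ σ′ , suc (cost e) + t ⟩

  while-true : ∀ {e c σ σ′ σ″ t u v w} → eval e σ ≡ cons v w →
    ⟨ c , σ ⟩⇓⟨ σ′ , t ⟩ → ⟨ while e loop c , σ′ ⟩⇓⟨ σ″ , u ⟩ →
    ⟨ while e loop c , σ ⟩⇓⟨ σ″ , suc (cost e) + (t + u) ⟩

  while-false : ∀ {e c σ} → eval e σ ≡ nil →
    ⟨ while e loop c , σ ⟩⇓⟨ σ , suc (cost e) ⟩

-- Input and output are both passed in variable 0; all other variables
-- are nil at the start.
initial : Tree → Store
initial input = (λ _ → nil) [ 0 ↦ input ]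

Computes_From_To_Within_ : Command → Tree → Tree → ℕ → Set
Computes c From input To output Within n =
  ∃ λ σ → ∃ λ t → ⟨ c , initial input ⟩⇓⟨ σ , t ⟩ × σ 0 ≡ output × t ≤ n

-- Coefficients, constant term first.
Polynomial : Set
Polynomial = List ℕ

⟦_⟧ : Polynomial → ℕ → ℕ
⟦ [] ⟧     n = 0
⟦ c ∷ cs ⟧ n = c + n * ⟦ cs ⟧ n

listTree : List Tree → Tree
listTree []       = nil
listTree (t ∷ ts) = cons t (listTree ts)

boolTree : Bool → Tree
boolTree false = nil
boolTree true  = cons nil nil

unaryTree : ℕ → Tree
unaryTree n = listTree (replicate n nil)

-- Characteristic vector.
subsetTree : ∀ {n} → Subset n → Tree
subsetTree S = listTree (map boolTree (Vec.toList S))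

edgeTree : ∀ {a b} → Edge a b → Tree
edgeTree (p , q) = cons (subsetTree p) (subsetTree q)

edgesTree : ∀ {a b} → List (Edge a b) → Tree
edgesTree es = listTree (map edgeTree es)

-- The sizes of A and B are in unary because the vertices themselves are
-- part of the input; the size of the tree is thus polynomially related to
-- |A| + |B| + |E|.
hypergraphTree : ∀ {r} → BipartiteHypergraph r → Tree
hypergraphTree H = cons (unaryTree a) (cons (unaryTree b) (edgesTree edges))
  where open BipartiteHypergraph H

{-# OPTIONS --safe #-}
module Submission where

-- A partial matching M is enlarged by a local search with lazy updates, after Annamalai.  The search
-- keeps a stack of layers of pairwise far apart edges; the vertices of A reached so far are the
-- unmatched ones and those of the edges of M touched by the layers.  Either a new layer is added
-- greedily, and by the hypothesis on τ it has at least a constant fraction of the size of the tree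
-- below it; or a constant fraction of the top layer meets no edge of M, and these edges are swapped
-- into M.  By pigeonhole the swap either enlarges M or removes a constant fraction of the edges of M
-- touched by some lower layer, whose successors are then discarded.  Let Zᵢ be the number of vertices
-- of A reached up to layer i.  Both a new layer and a swap change the Zᵢ by constant factors, so for a
-- large constant q the sum of the Zᵢ^-q increases in every step that does not enlarge M.  Scaled by
-- (1 + |A|)^q and with its terms rounded down, it takes only polynomially many values.

open import Defs
open import Data.Bool using (Bool; true; false; _∧_; _∨_; not)
import Data.Bool as Bool
open import Data.Bool.Properties using (∨-identityʳ; ∨-assoc; not-injective)
open import Data.Empty using (⊥; ⊥-elim)
open import Data.Fin using (zero; suc)
open import Data.Fin.Subset using (Subset; Nonempty; Empty; _∩_; _∪_; _─_; ∁; ∣_∣; ⋃) renaming (_∈_ to _∈ₛ_; ⊥ to ∅; ⊤ to full)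
open import Data.Fin.Subset.Properties using (nonempty?; ∣⊥∣≡0; x∈p∩q⁺; x∈p∩q⁻; x∈p∪q⁺; x∈p∪q⁻; p∩q≢∅⇒∣p─q∣<∣p∣; x∈p∧x∉q⇒x∈p─q; ∉⊥; p⊆q⇒∣p∣≤∣q∣; x∈∁p⇒x∉p; ∣∁p∣≡n∸∣p∣; ∣p∣≤n; ∣p∣≡n⇒p≡⊤; ∈⊤)
import Data.Integer as ℤ
import Data.Integer.Properties as ℤₚ
open import Data.List using (List; []; _∷_; length; map; filter; drop; reverse; reverseAcc; replicate; _++_; concat)
open import Data.List.Properties using (reverse-involutive; length-reverse; drop-drop; length-filter; length-++; length-map; length-replicate; map-id; filter-++; filter-all; filter-none)
open import Data.List.Membership.Propositional using (_∈_; find; lose)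
open import Data.List.Membership.Propositional.Properties using (∈-filter⁺; ∈-filter⁻; ∈-++⁺ˡ; ∈-++⁺ʳ; ∈-++⁻; ∈-concat⁺′; ∈-concat⁻′)
open import Data.List.Relation.Unary.All as All using (All; []; _∷_)
open import Data.List.Relation.Unary.AllPairs as AllPairs using (AllPairs; []; _∷_)
import Data.List.Relation.Unary.AllPairs.Properties as AllPairs
open import Data.List.Relation.Unary.Any using (Any; here; there; any?)
open import Data.Nat using (ℕ; zero; suc; pred; _+_; _*_; _∸_; _^_; _⊔_; _≤_; _<_; _≤?_; _≡ᵇ_; z≤n; s≤s; s≤s⁻¹; NonZero)
open import Data.Nat.DivMod using (_/_; m/n≤m; m/n*n≤m; m*n/n≡m; /-monoˡ-≤; /-monoʳ-≤; m≥n⇒m/n>0)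
open import Data.Nat.Properties
open import Data.Nat.Solver using (module +-*-Solver)
open import Data.Product using (Σ; ∃; _×_; _,_; proj₁; proj₂)
open import Data.Rational using (ℚ; mkℚ; 0ℚ; toℚᵘ)
import Data.Rational as ℚ
import Data.Rational.Properties as ℚₚ
open import Data.Rational.Unnormalised using (mkℚᵘ)
import Data.Rational.Unnormalised as ℚᵘ
import Data.Rational.Unnormalised.Properties as ℚᵘₚ
open import Data.Sum using (_⊎_; inj₁; inj₂; [_,_]′)
open import Data.Unit using (⊤; tt)
import Data.Vec as Vec
open import Function using (_∘_; id)
open import Relation.Binary.PropositionalEquality using (_≡_; _≢_; refl; sym; trans; cong; cong₂; subst; subst₂)
open import Relation.Nullary using (Dec; yes; no; does; ¬_; contradiction)
open import Relation.Nullary.Decidable using (¬?; _×-dec_; _⊎-dec_; decidable-stable)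
open import Relation.Unary using (Decidable)

-- Polynomials and WHILE programs

-- The constant 2r-3 comes from the transversal that forces a new layer to be large. An edge at a
-- reached vertex of A that the greedy choice rejects is hit by the vertices in B of the layer edges
-- and of the edges of M that these meet. As layer edges are far apart, no edge of M meets two of
-- them; so apart from the few that meet no edge of M, they are at most as many as the touched edges
-- of M. A layer edge costs r-1 vertices, and a touched edge of M only r-2 more, since it shares one
-- with the layer: together 2r-3 for each touched edge. The slack ε bounds the rest, namely the
-- edges that meet no edge of M and the new layer, and an unmatched vertex accounts for the -1 in
-- |S|-1.
--
-- A swap at a lower layer uses only those edges whose vertex of A lies in an edge of M meeting that
-- layer, which leaves everything below intact. What is discarded above weighs little: the weights
-- of the layers decrease geometrically, so together they weigh at most as much as the kept layer,
-- whose weight triples.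

infixl 6 _+ₚ_
infixl 7 _*ₚ_

_+ₚ_ : Polynomial → Polynomial → Polynomial
[]       +ₚ q        = q
(c ∷ p)  +ₚ []       = c ∷ p
(c ∷ p)  +ₚ (d ∷ q)  = c + d ∷ p +ₚ q

_*ₚ_ : Polynomial → Polynomial → Polynomial
[]       *ₚ q = []
(c ∷ p)  *ₚ q = map (c *_) q +ₚ (0 ∷ p *ₚ q)

⟦+⟧ : ∀ p q n → ⟦ p +ₚ q ⟧ n ≡ ⟦ p ⟧ n + ⟦ q ⟧ n
⟦+⟧ []      q       n = refl
⟦+⟧ (c ∷ p) []      n = sym (+-identityʳ _)
⟦+⟧ (c ∷ p) (d ∷ q) n rewrite ⟦+⟧ p q n =
  solve 5 (λ c d n x y → c :+ d :+ n :* (x :+ y) := c :+ n :* x :+ (d :+ n :* y))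
    refl c d n (⟦ p ⟧ n) (⟦ q ⟧ n)
  where open +-*-Solver using (solve; _:+_; _:*_; _:=_)

⟦scale⟧ : ∀ c q n → ⟦ map (c *_) q ⟧ n ≡ c * ⟦ q ⟧ n
⟦scale⟧ c []      n = sym (*-zeroʳ c)
⟦scale⟧ c (d ∷ q) n rewrite ⟦scale⟧ c q n =
  solve 4 (λ c d n x → c :* d :+ n :* (c :* x) := c :* (d :+ n :* x)) refl c d n (⟦ q ⟧ n)
  where open +-*-Solver using (solve; _:+_; _:*_; _:=_)

⟦*⟧ : ∀ p q n → ⟦ p *ₚ q ⟧ n ≡ ⟦ p ⟧ n * ⟦ q ⟧ n
⟦*⟧ []      q n = refl
⟦*⟧ (c ∷ p) q n
  rewrite ⟦+⟧ (map (c *_) q) (0 ∷ p *ₚ q) n | ⟦scale⟧ c q n | ⟦*⟧ p q n =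
  solve 4 (λ c n x y → c :* y :+ n :* (x :* y) := (c :+ n :* x) :* y)
    refl c n (⟦ p ⟧ n) (⟦ q ⟧ n)
  where open +-*-Solver using (solve; _:+_; _:*_; _:=_)

IsPolynomial : (ℕ → ℕ) → Set
IsPolynomial f = ∃ λ p → ∀ n → f n ≡ ⟦ p ⟧ n

constant : ∀ c → IsPolynomial (λ _ → c)
constant c = c ∷ [] , λ n → sym (trans (cong (c +_) (*-zeroʳ n)) (+-identityʳ c))

identity : IsPolynomial id
identity = 0 ∷ 1 ∷ [] , λ n →
  sym (trans (cong (λ z → n * (1 + z)) (*-zeroʳ n)) (*-identityʳ n))

infixl 6 _⊕_
infixl 7 _⊗_

_⊕_ : ∀ {f g} → IsPolynomial f → IsPolynomial g → IsPolynomial (λ n → f n + g n)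
(p , f≡p) ⊕ (q , g≡q) =
  p +ₚ q , λ n → trans (cong₂ _+_ (f≡p n) (g≡q n)) (sym (⟦+⟧ p q n))

_⊗_ : ∀ {f g} → IsPolynomial f → IsPolynomial g → IsPolynomial (λ n → f n * g n)
(p , f≡p) ⊗ (q , g≡q) =
  p *ₚ q , λ n → trans (cong₂ _*_ (f≡p n) (g≡q n)) (sym (⟦*⟧ p q n))

power : ∀ {f} → IsPolynomial f → ∀ k → IsPolynomial (λ n → f n ^ k)
power f zero    = constant 1
power f (suc k) = f ⊗ power f k

update-same : ∀ σ x t → (σ [ x ↦ t ]) x ≡ t
update-same σ x t = cong (λ b → Bool.if b then t else σ x) (x≡ᵇx x)
  where
  x≡ᵇx : ∀ x → (x ≡ᵇ x) ≡ true
  x≡ᵇx zero    = refl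
  x≡ᵇx (suc x) = x≡ᵇx x

update-other : ∀ σ {x y} t → x ≢ y → (σ [ x ↦ t ]) y ≡ σ y
update-other σ {x} {y} t x≢y with x ≡ᵇ y in eq
... | false = refl
... | true  = contradiction (≡ᵇ⇒≡ x y (subst Bool.T (sym eq) _)) x≢y

update-below : ∀ σ x t {k} → k < x → (σ [ x ↦ t ]) k ≡ σ k
update-below σ x t k<x = update-other σ {x} t (λ { refl → <-irrefl refl k<x })

-- Programs work on a single register and use the registers above it as scratch space.
record Run (c : Command) (n : ℕ) (σ : Store) (out : Tree) (bound : ℕ) : Set where
  constructor mkRun
  field
    {final} : Store
    {steps} : ℕ
    exec    : ⟨ c , σ ⟩⇓⟨ final , steps ⟩
    result  : final n ≡ out
    frame   : ∀ {k} → k < n → final k ≡ σ k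
    within  : steps ≤ bound

-- The code and its time bound are uniform in d.  As N d need not be the size of i d, programs
-- compose without bounds on the sizes of intermediate trees.
record Realizes {D : Set} (N : D → ℕ) (i o : D → Tree) : Set where
  field
    code   : ℕ → Command
    time   : ℕ → ℕ
    isPoly : IsPolynomial time
    runs   : ∀ n d σ → σ n ≡ i d → Run (code n) n σ (o d) (time (N d))

open Realizes

-- The data `d` may carry invariants that no tree encodes. Since code and time are chosen before
-- `d`, programs apply to such enriched data, and a loop body need only be correct where its
-- invariant holds.
reindex : ∀ {D D′ N i o} (h : D′ → D) → Realizes {D} N i o →
          Realizes {D′} (N ∘ h) (i ∘ h) (o ∘ h)
reindex h f .code     = f .code
reindex h f .time     = f .time
reindex h f .isPoly   = f .isPoly
reindex h f .runs n d = f .runs n (h d)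

retarget : ∀ {D N i o o′} → (∀ d → o d ≡ o′ d) → Realizes {D} N i o → Realizes N i o′
retarget o≡o′ f .code         = f .code
retarget o≡o′ f .time         = f .time
retarget o≡o′ f .isPoly       = f .isPoly
retarget {N = N} o≡o′ f .runs n d σ eq =
  subst (λ t → Run (f .code n) n σ t (f .time (N d))) (o≡o′ d) (f .runs n d σ eq)

resource : ∀ {D N i i′ o} → (∀ d → i d ≡ i′ d) → Realizes {D} N i o → Realizes N i′ o
resource i≡i′ f .code          = f .code
resource i≡i′ f .time          = f .time
resource i≡i′ f .isPoly        = f .isPoly
resource i≡i′ f .runs n d σ eq = f .runs n d σ (trans eq (sym (i≡i′ d)))

-- An expression stands for a function of a single tree, so all its variables become the register at
-- hand.
at : Var → Expr → Expr
at n (var _)    = var n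
at n nil        = nil
at n (cons e f) = cons (at n e) (at n f)
at n (hd e)     = hd (at n e)
at n (tl e)     = tl (at n e)

cost-at : ∀ n e → cost (at n e) ≡ cost e
cost-at n (var _)    = refl
cost-at n nil        = refl
cost-at n (cons e f) = cong suc (cong₂ _+_ (cost-at n e) (cost-at n f))
cost-at n (hd e)     = cong suc (cost-at n e)
cost-at n (tl e)     = cong suc (cost-at n e)

eval-at : ∀ n e σ {t} → σ n ≡ t → eval (at n e) σ ≡ eval e (λ _ → t)
eval-at n (var _)    σ eq = eq
eval-at n nil        σ eq = refl
eval-at n (cons e f) σ eq = cong₂ cons (eval-at n e σ eq) (eval-at n f σ eq)
eval-at n (hd e)     σ eq = cong left (eval-at n e σ eq)
eval-at n (tl e)     σ eq = cong right (eval-at n e σ eq)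

⌜_⌝ : ∀ {D N i} (e : Expr) → Realizes {D} N i (λ d → eval e (λ _ → i d))
⌜ e ⌝ .code n   = n ≔ at n e
⌜ e ⌝ .time _   = suc (cost e)
⌜ e ⌝ .isPoly   = constant _
⌜ e ⌝ .runs n d σ eq = mkRun assign
  (trans (update-same σ n _) (eval-at n e σ eq))
  (update-below σ n _)
  (≤-reflexive (cong suc (cost-at n e)))

infixr 4 _⟫_

_⟫_ : ∀ {D N i m o} → Realizes {D} N i m → Realizes N m o → Realizes N i o
(f ⟫ g) .code n = f .code n ⨾ g .code n
(f ⟫ g) .time N = f .time N + g .time N
(f ⟫ g) .isPoly = f .isPoly ⊕ g .isPoly
(f ⟫ g) .runs n d σ eq with f .runs n d σ eq
... | mkRun F resF frF tF with g .runs n d _ resF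
...   | mkRun G resG frG tG =
  mkRun (sequence F G) resG (λ k<n → trans (frG k<n) (frF k<n)) (+-mono-≤ tF tG)

-- Programs overwrite their register, so each runs on a copy. By `frame` the first preserves the
-- input in register `n` and the second preserves the result of the first in register `suc n`.
pair : ∀ {D N i o₁ o₂} → Realizes {D} N i o₁ → Realizes N i o₂ →
       Realizes N i (λ d → cons (o₁ d) (o₂ d))
pair f g .code n =
  suc n ≔ var n ⨾ f .code (suc n) ⨾ suc (suc n) ≔ var n ⨾ g .code (suc (suc n)) ⨾
  n ≔ cons (var (suc n)) (var (suc (suc n)))
pair f g .time N = 2 + (f .time N + (2 + (g .time N + 4)))
pair f g .isPoly =
  constant 2 ⊕ (f .isPoly ⊕ (constant 2 ⊕ (g .isPoly ⊕ constant 4)))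
pair f g .runs n d σ eq
  with f .runs (suc n) d (σ [ suc n ↦ σ n ]) (trans (update-same σ (suc n) _) eq)
... | mkRun {τ} F resF frF tF
  with g .runs (suc (suc n)) d (τ [ suc (suc n) ↦ τ n ])
         (trans (update-same τ (suc (suc n)) _)
           (trans (frF ≤-refl) (trans (update-below σ (suc n) _ ≤-refl) eq)))
...   | mkRun {υ} G resG frG tG = mkRun
  (sequence assign (sequence F (sequence assign (sequence G assign))))
  (trans (update-same υ n _) (cong₂ cons
    (trans (frG ≤-refl) (trans (update-below τ (suc (suc n)) _ ≤-refl) resF))
    resG))
  (λ k<n → let k<1+n = m<n⇒m<1+n k<n in
    trans (update-below υ n _ k<n)
    (trans (frG (m<n⇒m<1+n k<1+n))
    (trans (update-below τ (suc (suc n)) _ (m<n⇒m<1+n k<1+n))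
    (trans (frF k<1+n) (update-below σ (suc n) _ k<1+n)))))
  (+-monoʳ-≤ 2 (+-mono-≤ tF (+-monoʳ-≤ 2 (+-monoˡ-≤ 4 tG))))

branch : ∀ {D N i o₁ o₂} {b : D → Bool} → Realizes {D} N i (boolTree ∘ b) →
         Realizes N i o₁ → Realizes N i o₂ →
         Realizes N i (λ d → Bool.if b d then o₁ d else o₂ d)
branch t f g .code n =
  suc n ≔ var n ⨾ t .code (suc n) ⨾ (if var (suc n) then f .code n else g .code n)
-- The sum replaces the maximum, which need not be a polynomial.
branch t f g .time N = 2 + (t .time N + (2 + (f .time N + g .time N)))
branch t f g .isPoly =
  constant 2 ⊕ (t .isPoly ⊕ (constant 2 ⊕ (f .isPoly ⊕ g .isPoly)))
branch {b = b} t f g .runs n d σ eq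
  with t .runs (suc n) d (σ [ suc n ↦ σ n ]) (trans (update-same σ (suc n) _) eq)
... | mkRun {τ} T resT frT tT = by-cases (b d) resT
  where
  below : ∀ {k} → k < suc n → τ k ≡ σ k
  below k<1+n = trans (frT k<1+n) (update-below σ (suc n) _ k<1+n)
  by-cases : ∀ v → τ (suc n) ≡ boolTree v → Run _ n σ (Bool.if v then _ else _) _
  by-cases true  τ≡ with f .runs n d τ (trans (below ≤-refl) eq)
  ... | mkRun F resF frF tF = mkRun
    (sequence assign (sequence T (if-true τ≡ F))) resF
    (λ k<n → trans (frF k<n) (below (m<n⇒m<1+n k<n)))
    (+-monoʳ-≤ 2 (+-mono-≤ tT (+-monoʳ-≤ 2 (m≤n⇒m≤n+o _ tF))))
  by-cases false τ≡ with g .runs n d τ (trans (below ≤-refl) eq)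
  ... | mkRun G resG frG tG = mkRun
    (sequence assign (sequence T (if-false τ≡ G))) resG
    (λ k<n → trans (frG k<n) (below (m<n⇒m<1+n k<n)))
    (+-monoʳ-≤ 2 (+-mono-≤ tT (+-monoʳ-≤ 2 (m≤n⇒m≤o+n _ tG))))

-- The loop invariant is part of the type `S p`. The input `p` stays fixed, so every round has the
-- same time bound in terms of `N p`, however the state changes.
module Iteration {P : Set} {S : P → Set}
  (continue  : ∀ {p} → S p → Bool)
  (next      : ∀ {p} (s : S p) → continue s ≡ true → S p)
  (rank      : ∀ {p} → S p → ℕ)
  (decreases : ∀ {p} (s : S p) c → rank (next s c) < rank s)
  where

  data Halts {p} (s : S p) : Set where
    stop : continue s ≡ false → Halts s
    go   : (c : continue s ≡ true) → Halts (next s c) → Halts s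

  outcome : ∀ {p} {s : S p} → Halts s → S p
  outcome {s = s} (stop _) = s
  outcome (go _ h)         = outcome h

  outcome-stops : ∀ {p} {s : S p} (h : Halts s) → continue (outcome h) ≡ false
  outcome-stops (stop c) = c
  outcome-stops (go _ h) = outcome-stops h

  rounds : ∀ {p} {s : S p} → Halts s → ℕ
  rounds (stop _) = 0
  rounds (go _ h) = suc (rounds h)

  rounds≤rank : ∀ {p} {s : S p} (h : Halts s) → rounds h ≤ rank s
  rounds≤rank (stop _) = z≤n
  rounds≤rank (go c h) = ≤-<-trans (rounds≤rank h) (decreases _ c)

  halts : ∀ {p} (s : S p) → Halts s
  halts s = within (rank s) s ≤-refl
    where
    within : ∀ k {p} (s : S p) → rank s ≤ k → Halts s
    within k s r≤k with continue s in eq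
    within k       s r≤k | false = stop eq
    within zero    s r≤k | true  = contradiction (<-≤-trans (decreases s eq) r≤k) λ ()
    within (suc k) s r≤k | true  =
      go eq (within k (next s eq) (s≤s⁻¹ (<-≤-trans (decreases s eq) r≤k)))

  iterate : ∀ {p} → S p → S p
  iterate s = outcome (halts s)

  iterate-stops : ∀ {p} (s : S p) → continue (iterate s) ≡ false
  iterate-stops s = outcome-stops (halts s)

  module _ {N : P → ℕ} (enc : ∀ p → S p → Tree)
    {q : ℕ → ℕ} (isPoly-q : IsPolynomial q) (rank≤q : ∀ {p} (s : S p) → rank s ≤ q (N p))
    (test : Realizes {Σ P S} (N ∘ proj₁) (λ (p , s) → enc p s) (λ (p , s) → boolTree (continue s)))
    (body : Realizes {Σ P (λ p → Σ (S p) (λ s → continue s ≡ true))} (N ∘ proj₁)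
              (λ (p , s , _) → enc p s) (λ (p , s , c) → enc p (next s c)))
    where

    private
      again : ℕ → Command
      -- A loop can test only an expression, so the test program runs before the loop and after each
      -- round and leaves its verdict in register `suc n`.
      again n = while var (suc n) loop
        (body .code n ⨾ suc n ≔ var n ⨾ test .code (suc n))

      round : ℕ → ℕ
      round N = 2 + (body .time N + (2 + test .time N))

      again-runs : ∀ n p {s : S p} (h : Halts s) σ → σ n ≡ enc p s →
        σ (suc n) ≡ boolTree (continue s) →
        Run (again n) n σ (enc p (outcome h)) (rounds h * round (N p) + 2)
      again-runs n p (stop c) σ eq eq′ =
        mkRun (while-false (trans eq′ (cong boolTree c))) eq (λ _ → refl) ≤-refl
      again-runs n p {s} (go c h) σ eq eq′ with body .runs n (p , s , c) σ eq
      ... | mkRun {τ} B resB frB tB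
        with test .runs (suc n) (p , next s c) (τ [ suc n ↦ τ n ])
               (trans (update-same τ (suc n) _) resB)
      ...   | mkRun {υ} T resT frT tT
        with again-runs n p h υ
               (trans (frT ≤-refl) (trans (update-below τ (suc n) _ ≤-refl) resB)) resT
      ...     | mkRun L resL frL tL = mkRun
        (while-true (trans eq′ (cong boolTree c)) (sequence B (sequence assign T)) L)
        resL
        (λ k<n → trans (frL k<n) (trans (frT (m<n⇒m<1+n k<n))
          (trans (update-below τ (suc n) _ (m<n⇒m<1+n k<n)) (frB k<n))))
        (≤-trans (+-monoʳ-≤ 2 (+-mono-≤ (+-mono-≤ tB (+-monoʳ-≤ 2 tT)) tL))
          (≤-reflexive (sym (+-assoc (round (N p)) _ 2))))

    iterate-realizes : Realizes {Σ P S} (N ∘ proj₁)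
      (λ (p , s) → enc p s) (λ (p , s) → enc p (iterate s))
    iterate-realizes .code n = suc n ≔ var n ⨾ test .code (suc n) ⨾ again n
    iterate-realizes .time N = 2 + (test .time N + (q N * round N + 2))
    iterate-realizes .isPoly = constant 2 ⊕ (test .isPoly ⊕ (isPoly-q ⊗
      (constant 2 ⊕ (body .isPoly ⊕ (constant 2 ⊕ test .isPoly))) ⊕ constant 2))
    iterate-realizes .runs n (p , s) σ eq
      with test .runs (suc n) (p , s) (σ [ suc n ↦ σ n ]) (trans (update-same σ (suc n) _) eq)
    ... | mkRun {τ} T resT frT tT
      with again-runs n p (halts s) τ
             (trans (frT ≤-refl) (trans (update-below σ (suc n) _ ≤-refl) eq)) resT
    ...   | mkRun L resL frL tL = mkRun
      (sequence assign (sequence T L))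
      resL
      (λ k<n → trans (frL k<n) (trans (frT (m<n⇒m<1+n k<n))
        (update-below σ (suc n) _ (m<n⇒m<1+n k<n))))
      (+-monoʳ-≤ 2 (+-mono-≤ tT (≤-trans tL
        (+-monoˡ-≤ 2 (*-monoˡ-≤ (round (N p))
          (≤-trans (rounds≤rank (halts s)) (rank≤q s)))))))

-- Programs on lists and sets

infixl 8 _₁ _₂
x₀ : Expr
x₀ = var 0

_₁ _₂ : Expr → Expr
e ₁ = hd e
e ₂ = tl e

isCons : Tree → Bool
isCons nil        = false
isCons (cons _ _) = true

nonNil : ∀ {D N i} → Realizes {D} N i (boolTree ∘ isCons ∘ i)
nonNil .code n = if var n then (n ≔ cons nil nil) else (n ≔ nil)
nonNil .time _ = 6
nonNil .isPoly = constant 6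
nonNil {i = i} .runs n d σ eq = by-cases (i d) eq
  where
  by-cases : ∀ t → σ n ≡ t → Run _ n σ (boolTree (isCons t)) 6
  by-cases nil        eq = mkRun (if-false eq assign) (update-same σ n _)
    (update-below σ n _) (m≤m+n 4 2)
  by-cases (cons _ _) eq = mkRun (if-true eq assign) (update-same σ n _)
    (update-below σ n _) ≤-refl

negate : ∀ {D N i} {b : D → Bool} → Realizes N i (boolTree ∘ b) →
         Realizes N i (boolTree ∘ not ∘ b)
negate {b = b} f = retarget (λ d → lemma (b d)) (branch f ⌜ nil ⌝ ⌜ cons nil nil ⌝)
  where
  lemma : ∀ v → (Bool.if v then nil else cons nil nil) ≡ boolTree (not v)
  lemma true  = refl
  lemma false = refl

or : ∀ {D N i} {b c : D → Bool} → Realizes N i (boolTree ∘ b) →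
     Realizes N i (boolTree ∘ c) → Realizes N i (λ d → boolTree (b d ∨ c d))
or {b = b} f g = retarget (λ d → lemma (b d)) (branch f ⌜ cons nil nil ⌝ g)
  where
  lemma : ∀ v {w} → (Bool.if v then cons nil nil else boolTree w) ≡ boolTree (v ∨ w)
  lemma true  = refl
  lemma false = refl

and : ∀ {D N i} {b c : D → Bool} → Realizes N i (boolTree ∘ b) →
      Realizes N i (boolTree ∘ c) → Realizes N i (λ d → boolTree (b d ∧ c d))
and {b = b} f g = retarget (λ d → lemma (b d)) (branch f g ⌜ nil ⌝)
  where
  lemma : ∀ v {w} → (Bool.if v then boolTree w else nil) ≡ boolTree (v ∧ w)
  lemma true  = refl
  lemma false = refl

-- The type of the accumulator depends on the elements still to come, so that it can hold an
-- invariant that relates it to them.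
module Fold {D : Set} {N : D → ℕ} {T : D → Set} (encT : ∀ {d} → T d → Tree)
  (env : D → Tree) {A : ∀ d → List (T d) → Set} (encA : ∀ {d xs} → A d xs → Tree)
  (f : ∀ {d x xs} → A d (x ∷ xs) → A d xs)
  (step : Realizes {Σ D (λ d → Σ (T d × List (T d)) (λ (x , xs) → A d (x ∷ xs)))}
    (N ∘ proj₁)
    (λ (d , (x , _) , s) → cons (env d) (cons (encA s) (encT x)))
    (λ (_ , _ , s) → encA (f s)))
  where

  fold : ∀ {d} xs → A d xs → A d []
  fold []       s = s
  fold (x ∷ xs) s = fold xs (f s)

  private
    S : D → Set
    S d = Σ (List (T d)) (λ xs → length xs ≤ N d × A d xs)

    enc : ∀ d → S d → Tree
    enc d (xs , _ , s) = cons (env d) (cons (encA s) (listTree (map encT xs)))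

    continue : ∀ {d} → S d → Bool
    continue ([] , _)    = false
    continue (_ ∷ _ , _) = true

    next : ∀ {d} (s : S d) → continue s ≡ true → S d
    next (x ∷ xs , b , s) _ = xs , ≤-trans (n≤1+n _) b , f s

    decreases : ∀ {d} (s : S d) c → length (proj₁ (next s c)) < length (proj₁ s)
    decreases (x ∷ xs , _ , _) _ = ≤-refl

    open Iteration {D} {S} continue next (length ∘ proj₁) decreases

    isCons-list : ∀ {d} (s : S d) → isCons (listTree (map encT (proj₁ s))) ≡ continue s
    isCons-list ([] , _)    = refl
    isCons-list (_ ∷ _ , _) = refl

    outcome-fold : ∀ {d} {s : S d} (h : Halts s) →
      enc d (outcome h) ≡ cons (env d) (cons (encA (fold (proj₁ s) (proj₂ (proj₂ s)))) nil)
    outcome-fold {s = [] , _ , s}     (stop _)  = refl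
    outcome-fold {s = x ∷ xs , _ , s} (stop ())
    outcome-fold {s = [] , _ , s}     (go () h)
    outcome-fold {s = x ∷ xs , _ , s} (go _ h)  = outcome-fold h

    split : ∀ {d} (s : S d) → continue s ≡ true →
            Σ (T d × List (T d)) (λ (x , xs) → A d (x ∷ xs))
    split (x ∷ xs , _ , s) _ = (x , xs) , s

    body-input : ∀ d (s : S d) (c : continue s ≡ true) →
      let ((x , xs) , s′) = split s c in
      cons (env d) (cons (encA s′) (listTree (map encT (x ∷ xs)))) ≡ enc d s
    body-input d (x ∷ xs , _ , s) c = refl

    body-result : ∀ d (s : S d) (c : continue s ≡ true) →
      let ((x , xs) , s′) = split s c in
      cons (env d) (cons (encA (f s′)) (listTree (map encT xs))) ≡ enc d (next s c)
    body-result d (x ∷ xs , _ , s) c = refl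

    body : Realizes {Σ D (λ d → Σ (S d) (λ s → continue s ≡ true))} (N ∘ proj₁)
      (λ (d , s , _) → enc d s) (λ (d , s , c) → enc d (next s c))
    body = resource (λ (d , s , c) → body-input d s c)
      (retarget (λ (d , s , c) → body-result d s c)
        (reindex (λ (d , s , c) → d , split s c) body′))
      where
      body′ : Realizes {Σ D (λ d → Σ (T d × List (T d)) (λ (x , xs) → A d (x ∷ xs)))}
        (N ∘ proj₁)
        (λ (d , (x , xs) , s) → cons (env d) (cons (encA s) (listTree (map encT (x ∷ xs)))))
        (λ (d , (x , xs) , s) → cons (env d) (cons (encA (f s)) (listTree (map encT xs))))
      body′ = pair ⌜ x₀ ₁ ⌝ (pair
        (⌜ cons (x₀ ₁) (cons (x₀ ₂ ₁) (x₀ ₂ ₂ ₁)) ⌝ ⟫ step) ⌜ x₀ ₂ ₂ ₂ ⌝)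

  fold-realizes : (xs : ∀ d → List (T d)) → (∀ d → length (xs d) ≤ N d) →
    (s : ∀ d → A d (xs d)) →
    Realizes N (λ d → cons (env d) (cons (encA (s d)) (listTree (map encT (xs d)))))
      (λ d → encA (fold (xs d) (s d)))
  fold-realizes xs bound s =
    retarget (λ d → outcome-fold (halts (state d)))
      (reindex (λ d → d , state d) (iterate-realizes enc identity (proj₁ ∘ proj₂)
        (retarget (λ (_ , s) → cong boolTree (isCons-list s)) (⌜ x₀ ₂ ₂ ⌝ ⟫ nonNil))
        body))
    ⟫ ⌜ x₀ ₂ ₁ ⌝
    where
    state : ∀ d → S d
    state d = xs d , bound d , s d

reverse-realizes : ∀ {D N} {T : D → Set} (encT : ∀ {d} → T d → Tree)
  (xs : ∀ d → List (T d)) → (∀ d → length (xs d) ≤ N d) →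
  Realizes N (λ d → listTree (map encT (xs d))) (λ d → listTree (map encT (reverse (xs d))))
reverse-realizes {T = T} encT xs bound =
  ⌜ cons nil (cons nil x₀) ⌝ ⟫
  retarget (λ d → cong (listTree ∘ map encT) (fold≡reverseAcc (xs d) []))
    (fold-realizes xs bound (λ _ → []))
  where
  open Fold encT (λ _ → nil) {A = λ d _ → List (T d)} (λ ys → listTree (map encT ys))
    (λ {_} {x} ys → x ∷ ys) ⌜ cons (x₀ ₂ ₂) (x₀ ₂ ₁) ⌝
  fold≡reverseAcc : ∀ {d} (xs ys : List (T d)) → fold xs ys ≡ reverseAcc ys xs
  fold≡reverseAcc []       ys = refl
  fold≡reverseAcc (x ∷ xs) ys = fold≡reverseAcc xs (x ∷ ys)

module _ {A : Set} where

  ∈-reverseAcc : ∀ {x} {ys : List A} xs → x ∈ ys → x ∈ reverseAcc ys xs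
  ∈-reverseAcc []       x∈ys = x∈ys
  ∈-reverseAcc (z ∷ xs) x∈ys = ∈-reverseAcc xs (there x∈ys)

  length≤reverseAcc : ∀ {ys : List A} xs → length ys ≤ length (reverseAcc ys xs)
  length≤reverseAcc []       = ≤-refl
  length≤reverseAcc (z ∷ xs) = ≤-trans (n≤1+n _) (length≤reverseAcc xs)

module _ {D : Set} {N : D → ℕ} {T : D → Set} (encT : ∀ {d} → T d → Tree) (env : D → Tree)
  (xs : ∀ d → List (T d)) (bound : ∀ d → length (xs d) ≤ N d) where

  Suffix : D → Set
  Suffix d = Σ (T d × List (T d)) (λ (x , ys) → x ∈ xs d × length ys ≤ N d)

  -- A loop consumes a list from the front while `g` is built up from the back, so the list is
  -- reversed first. The accumulator remembers, for the specification, the suffix treated so far;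
  -- the equation with `reverseAcc` makes it all of `xs d` in the end.
  recursion : (g : ∀ d → List (T d) → Tree) →
    Realizes {Σ D Suffix} (N ∘ proj₁)
      (λ (d , (x , ys) , _) → cons (env d) (cons (g d ys) (encT x)))
      (λ (d , (x , ys) , _) → g d (x ∷ ys)) →
    Realizes N (λ d → cons (env d) (cons (g d []) (listTree (map encT (xs d)))))
      (λ d → g d (xs d))
  recursion g step =
    pair ⌜ x₀ ₁ ⌝ (pair ⌜ x₀ ₂ ₁ ⌝ (⌜ x₀ ₂ ₂ ⌝ ⟫ reverse-realizes encT xs bound)) ⟫
    retarget (λ d → cong (g d) (proj₂ (fold (reverse (xs d)) (start d))))
      (fold-realizes (reverse ∘ xs)
        (λ d → subst (_≤ N d) (sym (length-reverse (xs d))) (bound d)) start)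
    where
    A : ∀ d → List (T d) → Set
    A d zs = Σ (List (T d)) (λ ys → reverseAcc ys zs ≡ xs d)
    open Fold encT env {A} (λ {d} (ys , _) → g d ys) (λ {_} {x} (ys , eq) → x ∷ ys , eq)
      (reindex (λ (d , (x , zs) , ys , eq) → d , (x , ys) ,
          subst (x ∈_) eq (∈-reverseAcc zs (here refl)) ,
          ≤-trans (≤-trans (length≤reverseAcc (x ∷ zs)) (≤-reflexive (cong length eq)))
            (bound d))
        step)
    start : ∀ d → A d (reverse (xs d))
    start d = [] , reverse-involutive (xs d)

  module _ {P : ∀ d → T d → Set} (P? : ∀ d → Decidable (P d))
    (decide : Realizes {Σ D (λ d → Σ (T d) (_∈ xs d))} (N ∘ proj₁)
      (λ (d , x , _) → cons (env d) (encT x)) (λ (d , x , _) → boolTree (does (P? d x))))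
    where

    private
      decide′ : Realizes {Σ D Suffix} (N ∘ proj₁)
        (λ (d , (x , ys) , _) → cons (env d) (encT x))
        (λ (d , (x , ys) , _) → boolTree (does (P? d x)))
      decide′ = reindex (λ (d , (x , _) , x∈xs , _) → d , x , x∈xs) decide

    any-realizes : Realizes N (λ d → cons (env d) (listTree (map encT (xs d))))
      (λ d → boolTree (does (any? (P? d) (xs d))))
    any-realizes = ⌜ cons (x₀ ₁) (cons nil (x₀ ₂)) ⌝ ⟫
      recursion (λ d ys → boolTree (does (any? (P? d) ys)))
        (or (⌜ cons (x₀ ₁) (x₀ ₂ ₂) ⌝ ⟫ decide′) ⌜ x₀ ₂ ₁ ⌝)

    filter-realizes : Realizes N (λ d → cons (env d) (listTree (map encT (xs d))))
      (λ d → listTree (map encT (filter (P? d) (xs d))))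
    filter-realizes = ⌜ cons (x₀ ₁) (cons nil (x₀ ₂)) ⌝ ⟫
      recursion (λ d ys → listTree (map encT (filter (P? d) ys)))
        (retarget (λ (d , (x , ys) , _) → lemma d x ys)
          (branch (⌜ cons (x₀ ₁) (x₀ ₂ ₂) ⌝ ⟫ decide′) ⌜ cons (x₀ ₂ ₂) (x₀ ₂ ₁) ⌝ ⌜ x₀ ₂ ₁ ⌝))
      where
      lemma : ∀ d x ys →
        (Bool.if does (P? d x) then cons (encT x) (listTree (map encT (filter (P? d) ys)))
          else listTree (map encT (filter (P? d) ys)))
        ≡ listTree (map encT (filter (P? d) (x ∷ ys)))
      lemma d x ys with does (P? d x)
      ... | true  = refl
      ... | false = refl

append-realizes : ∀ {D N} {T : D → Set} (encT : ∀ {d} → T d → Tree)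
  (xs ys : ∀ d → List (T d)) → (∀ d → length (xs d) ≤ N d) →
  Realizes N (λ d → cons (listTree (map encT (xs d))) (listTree (map encT (ys d))))
    (λ d → listTree (map encT (xs d ++ ys d)))
append-realizes encT xs ys bound = ⌜ cons nil (cons (x₀ ₂) (x₀ ₁)) ⌝ ⟫
  recursion encT (λ _ → nil) xs bound (λ d zs → listTree (map encT (zs ++ ys d)))
    ⌜ cons (x₀ ₂ ₂) (x₀ ₂ ₁) ⌝

tails : ℕ → Expr → Expr
tails zero    e = e
tails (suc c) e = tails c (e ₂)

-- For each element of `xs`, `c` elements are removed from `ys`; the inequality holds precisely if
-- nothing remains. As `c` is a constant, the removals of one round form a single expression.
covers-realizes : ∀ c {D N} {T U : D → Set} (encT : ∀ {d} → T d → Tree) (encU : ∀ {d} → U d → Tree)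
  (xs : ∀ d → List (T d)) (ys : ∀ d → List (U d)) → (∀ d → length (xs d) ≤ N d) →
  Realizes N (λ d → cons (listTree (map encT (xs d))) (listTree (map encU (ys d))))
    (λ d → boolTree (does (length (ys d) ≤? length (xs d) * c)))
covers-realizes c {T = T} {U = U} encT encU xs ys bound =
  ⌜ cons nil (cons (x₀ ₂) (x₀ ₁)) ⌝ ⟫
  recursion encT (λ _ → nil) xs bound g
    (retarget (λ (d , (x , zs) , _) → step d zs) ⌜ tails c (x₀ ₂ ₁) ⌝) ⟫
  retarget (λ d → cong boolTree (exhausted (ys d) (length (xs d) * c))) (negate nonNil)
  where
  g : ∀ d → List (T d) → Tree
  g d zs = listTree (map encU (drop (length zs * c) (ys d)))

  tail-drop : ∀ {d} (us : List (U d)) → right (listTree (map encU us)) ≡ listTree (map encU (drop 1 us))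
  tail-drop []       = refl
  tail-drop (_ ∷ us) = refl

  tails-drop : ∀ {d} k (us : List (U d)) e {σ} → eval e σ ≡ listTree (map encU us) →
    eval (tails k e) σ ≡ listTree (map encU (drop k us))
  tails-drop zero    us e eq = eq
  tails-drop (suc k) us e eq = trans
    (tails-drop k (drop 1 us) (e ₂) (trans (cong right eq) (tail-drop us)))
    (cong (listTree ∘ map encU) (drop-drop 1 k us))

  step : ∀ d zs {t} → eval (tails c (x₀ ₂ ₁)) (λ _ → cons nil (cons (g d zs) t)) ≡
    listTree (map encU (drop (suc (length zs) * c) (ys d)))
  step d zs = trans (tails-drop c (drop (length zs * c) (ys d)) (x₀ ₂ ₁) refl)
    (cong (listTree ∘ map encU) (trans (drop-drop (length zs * c) c (ys d))
      (cong (λ k → drop k (ys d)) (+-comm (length zs * c) c))))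

  exhausted : ∀ {d} (us : List (U d)) k →
    not (isCons (listTree (map encU (drop k us)))) ≡ does (length us ≤? k)
  exhausted []       zero    = refl
  exhausted []       (suc k) = refl
  exhausted (_ ∷ us) zero    = refl
  exhausted (_ ∷ us) (suc k) = trans (exhausted us k) (sym (≤?-suc (length us) k))
    where
    ≤?-suc : ∀ m n → does (suc m ≤? suc n) ≡ does (m ≤? n)
    ≤?-suc zero    n = refl
    ≤?-suc (suc m) n = refl

does-unique : ∀ {A : Set} (A? : Dec A) {b} → (b ≡ true → A) → (A → b ≡ true) → b ≡ does A?
does-unique (yes a) f g = g a
does-unique (no ¬a) {true}  f g = contradiction (f refl) ¬a
does-unique (no ¬a) {false} f g = refl

-- Follows the loop that computes it: the second vector is consumed as a list, and where it has run
-- out `left nil` is read as `false`.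
common : ∀ {n} → Subset n → List Bool → Bool
common Vec.[]       q       = false
common (b Vec.∷ p) []       = false ∨ common p []
common (b Vec.∷ p) (c ∷ q) = (b ∧ c) ∨ common p q

common-sound : ∀ {n} (p q : Subset n) → common p (Vec.toList q) ≡ true → Nonempty (p ∩ q)
common-sound (true Vec.∷ p)  (true Vec.∷ q)  eq = zero , Vec.here
common-sound (true Vec.∷ p)  (false Vec.∷ q) eq with common-sound p q eq
... | i , i∈ = suc i , Vec.there i∈
common-sound (false Vec.∷ p) (_ Vec.∷ q)     eq with common-sound p q eq
... | i , i∈ = suc i , Vec.there i∈

common-complete : ∀ {n} (p q : Subset n) → Nonempty (p ∩ q) → common p (Vec.toList q) ≡ true
common-complete (true Vec.∷ p)  (true Vec.∷ q)  _ = refl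
common-complete (true Vec.∷ p)  (false Vec.∷ q) (suc i , Vec.there i∈) =
  common-complete p q (i , i∈)
common-complete (false Vec.∷ p) (_ Vec.∷ q)     (suc i , Vec.there i∈) =
  common-complete p q (i , i∈)

intersect-realizes : ∀ {D N} {n : D → ℕ} → (∀ d → n d ≤ N d) → (p q : ∀ d → Subset (n d)) →
  Realizes N (λ d → cons (subsetTree (p d)) (subsetTree (q d)))
    (λ d → boolTree (does (nonempty? (p d ∩ q d))))
intersect-realizes {D} {N} {n} n≤N p q =
  ⌜ cons nil (cons (cons nil (x₀ ₂)) (x₀ ₁)) ⌝ ⟫
  fold-realizes (λ d → Vec.toList (p d))
    (λ d → ≤-trans (≤-reflexive (length-toList (p d))) (n≤N d))
    (λ d → false , Vec.toList (q d)) ⟫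
  retarget (λ d → cong boolTree (trans (fold-common (p d) false (Vec.toList (q d)))
      (does-unique (nonempty? (p d ∩ q d)) (common-sound (p d) (q d))
        (common-complete (p d) (q d)))))
    ⌜ x₀ ₁ ⌝
  where
  length-toList : ∀ {m} (v : Subset m) → length (Vec.toList v) ≡ m
  length-toList Vec.[]      = refl
  length-toList (_ Vec.∷ v) = cong suc (length-toList v)

  first : List Bool → Bool
  first []      = false
  first (b ∷ _) = b

  bits : List Bool → Tree
  bits = listTree ∘ map boolTree

  left-bits : ∀ bs → left (bits bs) ≡ boolTree (first bs)
  left-bits []      = refl
  left-bits (_ ∷ _) = refl

  right-bits : ∀ bs → right (bits bs) ≡ bits (drop 1 bs)
  right-bits []      = refl
  right-bits (_ ∷ _) = refl

  open Fold {D} {N} {λ _ → Bool} boolTree (λ _ → nil) {λ _ _ → Bool × List Bool}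
    (λ (b , bs) → cons (boolTree b) (bits bs))
    (λ {_} {x} (b , bs) → b ∨ (x ∧ first bs) , drop 1 bs)
    (pair (or ⌜ x₀ ₂ ₁ ₁ ⌝ (and ⌜ x₀ ₂ ₂ ⌝
        (retarget (λ (_ , _ , _ , bs) → left-bits bs) ⌜ x₀ ₂ ₁ ₂ ₁ ⌝)))
      (retarget (λ (_ , _ , _ , bs) → right-bits bs) ⌜ x₀ ₂ ₁ ₂ ₂ ⌝))

  fold-common : ∀ {d m} (v : Subset m) b bs →
    proj₁ (fold {d} (Vec.toList v) (b , bs)) ≡ b ∨ common v bs
  fold-common Vec.[]      b bs       = sym (∨-identityʳ b)
  fold-common {d} (x Vec.∷ v) b []       = trans (fold-common {d} v (b ∨ (x ∧ false)) [])
    (trans (∨-assoc b _ _) (cong (λ c → b ∨ (c ∨ _)) (∧-false x)))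
    where
    ∧-false : ∀ x → x ∧ false ≡ false
    ∧-false true  = refl
    ∧-false false = refl
  fold-common {d} (x Vec.∷ v) b (c ∷ bs) = trans (fold-common {d} v (b ∨ (x ∧ c)) bs)
    (∨-assoc b _ _)

-- The search and its implementation

module _ {a b : ℕ} where

  MeetsA MeetsB : Edge a b → Edge a b → Set
  MeetsA e f = Nonempty (proj₁ e ∩ proj₁ f)
  MeetsB e f = Nonempty (proj₂ e ∩ proj₂ f)

  meetsA? : ∀ e f → Dec (MeetsA e f)
  meetsA? e f = nonempty? (proj₁ e ∩ proj₁ f)

  meetsB? : ∀ e f → Dec (MeetsB e f)
  meetsB? e f = nonempty? (proj₂ e ∩ proj₂ f)

  Stack : Set
  Stack = List (List (Edge a b))

  Touched : Stack → Edge a b → Set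
  Touched Xs m = Any (Any (MeetsB m)) Xs

  touched? : ∀ Xs m → Dec (Touched Xs m)
  touched? Xs m = any? (any? (meetsB? m)) Xs

  module Search (M : List (Edge a b)) where

    -- Layer edges are kept pairwise far apart in this sense, so that an edge of `M` meets at most
    -- one of them in B.
    Near : Edge a b → Edge a b → Set
    Near e x = MeetsB e x ⊎ Any (λ m → MeetsB m e × MeetsB m x) M

    near? : ∀ e x → Dec (Near e x)
    near? e x = meetsB? e x ⊎-dec any? (λ m → meetsB? m e ×-dec meetsB? m x) M

    -- The first clause says that the vertex of A in `e` has been reached: it is unmatched or its
    -- edge of `M` is touched.
    Eligible : Stack → List (Edge a b) → Edge a b → Set
    Eligible Xs X e =
      ¬ Any (λ m → MeetsA e m × ¬ Touched Xs m) M ×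
      ¬ Any (λ x → MeetsA e x ⊎ Near e x) X ×
      ¬ Any (Any (Near e)) Xs

    eligible? : ∀ Xs X e → Dec (Eligible Xs X e)
    eligible? Xs X e =
      ¬? (any? (λ m → meetsA? e m ×-dec ¬? (touched? Xs m)) M) ×-dec
      (¬? (any? (λ x → meetsA? e x ⊎-dec near? e x) X) ×-dec
      ¬? (any? (any? (near? e)) Xs))

    greedy : Stack → List (Edge a b) → List (Edge a b)
    greedy Xs []       = []
    greedy Xs (e ∷ es) = Bool.if does (eligible? Xs (greedy Xs es) e)
      then e ∷ greedy Xs es else greedy Xs es

    length-greedy : ∀ Xs es → length (greedy Xs es) ≤ length es
    length-greedy Xs []       = z≤n
    length-greedy Xs (e ∷ es) with does (eligible? Xs (greedy Xs es) e)
    ... | true  = s≤s (length-greedy Xs es)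
    ... | false = m≤n⇒m≤1+n (length-greedy Xs es)

    blocking immediate : List (Edge a b) → List (Edge a b)
    blocking X  = filter (λ m → any? (meetsB? m) X) M
    immediate X = filter (λ x → ¬? (any? (meetsB? x) M)) X

    -- These edges can take the place of edges of `M` that meet the layer `X`. Swapping no others
    -- protects the layers below `X`.
    select : List (Edge a b) → List (Edge a b) → List (Edge a b)
    select I X = filter (λ x → any? (meetsA? x) (blocking X)) I

    replace : List (Edge a b) → List (Edge a b)
    replace J = J ++ filter (λ m → ¬? (any? (meetsA? m) J)) M

    -- Seeks the topmost layer at which a swap removes at least a `c`-th of the blocking edges. If
    -- there is none, all of `I` is returned: it then displaces so few edges of `M` that the swap
    -- enlarges `M`.
    walk : ℕ → List (Edge a b) → Stack → List (Edge a b) × Stack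
    walk c I []       = I , []
    walk c I (X ∷ Xs) =
      Bool.if does (length (blocking X) ≤? length (select I X) * c)
      then (select I X , X ∷ Xs) else walk c I Xs

    collapse : ℕ → List (Edge a b) → Stack → List (Edge a b) × Stack
    collapse c I Xs = let (J , Ys) = walk c I Xs in replace J , Ys

  open Search

  step : (μ c : ℕ) (es M : List (Edge a b)) → Stack → List (Edge a b) × Stack
  step μ c es M []       = M , greedy M [] es ∷ []
  step μ c es M (X ∷ Xs) =
    Bool.if does (length X ≤? length (immediate M X) * μ)
    then collapse M c (immediate M X) Xs
    else (M , greedy M (X ∷ Xs) es ∷ X ∷ Xs)

open Search

stackTree : ∀ {a b} → Stack {a} {b} → Tree
stackTree = listTree ∘ map edgesTree

pairTree : ∀ {a b} → List (Edge a b) × Stack {a} {b} → Tree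
pairTree (M , Xs) = cons (edgesTree M) (stackTree Xs)

module _ {D : Set} {N a b : D → ℕ} (a≤N : ∀ d → a d ≤ N d) (b≤N : ∀ d → b d ≤ N d) where

  meetsA-realizes : (e f : ∀ d → Edge (a d) (b d)) →
    Realizes N (λ d → cons (edgeTree (e d)) (edgeTree (f d)))
      (λ d → boolTree (does (meetsA? (e d) (f d))))
  meetsA-realizes e f = ⌜ cons (x₀ ₁ ₁) (x₀ ₂ ₁) ⌝ ⟫
    intersect-realizes a≤N (λ d → proj₁ (e d)) (λ d → proj₁ (f d))

  meetsB-realizes : (e f : ∀ d → Edge (a d) (b d)) →
    Realizes N (λ d → cons (edgeTree (e d)) (edgeTree (f d)))
      (λ d → boolTree (does (meetsB? (e d) (f d))))
  meetsB-realizes e f = ⌜ cons (x₀ ₁ ₂) (x₀ ₂ ₂) ⌝ ⟫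
    intersect-realizes b≤N (λ d → proj₂ (e d)) (λ d → proj₂ (f d))

-- Time is measured by `N d` and not by the tree at hand, so each list that is looped over needs its
-- own bound.
Short : ∀ {D : Set} (N : D → ℕ) {T : D → Set} → (∀ d → List (T d)) → Set
Short N xs = ∀ d → length (xs d) ≤ N d

ShortStack : ∀ {D : Set} (N : D → ℕ) {T : D → Set} → (∀ d → List (List (T d))) → Set
ShortStack N Xs = Short N Xs × (∀ d {X} → X ∈ Xs d → length X ≤ N d)

module _ {D : Set} {N a b : D → ℕ} (a≤N : ∀ d → a d ≤ N d) (b≤N : ∀ d → b d ≤ N d)
  (e : ∀ d → Edge (a d) (b d)) (X : ∀ d → List (Edge (a d) (b d))) (X-short : Short N X) where

  anyMeetsA-realizes : Realizes N (λ d → cons (edgeTree (e d)) (edgesTree (X d)))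
    (λ d → boolTree (does (any? (meetsA? (e d)) (X d))))
  anyMeetsA-realizes = any-realizes edgeTree (edgeTree ∘ e) X X-short (λ d → meetsA? (e d))
    (meetsA-realizes (a≤N ∘ proj₁) (b≤N ∘ proj₁) _ _)

  anyMeetsB-realizes : Realizes N (λ d → cons (edgeTree (e d)) (edgesTree (X d)))
    (λ d → boolTree (does (any? (meetsB? (e d)) (X d))))
  anyMeetsB-realizes = any-realizes edgeTree (edgeTree ∘ e) X X-short (λ d → meetsB? (e d))
    (meetsB-realizes (a≤N ∘ proj₁) (b≤N ∘ proj₁) _ _)

module _ {D : Set} {N a b : D → ℕ} (a≤N : ∀ d → a d ≤ N d) (b≤N : ∀ d → b d ≤ N d)
  (Xs : ∀ d → Stack {a d} {b d}) (Xs-short : ShortStack N Xs) where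

  touched-realizes : (m : ∀ d → Edge (a d) (b d)) →
    Realizes N (λ d → cons (edgeTree (m d)) (stackTree (Xs d)))
      (λ d → boolTree (does (touched? (Xs d) (m d))))
  touched-realizes m = any-realizes edgesTree (edgeTree ∘ m) Xs (proj₁ Xs-short)
    (λ d → any? (meetsB? (m d)))
    (anyMeetsB-realizes (a≤N ∘ proj₁) (b≤N ∘ proj₁) _ _
      (λ (d , _ , X∈) → proj₂ Xs-short d X∈))

module _ {D : Set} {N a b : D → ℕ} (a≤N : ∀ d → a d ≤ N d) (b≤N : ∀ d → b d ≤ N d)
  (M : ∀ d → List (Edge (a d) (b d))) (M-short : Short N M) where

  near-realizes : (e x : ∀ d → Edge (a d) (b d)) →
    Realizes N (λ d → cons (cons (edgesTree (M d)) (edgeTree (e d))) (edgeTree (x d)))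
      (λ d → boolTree (does (near? (M d) (e d) (x d))))
  near-realizes e x = or
    (⌜ cons (x₀ ₁ ₂) (x₀ ₂) ⌝ ⟫ meetsB-realizes a≤N b≤N e x)
    (⌜ cons (cons (x₀ ₁ ₂) (x₀ ₂)) (x₀ ₁ ₁) ⌝ ⟫
      any-realizes edgeTree (λ d → cons (edgeTree (e d)) (edgeTree (x d))) M M-short
        (λ d m → meetsB? m (e d) ×-dec meetsB? m (x d))
        (and (⌜ cons (x₀ ₂) (x₀ ₁ ₁) ⌝ ⟫ meetsB-realizes (a≤N ∘ proj₁) (b≤N ∘ proj₁) _ _)
             (⌜ cons (x₀ ₂) (x₀ ₁ ₂) ⌝ ⟫ meetsB-realizes (a≤N ∘ proj₁) (b≤N ∘ proj₁) _ _)))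

module _ {D : Set} {N a b : D → ℕ} (a≤N : ∀ d → a d ≤ N d) (b≤N : ∀ d → b d ≤ N d)
  (M : ∀ d → List (Edge (a d) (b d))) (M-short : Short N M)
  (Xs : ∀ d → Stack {a d} {b d}) (Xs-short : ShortStack N Xs) where

  eligible-realizes : (X : ∀ d → List (Edge (a d) (b d))) → Short N X →
    (e : ∀ d → Edge (a d) (b d)) →
    Realizes N
      (λ d → cons (pairTree (M d , Xs d)) (cons (edgesTree (X d)) (edgeTree (e d))))
      (λ d → boolTree (does (eligible? (M d) (Xs d) (X d) (e d))))
  eligible-realizes X X-short e = and
    (negate (⌜ cons (cons (x₀ ₂ ₂) (x₀ ₁ ₂)) (x₀ ₁ ₁) ⌝ ⟫
      any-realizes edgeTree (λ d → cons (edgeTree (e d)) (stackTree (Xs d))) M M-short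
        (λ d m → meetsA? (e d) m ×-dec ¬? (touched? (Xs d) m))
        (and (⌜ cons (x₀ ₁ ₁) (x₀ ₂) ⌝ ⟫ meetsA-realizes (a≤N ∘ proj₁) (b≤N ∘ proj₁) _ _)
          (negate (⌜ cons (x₀ ₂) (x₀ ₁ ₂) ⌝ ⟫
            touched-realizes (a≤N ∘ proj₁) (b≤N ∘ proj₁) (Xs ∘ proj₁)
              (proj₁ Xs-short ∘ proj₁ , λ (d , _) → proj₂ Xs-short d) _)))))
    (and
      (negate (⌜ cons (cons (x₀ ₁ ₁) (x₀ ₂ ₂)) (x₀ ₂ ₁) ⌝ ⟫
        any-realizes edgeTree M×e X X-short
          (λ d x → meetsA? (e d) x ⊎-dec near? (M d) (e d) x)
          (or (⌜ cons (x₀ ₁ ₂) (x₀ ₂) ⌝ ⟫ meetsA-realizes (a≤N ∘ proj₁) (b≤N ∘ proj₁) _ _)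
            (near-realizes (a≤N ∘ proj₁) (b≤N ∘ proj₁) (M ∘ proj₁) (M-short ∘ proj₁) _ _))))
      (negate (⌜ cons (cons (x₀ ₁ ₁) (x₀ ₂ ₂)) (x₀ ₁ ₂) ⌝ ⟫
        any-realizes edgesTree M×e Xs (proj₁ Xs-short)
          (λ d → any? (near? (M d) (e d)))
          (any-realizes edgeTree (M×e ∘ proj₁) (λ (_ , Y , _) → Y)
            (λ (d , _ , Y∈) → proj₂ Xs-short d Y∈)
            (λ (d , _) → near? (M d) (e d))
            (near-realizes (a≤N ∘ proj₁ ∘ proj₁) (b≤N ∘ proj₁ ∘ proj₁)
              (M ∘ proj₁ ∘ proj₁) (M-short ∘ proj₁ ∘ proj₁) _ _)))))
    where
    M×e : D → Tree
    M×e d = cons (edgesTree (M d)) (edgeTree (e d))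

length-walk : ∀ {a b} (M : List (Edge a b)) c I Xs → length (proj₁ (walk M c I Xs)) ≤ length I
length-walk M c I []       = ≤-refl
length-walk M c I (X ∷ Xs) with does (length (blocking M X) ≤? length (select M I X) * c)
... | true  = length-filter _ I
... | false = length-walk M c I Xs

module _ {D : Set} {N a b : D → ℕ} (a≤N : ∀ d → a d ≤ N d) (b≤N : ∀ d → b d ≤ N d)
  (M : ∀ d → List (Edge (a d) (b d))) (M-short : Short N M) where

  greedy-realizes : (Xs : ∀ d → Stack {a d} {b d}) → ShortStack N Xs →
    (es : ∀ d → List (Edge (a d) (b d))) → Short N es →
    Realizes N (λ d → cons (pairTree (M d , Xs d)) (edgesTree (es d)))
      (λ d → edgesTree (greedy (M d) (Xs d) (es d)))
  greedy-realizes Xs Xs-short es es-short = ⌜ cons (x₀ ₁) (cons nil (x₀ ₂)) ⌝ ⟫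
    recursion edgeTree (λ d → pairTree (M d , Xs d)) es es-short
      (λ d fs → edgesTree (greedy (M d) (Xs d) fs))
      (retarget (λ (d , (f , fs) , _) → lemma d f fs)
        (branch
          (eligible-realizes (a≤N ∘ proj₁) (b≤N ∘ proj₁) (M ∘ proj₁) (M-short ∘ proj₁)
            (Xs ∘ proj₁) (proj₁ Xs-short ∘ proj₁ , λ (d , _) → proj₂ Xs-short d)
            (λ (d , (_ , fs) , _) → greedy (M d) (Xs d) fs)
            (λ (d , (_ , fs) , _ , fs≤N) → ≤-trans (length-greedy (M d) (Xs d) fs) fs≤N)
            (λ (_ , (f , _) , _) → f))
          ⌜ cons (x₀ ₂ ₂) (x₀ ₂ ₁) ⌝ ⌜ x₀ ₂ ₁ ⌝))
    where
    lemma : ∀ d f fs →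
      (Bool.if does (eligible? (M d) (Xs d) (greedy (M d) (Xs d) fs) f)
        then cons (edgeTree f) (edgesTree (greedy (M d) (Xs d) fs))
        else edgesTree (greedy (M d) (Xs d) fs))
      ≡ edgesTree (greedy (M d) (Xs d) (f ∷ fs))
    lemma d f fs with does (eligible? (M d) (Xs d) (greedy (M d) (Xs d) fs) f)
    ... | true  = refl
    ... | false = refl

  blocking-realizes : (X : ∀ d → List (Edge (a d) (b d))) → Short N X →
    Realizes N (λ d → cons (edgesTree (X d)) (edgesTree (M d)))
      (λ d → edgesTree (blocking (M d) (X d)))
  blocking-realizes X X-short = filter-realizes edgeTree (edgesTree ∘ X) M M-short
    (λ d m → any? (meetsB? m) (X d))
    (⌜ cons (x₀ ₂) (x₀ ₁) ⌝ ⟫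
      anyMeetsB-realizes (a≤N ∘ proj₁) (b≤N ∘ proj₁) (λ (_ , m , _) → m) (X ∘ proj₁)
        (X-short ∘ proj₁))

  immediate-realizes : (X : ∀ d → List (Edge (a d) (b d))) → Short N X →
    Realizes N (λ d → cons (edgesTree (M d)) (edgesTree (X d)))
      (λ d → edgesTree (immediate (M d) (X d)))
  immediate-realizes X X-short = filter-realizes edgeTree (edgesTree ∘ M) X X-short
    (λ d x → ¬? (any? (meetsB? x) (M d)))
    (negate (⌜ cons (x₀ ₂) (x₀ ₁) ⌝ ⟫
      anyMeetsB-realizes (a≤N ∘ proj₁) (b≤N ∘ proj₁) (λ (_ , x , _) → x) (M ∘ proj₁)
        (M-short ∘ proj₁)))

  select-realizes : (I X : ∀ d → List (Edge (a d) (b d))) → Short N I → Short N X →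
    Realizes N (λ d → cons (cons (edgesTree (M d)) (edgesTree (I d))) (edgesTree (X d)))
      (λ d → edgesTree (select (M d) (I d) (X d)))
  select-realizes I X I-short X-short =
    pair (⌜ cons (x₀ ₂) (x₀ ₁ ₁) ⌝ ⟫ blocking-realizes X X-short) ⌜ x₀ ₁ ₂ ⌝ ⟫
    filter-realizes edgeTree (λ d → edgesTree (blocking (M d) (X d))) I I-short
      (λ d x → any? (meetsA? x) (blocking (M d) (X d)))
      (⌜ cons (x₀ ₂) (x₀ ₁) ⌝ ⟫
        anyMeetsA-realizes (a≤N ∘ proj₁) (b≤N ∘ proj₁) (λ (_ , x , _) → x)
          (λ (d , _) → blocking (M d) (X d))
          (λ (d , _) → ≤-trans (length-filter _ (M d)) (M-short d)))

  replace-realizes : (J : ∀ d → List (Edge (a d) (b d))) → Short N J →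
    Realizes N (λ d → cons (edgesTree (J d)) (edgesTree (M d)))
      (λ d → edgesTree (replace (M d) (J d)))
  replace-realizes J J-short =
    pair ⌜ x₀ ₁ ⌝
      (filter-realizes edgeTree (edgesTree ∘ J) M M-short
        (λ d m → ¬? (any? (meetsA? m) (J d)))
        (negate (⌜ cons (x₀ ₂) (x₀ ₁) ⌝ ⟫
          anyMeetsA-realizes (a≤N ∘ proj₁) (b≤N ∘ proj₁) (λ (_ , m , _) → m) (J ∘ proj₁)
            (J-short ∘ proj₁)))) ⟫
    append-realizes edgeTree J (λ d → filter (λ m → ¬? (any? (meetsA? m) (J d))) (M d)) J-short

module _ {D : Set} {N a b : D → ℕ} (a≤N : ∀ d → a d ≤ N d) (b≤N : ∀ d → b d ≤ N d)
  (M : ∀ d → List (Edge (a d) (b d))) (M-short : Short N M) where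

  walk-realizes : ∀ c (I : ∀ d → List (Edge (a d) (b d))) → Short N I →
    (Xs : ∀ d → Stack {a d} {b d}) → ShortStack N Xs →
    Realizes N
      (λ d → cons (cons (edgesTree (M d)) (edgesTree (I d))) (stackTree (Xs d)))
      (λ d → pairTree (walk (M d) c (I d) (Xs d)))
  walk-realizes c I I-short Xs Xs-short =
    ⌜ cons (x₀ ₁) (cons (cons nil (cons (x₀ ₁ ₂) nil)) (x₀ ₂)) ⌝ ⟫
    recursion edgesTree (λ d → cons (edgesTree (M d)) (edgesTree (I d))) Xs (proj₁ Xs-short)
      -- The stack below the present layer is carried along, since it is part of the result if the
      -- threshold is met there.
      (λ d Ys → cons (stackTree Ys) (pairTree (walk (M d) c (I d) Ys)))
      (pair ⌜ cons (x₀ ₂ ₂) (x₀ ₂ ₁ ₁) ⌝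
        (retarget (λ (d , (X , Ys) , _) → lemma d X Ys)
          (branch
            (pair select-top (⌜ cons (x₀ ₂ ₂) (x₀ ₁ ₁) ⌝ ⟫ block) ⟫
              covers-realizes c edgeTree edgeTree
                (λ (d , (X , _) , _) → select (M d) (I d) X)
                (λ (d , (X , _) , _) → blocking (M d) X)
                (λ (d , _) → ≤-trans (length-filter _ (I d)) (I-short d)))
            (pair select-top ⌜ cons (x₀ ₂ ₂) (x₀ ₂ ₁ ₁) ⌝)
            ⌜ x₀ ₂ ₁ ₂ ⌝))) ⟫
    ⌜ x₀ ₂ ⌝
    where
    S : Set
    S = Σ D (Suffix {N = N} edgesTree (λ _ → nil) Xs (proj₁ Xs-short))

    top : ∀ (s : S) → List (Edge (a (proj₁ s)) (b (proj₁ s)))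
    top (_ , (X , _) , _) = X

    top-short : Short (N ∘ proj₁) top
    top-short (d , _ , X∈ , _) = proj₂ Xs-short d X∈

    block : Realizes {S} (N ∘ proj₁) (λ s → cons (edgesTree (top s)) (edgesTree (M (proj₁ s))))
      (λ s → edgesTree (blocking (M (proj₁ s)) (top s)))
    block = blocking-realizes (a≤N ∘ proj₁) (b≤N ∘ proj₁) (M ∘ proj₁) (M-short ∘ proj₁)
      top top-short

    select-top : ∀ {t : S → Tree} → Realizes {S} (N ∘ proj₁)
      (λ s → cons (cons (edgesTree (M (proj₁ s))) (edgesTree (I (proj₁ s))))
        (cons (t s) (edgesTree (top s))))
      (λ s → edgesTree (select (M (proj₁ s)) (I (proj₁ s)) (top s)))
    select-top = ⌜ cons (x₀ ₁) (x₀ ₂ ₂) ⌝ ⟫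
      select-realizes (a≤N ∘ proj₁) (b≤N ∘ proj₁) (M ∘ proj₁) (M-short ∘ proj₁)
        (I ∘ proj₁) top (I-short ∘ proj₁) top-short

    lemma : ∀ d X Ys →
      (Bool.if does (length (blocking (M d) X) ≤? length (select (M d) (I d) X) * c)
        then cons (edgesTree (select (M d) (I d) X)) (stackTree (X ∷ Ys))
        else pairTree (walk (M d) c (I d) Ys))
      ≡ pairTree (walk (M d) c (I d) (X ∷ Ys))
    lemma d X Ys with does (length (blocking (M d) X) ≤? length (select (M d) (I d) X) * c)
    ... | true  = refl
    ... | false = refl

  collapse-realizes : ∀ c (I : ∀ d → List (Edge (a d) (b d))) → Short N I →
    (Xs : ∀ d → Stack {a d} {b d}) → ShortStack N Xs →
    Realizes N
      (λ d → cons (cons (edgesTree (M d)) (edgesTree (I d))) (stackTree (Xs d)))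
      (λ d → pairTree (collapse (M d) c (I d) (Xs d)))
  collapse-realizes c I I-short Xs Xs-short =
    pair ⌜ x₀ ₁ ₁ ⌝ (walk-realizes c I I-short Xs Xs-short) ⟫
    pair (⌜ cons (x₀ ₂ ₁) (x₀ ₁) ⌝ ⟫
      replace-realizes a≤N b≤N M M-short (λ d → proj₁ (walk (M d) c (I d) (Xs d)))
        (λ d → ≤-trans (length-walk (M d) c (I d) (Xs d)) (I-short d)))
      ⌜ x₀ ₂ ₂ ⌝

module _ {D : Set} {N a b : D → ℕ} (a≤N : ∀ d → a d ≤ N d) (b≤N : ∀ d → b d ≤ N d)
  (M : ∀ d → List (Edge (a d) (b d))) (M-short : Short N M)
  (Xs : ∀ d → Stack {a d} {b d}) (Xs-short : ShortStack N Xs)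
  (es : ∀ d → List (Edge (a d) (b d))) (es-short : Short N es) where

  step-realizes : ∀ μ c →
    Realizes N (λ d → cons (edgesTree (es d)) (pairTree (M d , Xs d)))
      (λ d → pairTree (step μ c (es d) (M d) (Xs d)))
  step-realizes μ c = retarget (λ d → lemma d (Xs d))
    (branch
      (and (⌜ x₀ ₂ ₂ ⌝ ⟫ nonNil)
        (pair (⌜ cons (x₀ ₂ ₁) (x₀ ₂ ₂) ⌝ ⟫ imm)
          (retarget (λ d → top-tree (Xs d)) ⌜ x₀ ₂ ₂ ₁ ⌝) ⟫
          covers-realizes μ edgeTree edgeTree
            (λ d → immediate (M d) (top (Xs d))) (λ d → top (Xs d)) imm-short))
      (pair (pair ⌜ x₀ ₂ ₁ ⌝ (⌜ cons (x₀ ₂ ₁) (x₀ ₂ ₂) ⌝ ⟫ imm))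
          (retarget (λ d → rest-tree (Xs d)) ⌜ x₀ ₂ ₂ ₂ ⌝) ⟫
        collapse-realizes a≤N b≤N M M-short c (λ d → immediate (M d) (top (Xs d)))
          imm-short (λ d → rest (Xs d))
          ((λ d → ≤-trans (rest-length (Xs d)) (proj₁ Xs-short d)) ,
           (λ d X∈ → proj₂ Xs-short d (rest⊆ (Xs d) X∈))))
      (pair ⌜ x₀ ₂ ₁ ⌝ (pair
        (⌜ cons (x₀ ₂) (x₀ ₁) ⌝ ⟫ greedy-realizes a≤N b≤N M M-short Xs Xs-short es es-short)
        ⌜ x₀ ₂ ₂ ⌝)))
    where
    top : ∀ {d} → Stack {a d} {b d} → List (Edge (a d) (b d))
    top []      = []
    top (X ∷ _) = X

    rest : ∀ {d} → Stack {a d} {b d} → Stack {a d} {b d}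
    rest []       = []
    rest (_ ∷ Ys) = Ys

    top-tree : ∀ {d} (Ys : Stack {a d} {b d}) → left (stackTree Ys) ≡ edgesTree (top {d} Ys)
    top-tree []      = refl
    top-tree (_ ∷ _) = refl

    rest-tree : ∀ {d} (Ys : Stack {a d} {b d}) → right (stackTree Ys) ≡ stackTree (rest {d} Ys)
    rest-tree []      = refl
    rest-tree (_ ∷ _) = refl

    rest-length : ∀ {d} (Ys : Stack {a d} {b d}) → length (rest {d} Ys) ≤ length Ys
    rest-length []      = z≤n
    rest-length (_ ∷ _) = n≤1+n _

    rest⊆ : ∀ {d} (Ys : Stack {a d} {b d}) {X} → X ∈ rest {d} Ys → X ∈ Ys
    rest⊆ (_ ∷ Ys) X∈ = there X∈

    top-short : ∀ d → length (top (Xs d)) ≤ N d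
    top-short d with Xs d | proj₂ Xs-short d
    ... | []    | _     = z≤n
    ... | X ∷ _ | short = short (here refl)

    imm-short : ∀ d → length (immediate (M d) (top (Xs d))) ≤ N d
    imm-short d = ≤-trans (length-filter _ (top (Xs d))) (top-short d)

    imm : Realizes N (λ d → cons (edgesTree (M d)) (stackTree (Xs d)))
      (λ d → edgesTree (immediate (M d) (top (Xs d))))
    imm = pair ⌜ x₀ ₁ ⌝ (retarget (λ d → top-tree (Xs d)) ⌜ x₀ ₂ ₁ ⌝) ⟫
      immediate-realizes a≤N b≤N M M-short (λ d → top (Xs d)) top-short

    lemma : ∀ d (Ys : Stack {a d} {b d}) →
      (Bool.if isCons (stackTree Ys) ∧
               does (length (top {d} Ys) ≤? length (immediate (M d) (top {d} Ys)) * μ)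
        then pairTree (collapse (M d) c (immediate (M d) (top {d} Ys)) (rest {d} Ys))
        else pairTree (M d , greedy (M d) Ys (es d) ∷ Ys))
      ≡ pairTree (step μ c (es d) (M d) Ys)
    lemma d []       = refl
    lemma d (X ∷ Ys) with does (length X ≤? length (immediate (M d) X) * μ)
    ... | true  = refl
    ... | false = refl

-- Counting

module _ {A : Set} where

  module _ {P Q : A → Set} (P? : Decidable P) (Q? : Decidable Q) where

    filter-mono-≤ : ∀ xs → (∀ {x} → x ∈ xs → P x → Q x) →
      length (filter P? xs) ≤ length (filter Q? xs)
    filter-mono-≤ []       P⇒Q = z≤n
    filter-mono-≤ (x ∷ xs) P⇒Q with P? x | Q? x
    ... | yes p | yes q = s≤s (filter-mono-≤ xs (P⇒Q ∘ there))
    ... | yes p | no ¬q = contradiction (P⇒Q (here refl) p) ¬q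
    ... | no ¬p | yes q = m≤n⇒m≤1+n (filter-mono-≤ xs (P⇒Q ∘ there))
    ... | no ¬p | no ¬q = filter-mono-≤ xs (P⇒Q ∘ there)

    filter-mono-< : ∀ xs → (∀ {x} → x ∈ xs → P x → Q x) → Any (λ x → Q x × ¬ P x) xs →
      length (filter P? xs) < length (filter Q? xs)
    filter-mono-< (x ∷ xs) P⇒Q any with P? x | Q? x | any
    ... | yes p | _     | here (_ , ¬p) = contradiction p ¬p
    ... | no ¬p | no ¬q | here (q , _)  = contradiction q ¬q
    ... | no ¬p | yes q | here _        = s≤s (filter-mono-≤ xs (P⇒Q ∘ there))
    ... | yes p | no ¬q | there _       = contradiction (P⇒Q (here refl) p) ¬q
    ... | yes p | yes q | there any     = s≤s (filter-mono-< xs (P⇒Q ∘ there) any)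
    ... | no ¬p | yes q | there any     = m≤n⇒m≤1+n (filter-mono-< xs (P⇒Q ∘ there) any)
    ... | no ¬p | no ¬q | there any     = filter-mono-< xs (P⇒Q ∘ there) any

  module _ {P Q R : A → Set} (P? : Decidable P) (Q? : Decidable Q) (R? : Decidable R) where

    filter-cover : ∀ xs → (∀ {x} → x ∈ xs → P x → Q x ⊎ R x) →
      length (filter P? xs) ≤ length (filter Q? xs) + length (filter R? xs)
    filter-cover []       P⇒Q⊎R = z≤n
    filter-cover (x ∷ xs) P⇒Q⊎R with filter-cover xs (P⇒Q⊎R ∘ there) | P? x | Q? x | R? x
    ... | ih | no _  | no _  | no _  = ih
    ... | ih | no _  | no _  | yes _ = ≤-trans (m≤n⇒m≤1+n ih) (≤-reflexive (sym (+-suc _ _)))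
    ... | ih | no _  | yes _ | no _  = m≤n⇒m≤1+n ih
    ... | ih | no _  | yes _ | yes _ =
      m≤n⇒m≤1+n (≤-trans (m≤n⇒m≤1+n ih) (≤-reflexive (sym (+-suc _ _))))
    ... | ih | yes _ | yes _ | no _  = s≤s ih
    ... | ih | yes _ | yes _ | yes _ =
      s≤s (≤-trans (m≤n⇒m≤1+n ih) (≤-reflexive (sym (+-suc _ _))))
    ... | ih | yes _ | no _  | yes _ = ≤-trans (s≤s ih) (≤-reflexive (sym (+-suc _ _)))
    ... | ih | yes p | no ¬q | no ¬r with P⇒Q⊎R (here refl) p
    ...   | inj₁ q = contradiction q ¬q
    ...   | inj₂ r = contradiction r ¬r

    filter-disjoint : ∀ xs → (∀ {x} → x ∈ xs → Q x → P x) → (∀ {x} → x ∈ xs → R x → P x) →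
      (∀ {x} → x ∈ xs → Q x → R x → ⊥) →
      length (filter Q? xs) + length (filter R? xs) ≤ length (filter P? xs)
    filter-disjoint []       Q⇒P R⇒P ¬QR = z≤n
    filter-disjoint (x ∷ xs) Q⇒P R⇒P ¬QR
      with filter-disjoint xs (Q⇒P ∘ there) (R⇒P ∘ there) (¬QR ∘ there) | P? x | Q? x | R? x
    ... | ih | _     | yes q | yes r = ⊥-elim (¬QR (here refl) q r)
    ... | ih | yes _ | yes _ | no _  = s≤s ih
    ... | ih | yes _ | no _  | yes _ = ≤-trans (≤-reflexive (+-suc _ _)) (s≤s ih)
    ... | ih | yes _ | no _  | no _  = m≤n⇒m≤1+n ih
    ... | ih | no ¬p | yes q | no _  = contradiction (Q⇒P (here refl) q) ¬p
    ... | ih | no ¬p | no _  | yes r = contradiction (R⇒P (here refl) r) ¬p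
    ... | ih | no _  | no _  | no _  = ih

  AllPairs-lookup : ∀ {R : A → A → Set} {xs} → AllPairs R xs → ∀ {x y} → x ∈ xs → y ∈ xs →
    x ≡ y ⊎ R x y ⊎ R y x
  AllPairs-lookup (rs ∷ _) (here refl) (here refl) = inj₁ refl
  AllPairs-lookup (rs ∷ _) (here refl) (there y∈)  = inj₂ (inj₁ (All.lookup rs y∈))
  AllPairs-lookup (rs ∷ _) (there x∈)  (here refl) = inj₂ (inj₂ (All.lookup rs x∈))
  AllPairs-lookup (_ ∷ rs) (there x∈)  (there y∈)  = AllPairs-lookup rs x∈ y∈

-- No `y` is related to two of the `xs`, so those `xs` that have partners in `ys` have different
-- ones.
filter-crossing : ∀ {A B : Set} {R : A → B → Set} (R? : ∀ x y → Dec (R x y)) xs ys →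
  AllPairs (λ x x′ → ∀ {y} → y ∈ ys → R x y → R x′ y → ⊥) xs →
  length (filter (λ x → any? (R? x) ys) xs) ≤
  length (filter (λ y → any? (λ x → R? x y) xs) ys)
filter-crossing R? []       ys _          = z≤n
filter-crossing R? (x ∷ xs) ys (apart ∷ rest) with any? (R? x) ys
... | no  _ = ≤-trans (filter-crossing R? xs ys rest)
  (filter-mono-≤ _ _ ys (λ _ → there))
... | yes hit with find hit
...   | y , y∈ , Rxy = ≤-<-trans (filter-crossing R? xs ys rest)
  (filter-mono-< _ _ ys (λ _ → there)
    (lose y∈ (here Rxy , λ any → let (x′ , x′∈ , Rx′y) = find any in
      All.lookup apart x′∈ y∈ Rxy Rx′y)))

∣p∪q∣+∣p∩q∣ : ∀ {n} (p q : Subset n) → ∣ p ∪ q ∣ + ∣ p ∩ q ∣ ≡ ∣ p ∣ + ∣ q ∣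
∣p∪q∣+∣p∩q∣ Vec.[]            Vec.[]            = refl
∣p∪q∣+∣p∩q∣ (true Vec.∷ p)  (true Vec.∷ q)  = cong suc
  (trans (+-suc _ _) (trans (cong suc (∣p∪q∣+∣p∩q∣ p q)) (sym (+-suc _ _))))
∣p∪q∣+∣p∩q∣ (true Vec.∷ p)  (false Vec.∷ q) = cong suc (∣p∪q∣+∣p∩q∣ p q)
∣p∪q∣+∣p∩q∣ (false Vec.∷ p) (true Vec.∷ q)  =
  trans (cong suc (∣p∪q∣+∣p∩q∣ p q)) (sym (+-suc _ _))
∣p∪q∣+∣p∩q∣ (false Vec.∷ p) (false Vec.∷ q) = ∣p∪q∣+∣p∩q∣ p q

∣p∪q∣≤∣p∣+∣q∣ : ∀ {n} (p q : Subset n) → ∣ p ∪ q ∣ ≤ ∣ p ∣ + ∣ q ∣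
∣p∪q∣≤∣p∣+∣q∣ p q = subst (∣ p ∪ q ∣ ≤_) (∣p∪q∣+∣p∩q∣ p q) (m≤m+n _ _)

∣p∣≡0⇒Empty : ∀ {n} {p : Subset n} {i} → ∣ p ∣ ≡ 0 → ¬ i ∈ₛ p
∣p∣≡0⇒Empty {p = true Vec.∷ p}  ()
∣p∣≡0⇒Empty {p = false Vec.∷ p} eq (Vec.there i∈) = ∣p∣≡0⇒Empty eq i∈

Nonempty⇒0<∣p∣ : ∀ {n} {p : Subset n} → Nonempty p → 0 < ∣ p ∣
Nonempty⇒0<∣p∣ {p = p} (i , i∈) with ∣ p ∣ in eq
... | zero  = contradiction i∈ (∣p∣≡0⇒Empty eq)
... | suc _ = s≤s z≤n

0<∣p∣⇒Nonempty : ∀ {n} {p : Subset n} → 0 < ∣ p ∣ → Nonempty p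
0<∣p∣⇒Nonempty {p = true Vec.∷ p}  _   = zero , Vec.here
0<∣p∣⇒Nonempty {p = false Vec.∷ p} 0<p with 0<∣p∣⇒Nonempty {p = p} 0<p
... | i , i∈ = suc i , Vec.there i∈

∣p∣≡1⇒unique : ∀ {n} {p : Subset n} {i j} → ∣ p ∣ ≡ 1 → i ∈ₛ p → j ∈ₛ p → i ≡ j
∣p∣≡1⇒unique {p = true Vec.∷ p}  eq Vec.here       Vec.here       = refl
∣p∣≡1⇒unique {p = true Vec.∷ p}  eq Vec.here       (Vec.there j∈) =
  contradiction j∈ (∣p∣≡0⇒Empty (suc-injective eq))
∣p∣≡1⇒unique {p = true Vec.∷ p}  eq (Vec.there i∈) _              =
  contradiction i∈ (∣p∣≡0⇒Empty (suc-injective eq))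
∣p∣≡1⇒unique {p = false Vec.∷ p} eq (Vec.there i∈) (Vec.there j∈) =
  cong suc (∣p∣≡1⇒unique eq i∈ j∈)

module _ {A : Set} {n : ℕ} (f : A → Subset n) where

  union : List A → Subset n
  union = ⋃ ∘ map f

  ∈-union⁺ : ∀ {x xs i} → x ∈ xs → i ∈ₛ f x → i ∈ₛ union xs
  ∈-union⁺ (here refl) i∈ = x∈p∪q⁺ (inj₁ i∈)
  ∈-union⁺ (there x∈)  i∈ = x∈p∪q⁺ (inj₂ (∈-union⁺ x∈ i∈))

  ∈-union⁻ : ∀ xs {i} → i ∈ₛ union xs → ∃ λ x → x ∈ xs × i ∈ₛ f x
  ∈-union⁻ []       i∈ = contradiction i∈ ∉⊥
  ∈-union⁻ (x ∷ xs) i∈ with x∈p∪q⁻ (f x) (union xs) i∈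
  ... | inj₁ i∈x = x , here refl , i∈x
  ... | inj₂ i∈xs with ∈-union⁻ xs i∈xs
  ...   | y , y∈ , i∈y = y , there y∈ , i∈y

  ∣union∣≤ : ∀ k xs → (∀ {x} → x ∈ xs → ∣ f x ∣ ≤ k) → ∣ union xs ∣ ≤ length xs * k
  ∣union∣≤ k []       small = ≤-reflexive (∣⊥∣≡0 n)
  ∣union∣≤ k (x ∷ xs) small = ≤-trans (∣p∪q∣≤∣p∣+∣q∣ (f x) (union xs))
    (+-mono-≤ (small (here refl)) (∣union∣≤ k xs (small ∘ there)))

  -- Each set shares an element with `U` and thus adds at most `k`. For the edges of `M` that meet
  -- the tree this saves one vertex each, the difference between 2r-2 and 2r-3.
  ∣union∪U∣≤ : ∀ k U xs → (∀ {x} → x ∈ xs → ∣ f x ∣ ≤ suc k) →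
    (∀ {x} → x ∈ xs → Nonempty (f x ∩ U)) → ∣ union xs ∪ U ∣ ≤ length xs * k + ∣ U ∣
  ∣union∪U∣≤ k U [] small meets =
    p⊆q⇒∣p∣≤∣q∣ (λ i∈ → case-∪ (x∈p∪q⁻ ∅ U i∈))
    where
    case-∪ : ∀ {i} → i ∈ₛ ∅ ⊎ i ∈ₛ U → i ∈ₛ U
    case-∪ (inj₁ i∈) = contradiction i∈ ∉⊥
    case-∪ (inj₂ i∈) = i∈
  ∣union∪U∣≤ k U (x ∷ xs) small meets = s≤s⁻¹ (begin-strict
    ∣ (f x ∪ union xs) ∪ U ∣       ≤⟨ p⊆q⇒∣p∣≤∣q∣ reassociate ⟩
    ∣ f x ∪ V ∣                    <⟨ m<m+n _ (Nonempty⇒0<∣p∣ meets-V) ⟩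
    ∣ f x ∪ V ∣ + ∣ f x ∩ V ∣      ≡⟨ ∣p∪q∣+∣p∩q∣ (f x) V ⟩
    ∣ f x ∣ + ∣ V ∣                ≤⟨ +-mono-≤ (small (here refl))
                                       (∣union∪U∣≤ k U xs (small ∘ there) (meets ∘ there)) ⟩
    suc k + (length xs * k + ∣ U ∣) ≡⟨ cong suc (sym (+-assoc k _ _)) ⟩
    suc (k + length xs * k + ∣ U ∣) ∎)
    where
    open ≤-Reasoning
    V : Subset n
    V = union xs ∪ U
    meets-V : Nonempty (f x ∩ V)
    meets-V with meets (here refl)
    ... | i , i∈ with x∈p∩q⁻ (f x) U i∈
    ...   | i∈x , i∈U = i , x∈p∩q⁺ (i∈x , x∈p∪q⁺ (inj₂ i∈U))
    reassociate : ∀ {i} → i ∈ₛ (f x ∪ union xs) ∪ U → i ∈ₛ f x ∪ V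
    reassociate i∈ with x∈p∪q⁻ (f x ∪ union xs) U i∈
    ... | inj₂ i∈U = x∈p∪q⁺ (inj₂ (x∈p∪q⁺ (inj₂ i∈U)))
    ... | inj₁ i∈∪ with x∈p∪q⁻ (f x) (union xs) i∈∪
    ...   | inj₁ i∈x  = x∈p∪q⁺ (inj₁ i∈x)
    ...   | inj₂ i∈xs = x∈p∪q⁺ (inj₂ (x∈p∪q⁺ (inj₁ i∈xs)))

  -- The sets meet `U` in different points: removing `f x` costs `U` a point and keeps the points of
  -- the other sets.
  disjoint-meeting : ∀ xs U → AllPairs (λ x y → Empty (f x ∩ f y)) xs →
    (∀ {x} → x ∈ xs → Nonempty (f x ∩ U)) → length xs ≤ ∣ U ∣
  disjoint-meeting []       U _ _ = z≤n
  disjoint-meeting (x ∷ xs) U (apart ∷ rest) meets =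
    ≤-<-trans (disjoint-meeting xs (U ─ f x) rest meets-rest)
      (p∩q≢∅⇒∣p─q∣<∣p∣ U (f x) (flip (meets (here refl))))
    where
    flip : ∀ {p q : Subset n} → Nonempty (p ∩ q) → Nonempty (q ∩ p)
    flip {p} {q} (i , i∈) with x∈p∩q⁻ p q i∈
    ... | i∈p , i∈q = i , x∈p∩q⁺ (i∈q , i∈p)
    meets-rest : ∀ {y} → y ∈ xs → Nonempty (f y ∩ (U ─ f x))
    meets-rest {y} y∈ with meets (there y∈)
    ... | i , i∈ with x∈p∩q⁻ (f y) U i∈
    ...   | i∈y , i∈U = i , x∈p∩q⁺ (i∈y , x∈p∧x∉q⇒x∈p─q i∈U
      (λ i∈x → All.lookup apart y∈ (i , x∈p∩q⁺ (i∈x , i∈y))))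

-- Layers

module _ {a b : ℕ} where

  meetsA-sym : ∀ {e f : Edge a b} → MeetsA e f → MeetsA f e
  meetsA-sym {e} {f} (i , i∈) with x∈p∩q⁻ (proj₁ e) (proj₁ f) i∈
  ... | i∈e , i∈f = i , x∈p∩q⁺ (i∈f , i∈e)

  meetsB-sym : ∀ {e f : Edge a b} → MeetsB e f → MeetsB f e
  meetsB-sym {e} {f} (i , i∈) with x∈p∩q⁻ (proj₂ e) (proj₂ f) i∈
  ... | i∈e , i∈f = i , x∈p∩q⁺ (i∈f , i∈e)

-- μ and g are the two thresholds of the search: a layer is collapsed once a μ-th of its edges
-- is immediate, and a new layer has at least a g-th of the size of the tree below it.
module Layers {ρ : ℕ} (H : BipartiteHypergraph (suc (suc ρ))) (g μ : ℕ) where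

  open BipartiteHypergraph H

  E : Set
  E = Edge a b

  single : ∀ {e} → e ∈ edges → ∣ proj₁ e ∣ ≡ 1
  single e∈ = proj₁ (All.lookup uniform e∈)

  sizeB : ∀ {e} → e ∈ edges → ∣ proj₂ e ∣ ≡ suc ρ
  sizeB e∈ = proj₂ (All.lookup uniform e∈)

  meetsA-refl : ∀ {e} → e ∈ edges → MeetsA e e
  meetsA-refl {e} e∈ with 0<∣p∣⇒Nonempty {p = proj₁ e} (≤-reflexive (sym (single e∈)))
  ... | i , i∈ = i , x∈p∩q⁺ (i∈ , i∈)

  meetsA-through : ∀ {e f f′ : E} → e ∈ edges → MeetsA e f → MeetsA e f′ → MeetsA f f′
  meetsA-through {e} {f} {f′} e∈ (i , i∈) (j , j∈)
    with x∈p∩q⁻ (proj₁ e) (proj₁ f) i∈ | x∈p∩q⁻ (proj₁ e) (proj₁ f′) j∈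
  ... | i∈e , i∈f | j∈e , j∈f′ =
    i , x∈p∩q⁺ (i∈f , subst (_∈ₛ proj₁ f′) (∣p∣≡1⇒unique (single e∈) j∈e i∈e) j∈f′)

  length≤∣union∣ : ∀ {X} → (∀ {x} → x ∈ X → x ∈ edges) → AllPairs (λ x y → ¬ MeetsA x y) X →
    length X ≤ ∣ union proj₁ X ∣
  length≤∣union∣ {X} inside apart = disjoint-meeting proj₁ X (union proj₁ X) apart λ {x} x∈ →
    let (i , i∈) = meetsA-refl (inside x∈) ; (i∈x , _) = x∈p∩q⁻ (proj₁ x) (proj₁ x) i∈ in
    i , x∈p∩q⁺ (i∈x , ∈-union⁺ proj₁ x∈ i∈x)

  record Matching (M : List E) : Set where
    field
      within   : ∀ {m} → m ∈ M → m ∈ edges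
      disjoint : AllPairs (Disjoint H) M

    unique-partner : ∀ {e m m′} → e ∈ edges → m ∈ M → m′ ∈ M →
      MeetsA e m → MeetsA e m′ → m ≡ m′
    unique-partner {e} {m} {m′} e∈ m∈ m′∈ eAm eAm′ with AllPairs-lookup disjoint m∈ m′∈
    ... | inj₁ m≡m′ = m≡m′
    ... | inj₂ (inj₁ (¬A , _)) = contradiction (meetsA-through {f = m} {m′} e∈ eAm eAm′) ¬A
    ... | inj₂ (inj₂ (¬A , _)) = contradiction (meetsA-through {f = m′} {m} e∈ eAm′ eAm) ¬A

    length≤union : length M ≤ ∣ union proj₁ M ∣
    length≤union = length≤∣union∣ within (AllPairs.map proj₁ disjoint)

    length≤a : length M ≤ a
    length≤a = ≤-trans length≤union (∣p∣≤n (union proj₁ M))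

  free touchedBy : List E → Stack → List E
  free M Xs      = filter (λ m → ¬? (touched? Xs m)) M
  touchedBy M Xs = filter (touched? Xs) M

  -- `grown` bounds the number `a ∸ length (free M Xs)` of vertices of A reached below the layer by
  -- `length X * g`, without a truncated subtraction.
  record Layer (M X : List E) (Xs : Stack) : Set where
    field
      inside   : ∀ {x} → x ∈ X → x ∈ edges
      apart    : AllPairs (λ x y → ¬ MeetsA x y) X
      sparse   : AllPairs (λ x y → ¬ Near M x y) X
      rooted   : ∀ {x m} → x ∈ X → m ∈ M → MeetsA x m → Touched Xs m
      separate : ∀ {x Y y} → x ∈ X → Y ∈ Xs → y ∈ Y → ¬ Near M x y
      grown    : a ≤ length (free M Xs) + length X * g

  -- A layer is settled once it was found, while on top, to have too few immediate edges for a
  -- collapse. Swaps at higher layers preserve this by `immediate-kept`.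
  Settled : List E → Stack → Set
  Settled M []       = ⊤
  Settled M (X ∷ Xs) =
    Layer M X Xs × length (immediate M X) * μ < length X × Settled M Xs

  length-cover : ∀ {A : Set} {Q R : A → Set} (Q? : ∀ x → Dec (Q x)) (R? : ∀ x → Dec (R x)) xs →
    (∀ {x} → x ∈ xs → Q x ⊎ R x) → length xs ≤ length (filter Q? xs) + length (filter R? xs)
  length-cover Q? R? xs Q⊎R = subst (_≤ length (filter Q? xs) + length (filter R? xs))
    (cong length (filter-all (λ _ → yes tt) (All.universal _ xs)))
    (filter-cover (λ _ → yes tt) Q? R? xs (λ x∈ _ → Q⊎R x∈))

  decide : ∀ {P : Set} → Dec P → P ⊎ ¬ P
  decide (yes p) = inj₁ p
  decide (no ¬p) = inj₂ ¬p

  free+touched≤ : ∀ M Xs → length (free M Xs) + length (touchedBy M Xs) ≤ length M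
  free+touched≤ M Xs = subst (length (free M Xs) + length (touchedBy M Xs) ≤_)
    (cong length (filter-all (λ _ → yes tt) (All.universal _ M)))
    (filter-disjoint (λ _ → yes tt) (λ m → ¬? (touched? Xs m)) (touched? Xs) M
      (λ _ _ → tt) (λ _ _ → tt) (λ _ ¬t t → ¬t t))

  module _ {M X Xs} (layer : Layer M X Xs) where

    open Layer layer

    -- An edge of `M` that meets this layer and a lower one would make two of their edges near.
    -- Hence different layers have different blocking edges.
    blocking-untouched : ∀ {m} → m ∈ M → Any (MeetsB m) X → ¬ Touched Xs m
    blocking-untouched {m} m∈ hit touched with find hit | find touched
    ... | x , x∈ , mBx | Y , Y∈ , hit′ with find hit′
    ...   | y , y∈ , mBy = separate x∈ Y∈ y∈ (inj₂ (lose m∈ (mBx , mBy)))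

    free-shrinks : length (free M (X ∷ Xs)) + length (blocking M X) ≤ length (free M Xs)
    free-shrinks = filter-disjoint _ _ _ M
      (λ _ ¬t t → ¬t (there t)) blocking-untouched (λ _ ¬t hit → ¬t (here hit))

    touched-grows : length (blocking M X) + length (touchedBy M Xs) ≤ length (touchedBy M (X ∷ Xs))
    touched-grows = filter-disjoint _ _ _ M (λ _ → here) (λ _ → there) blocking-untouched

  free-cover : ∀ M X Xs → length (free M Xs) ≤ length (free M (X ∷ Xs)) + length (blocking M X)
  free-cover M X Xs = filter-cover _ _ _ M λ {m} _ ¬t → cover m ¬t (decide (any? (meetsB? m) X))
    where
    cover : ∀ m → ¬ Touched Xs m → Any (MeetsB m) X ⊎ ¬ Any (MeetsB m) X →
      ¬ Touched (X ∷ Xs) m ⊎ Any (MeetsB m) X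
    cover m ¬t (inj₁ hit)  = inj₂ hit
    cover m ¬t (inj₂ ¬hit) = inj₁ λ { (here hit) → ¬hit hit ; (there t) → ¬t t }

  -- An edge of `X` that is not immediate meets some edge of `M`, and sparseness makes these
  -- partners distinct.
  length≤immediate+blocking : ∀ {M X : List E} → AllPairs (λ x y → ¬ Near M x y) X →
    length X ≤ length (immediate M X) + length (blocking M X)
  length≤immediate+blocking {M} {X} sparse = ≤-trans
    (length-cover (λ x → ¬? (any? (meetsB? x) M)) (λ x → any? (meetsB? x) M) X
      (λ {x} _ → [ inj₂ , inj₁ ]′ (decide (any? (meetsB? x) M))))
    (+-monoʳ-≤ (length (immediate M X)) (≤-trans
      (filter-crossing meetsB? X M (AllPairs.map (λ {x} {y} ¬near {m} m∈ xBm yBm →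
        ¬near (inj₂ (lose m∈ (meetsB-sym {e = x} {m} xBm , meetsB-sym {e = y} {m} yBm)))) sparse))
      (filter-mono-≤ _ _ M (λ {m} _ hit → let (x , x∈ , xBm) = find hit in
        lose x∈ (meetsB-sym {e = x} {m} xBm)))))

  settled-inside : ∀ {M Xs X x} → Settled M Xs → X ∈ Xs → x ∈ X → x ∈ edges
  settled-inside (layer , _ , _) (here refl) x∈ = Layer.inside layer x∈
  settled-inside (_ , _ , settled) (there X∈) x∈ = settled-inside settled X∈ x∈

  settled-sparse : ∀ {M} Xs → Settled M Xs → AllPairs (λ x y → ¬ Near M x y) (concat Xs)
  settled-sparse []       _ = []
  settled-sparse (X ∷ Xs) (layer , _ , settled) =
    AllPairs.++⁺ (Layer.sparse layer) (settled-sparse Xs settled)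
      (All.tabulate λ x∈ → All.tabulate λ y∈ →
        let (Y , y∈Y , Y∈) = ∈-concat⁻′ Xs y∈ in Layer.separate layer x∈ Y∈ y∈Y)

  settled-immediate : ∀ {M} Xs → Settled M Xs →
    length (immediate M (concat Xs)) * μ ≤ length (concat Xs)
  settled-immediate []       _ = z≤n
  settled-immediate {M} (X ∷ Xs) (_ , few , settled) = begin
    length (immediate M (X ++ concat Xs)) * μ
      ≡⟨ cong (λ l → length l * μ) (filter-++ _ X (concat Xs)) ⟩
    length (immediate M X ++ immediate M (concat Xs)) * μ
      ≡⟨ cong (_* μ) (length-++ (immediate M X)) ⟩
    (length (immediate M X) + length (immediate M (concat Xs))) * μ
      ≡⟨ *-distribʳ-+ μ (length (immediate M X)) _ ⟩
    length (immediate M X) * μ + length (immediate M (concat Xs)) * μ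
      ≤⟨ +-mono-≤ (<⇒≤ few) (settled-immediate Xs settled) ⟩
    length X + length (concat Xs)
      ≡⟨ sym (length-++ X) ⟩
    length (X ++ concat Xs) ∎
    where open ≤-Reasoning

  record Greedy (M : List E) (Xs : Stack) (es X : List E) : Set where
    field
      inside   : ∀ {x} → x ∈ X → x ∈ es
      apart    : AllPairs (λ x y → ¬ MeetsA x y) X
      sparse   : AllPairs (λ x y → ¬ Near M x y) X
      rooted   : ∀ {x m} → x ∈ X → m ∈ M → MeetsA x m → Touched Xs m
      separate : ∀ {x Y y} → x ∈ X → Y ∈ Xs → y ∈ Y → ¬ Near M x y
      maximal  : ∀ {e} → e ∈ es → ¬ Eligible M Xs X e

  greedy-spec : ∀ M Xs es → (∀ {e} → e ∈ es → e ∈ edges) → Greedy M Xs es (greedy M Xs es)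
  greedy-spec M Xs [] es⊆ = record
    { inside = λ () ; apart = [] ; sparse = [] ; rooted = λ () ; separate = λ () ; maximal = λ () }
  greedy-spec M Xs (e ∷ es) es⊆ =
    extend (eligible? M Xs (greedy M Xs es) e) (greedy-spec M Xs es (es⊆ ∘ there))
    where
    extend : ∀ {X} (d : Dec (Eligible M Xs X e)) → Greedy M Xs es X →
      Greedy M Xs (e ∷ es) (Bool.if does d then e ∷ X else X)
    extend (no ¬el) G = record
      { inside = there ∘ inside ; apart = apart ; sparse = sparse
      ; rooted = rooted ; separate = separate
      ; maximal = λ { (here refl) → ¬el ; (there f∈) → maximal f∈ } }
      where open Greedy G
    extend (yes (el₁ , el₂ , el₃)) G = record
      { inside = λ { (here refl) → here refl ; (there x∈) → there (inside x∈) }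
      ; apart  = All.tabulate (λ x∈ eAx → el₂ (lose x∈ (inj₁ eAx))) ∷ apart
      ; sparse = All.tabulate (λ x∈ near → el₂ (lose x∈ (inj₂ near))) ∷ sparse
      ; rooted = λ
        { {m = m} (here refl) m∈ eAm → decidable-stable (touched? Xs m)
            (λ ¬t → el₁ (lose m∈ (eAm , ¬t)))
        ; (there x∈) → rooted x∈ }
      ; separate = λ
        { (here refl) Y∈ y∈ near → el₃ (lose Y∈ (lose y∈ near))
        ; (there x∈) → separate x∈ }
      ; maximal = λ
        -- The chosen edge meets itself in A and is thereby ineligible from now on.
        { (here refl) (_ , ¬2 , _) → ¬2 (here (inj₁ (meetsA-refl (es⊆ (here refl)))))
        ; (there f∈) (¬1 , ¬2 , ¬3) → maximal f∈ (¬1 , ¬2 ∘ there , ¬3) } }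
      where open Greedy G

-- Growth of new layers

-- Here r is ρ + 2, ε is at least 1 / `k`, and everything is scaled by `k`: `slope` stands for 2r-3
-- and `suc slope` for 2r-3 + 1 / `k`. By the choice of `μ`, immediate edges use up at most half of
-- the slack. `C` collects the cost of a new layer per edge; this cost has to exceed the other half
-- of the slack, whence `g` is `2 * C`.
module Constants (ρ k : ℕ) where

  slope C g μ c : ℕ
  slope = k * (2 * ρ + 1)
  C     = k * (suc ρ * suc ρ) + suc slope
  g     = 2 * C
  μ     = suc (2 * (k * suc ρ))
  c     = μ * g

  -- The transversal of S has at most (y + y₁) ρ + (x₁ + x) (1 + ρ) vertices, which contradicts
  -- expansion unless the new layer, of x₁ edges, is large.
  growth-bound : ∀ s x x₁ y y₁ i R →
    suc slope * s < k * R → R ≤ (y₁ + y) * ρ + (x₁ + x) * suc ρ →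
    y₁ ≤ x₁ * suc ρ → x ≤ i + y → i * μ ≤ x → y ≤ s + x₁ → s + x₁ < x₁ * g
  growth-bound s x x₁ y y₁ i R expands R≤ y₁≤ x≤ iμ≤ y≤ =
    +-cancelˡ-< (2 * (slope * z) + z) z (x₁ * g) (begin-strict
      2 * (slope * z) + z + z
        ≡⟨ solve 2 (λ A z → con 2 :* (A :* z) :+ z :+ z := con 2 :* ((con 1 :+ A) :* z))
             refl slope z ⟩
      2 * (suc slope * z)
        ≡⟨ cong (2 *_) (*-distribˡ-+ (suc slope) s x₁) ⟩
      2 * (suc slope * s + suc slope * x₁)
        <⟨ *-monoʳ-< 2 (+-monoˡ-< (suc slope * x₁) expands) ⟩
      2 * (k * R + suc slope * x₁)
        ≤⟨ *-monoʳ-≤ 2 (+-monoˡ-≤ (suc slope * x₁) (*-monoʳ-≤ k (≤-trans R≤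
             (+-mono-≤ (*-monoˡ-≤ ρ (+-monoˡ-≤ y y₁≤))
               (*-monoˡ-≤ (suc ρ) (+-monoʳ-≤ x₁ x≤)))))) ⟩
      2 * (k * ((x₁ * suc ρ + y) * ρ + (x₁ + (i + y)) * suc ρ) + suc slope * x₁)
        ≡⟨ solve 5 (λ k ρ x₁ y i →
             let A = k :* (con 2 :* ρ :+ con 1) ; ρ⁺ = con 1 :+ ρ in
             con 2 :* (k :* ((x₁ :* ρ⁺ :+ y) :* ρ :+ (x₁ :+ (i :+ y)) :* ρ⁺) :+ (con 1 :+ A) :* x₁)
             := con 2 :* (A :* y) :+ i :* (con 2 :* (k :* ρ⁺))
                :+ x₁ :* (con 2 :* (k :* (ρ⁺ :* ρ⁺) :+ (con 1 :+ A))))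
             refl k ρ x₁ y i ⟩
      2 * (slope * y) + i * (2 * (k * suc ρ)) + x₁ * g
        ≤⟨ +-monoˡ-≤ (x₁ * g) (+-mono-≤ (*-monoʳ-≤ 2 (*-monoʳ-≤ slope y≤)) (≤-trans few y≤)) ⟩
      2 * (slope * z) + z + x₁ * g ∎)
    where
    open ≤-Reasoning
    open +-*-Solver using (solve; _:+_; _:*_; _:=_; con)
    z = s + x₁
    few : i * (2 * (k * suc ρ)) ≤ y
    -- The summand 1 in `μ` absorbs the `i` in `x ≤ i + y`.
    few = +-cancelˡ-≤ i _ y (begin
      i + i * (2 * (k * suc ρ)) ≡⟨ sym (*-suc i _) ⟩
      i * μ                     ≤⟨ iμ≤ ⟩
      x                         ≤⟨ x≤ ⟩
      i + y                     ∎)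

module Growth {ρ : ℕ} (H : BipartiteHypergraph (suc (suc ρ))) (k : ℕ) where

  open BipartiteHypergraph H
  open Constants ρ k
  open Layers H g μ

  -- The hypothesis on τ with 1 / `k` for ε, multiplied by `k`. It speaks of all transversals rather
  -- than of a smallest one, and of `suc s` rather than of a subtraction from |S|.
  Expanding : Set
  Expanding = ∀ S s → ∣ S ∣ ≡ suc s → ∀ R → Hits H R (incident H S) →
    suc slope * s < k * ∣ R ∣

  module _ (expanding : Expanding) {M Xs} (matching : Matching M) (|M|<a : length M < a)
    (settled : Settled M Xs) where

    private
      X F Y : List E
      X = greedy M Xs edges
      F = X ++ concat Xs
      Y = blocking M F

      open Greedy (greedy-spec M Xs edges id)
      open Matching matching

      S : Subset a
      S = ∁ (union proj₁ (free M Xs ++ X))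

      U R : Subset b
      U = union proj₂ F
      R = union proj₂ Y ∪ U

      inside-F : ∀ {x} → x ∈ F → x ∈ edges
      inside-F x∈ with ∈-++⁻ X x∈
      ... | inj₁ x∈X = inside x∈X
      ... | inj₂ x∈Xs = let (Z , x∈Z , Z∈) = ∈-concat⁻′ Xs x∈Xs in settled-inside settled Z∈ x∈Z

      near-hits : ∀ {e x} → x ∈ F → Near M e x → Nonempty (R ∩ proj₂ e)
      near-hits {e} {x} x∈ (inj₁ (i , i∈)) with x∈p∩q⁻ (proj₂ e) (proj₂ x) i∈
      ... | i∈e , i∈x = i , x∈p∩q⁺ (x∈p∪q⁺ (inj₂ (∈-union⁺ proj₂ x∈ i∈x)) , i∈e)
      near-hits {e} x∈ (inj₂ both) with find both
      ... | m , m∈ , (i , i∈) , mBx with x∈p∩q⁻ (proj₂ m) (proj₂ e) i∈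
      ...   | i∈m , i∈e = i , x∈p∩q⁺
        (x∈p∪q⁺ (inj₁ (∈-union⁺ proj₂ (∈-filter⁺ (λ m → any? (meetsB? m) F) m∈ (lose x∈ mBx)) i∈m))
        , i∈e)

      avoids : ∀ {e f} → ∣ proj₁ e ∩ S ∣ ≡ 1 → e ∈ edges → f ∈ free M Xs ++ X → ¬ MeetsA e f
      avoids {e} {f} one e∈ f∈ (j , j∈)
        with 0<∣p∣⇒Nonempty {p = proj₁ e ∩ S} (≤-reflexive (sym one))
      ... | i , i∈ with x∈p∩q⁻ (proj₁ e) S i∈ | x∈p∩q⁻ (proj₁ e) (proj₁ f) j∈
      ...   | i∈e , i∈S | j∈e , j∈f = x∈∁p⇒x∉p i∈S (∈-union⁺ proj₁ f∈
        (subst (_∈ₛ proj₁ f) (∣p∣≡1⇒unique (single e∈) j∈e i∈e) j∈f))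

      -- An edge at `S` meets neither an untouched edge of `M` nor the new layer in A. By maximality
      -- it is ineligible, hence near some layer edge, and `R` contains the vertices that witness
      -- this.
      hits : Hits H R (incident H S)
      hits e (e∈ , one) = decidable-stable (nonempty? (R ∩ proj₂ e)) λ ¬hit → maximal e∈
        ( (λ any → let (m , m∈ , eAm , ¬t) = find any in
            avoids one e∈ (∈-++⁺ˡ (∈-filter⁺ (λ m → ¬? (touched? Xs m)) m∈ ¬t)) eAm)
        , (λ any → let (x , x∈ , A⊎near) = find any in
            [ avoids one e∈ (∈-++⁺ʳ (free M Xs) x∈)
            , ¬hit ∘ near-hits {e} (∈-++⁺ˡ x∈) ]′ A⊎near)
        , (λ any → let (Z , Z∈ , any′) = find any ; (x , x∈ , near) = find any′ in
            ¬hit (near-hits {e} (∈-++⁺ʳ X (∈-concat⁺′ x∈ Z∈)) near)))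

      blocking-X : length (blocking M X) ≤ length X * suc ρ
      blocking-X = ≤-trans
        (disjoint-meeting proj₂ (blocking M X) (union proj₂ X)
          (AllPairs.filter⁺ _ (AllPairs.map proj₂ disjoint)) meets)
        (∣union∣≤ proj₂ (suc ρ) X (≤-reflexive ∘ sizeB ∘ inside))
        where
        meets : ∀ {m} → m ∈ blocking M X → Nonempty (proj₂ m ∩ union proj₂ X)
        meets {m} m∈ with find (proj₂ (∈-filter⁻ (λ m → any? (meetsB? m) X) {xs = M} m∈))
        ... | x , x∈ , i , i∈ with x∈p∩q⁻ (proj₂ m) (proj₂ x) i∈
        ...   | i∈m , i∈x = i , x∈p∩q⁺ (i∈m , ∈-union⁺ proj₂ x∈ i∈x)

      Y≤ : length Y ≤ length (blocking M X) + length (touchedBy M Xs)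
      Y≤ = filter-cover _ _ _ M λ {m} _ hit → cover {m} (find hit)
        where
        cover : ∀ {m} → (∃ λ x → x ∈ F × MeetsB m x) → Any (MeetsB m) X ⊎ Touched Xs m
        cover (x , x∈ , mBx) with ∈-++⁻ X x∈
        ... | inj₁ x∈X = inj₁ (lose x∈X mBx)
        ... | inj₂ x∈Xs = let (Z , x∈Z , Z∈) = ∈-concat⁻′ Xs x∈Xs in inj₂ (lose Z∈ (lose x∈Z mBx))

      R≤ : ∣ R ∣ ≤ (length (blocking M X) + length (touchedBy M Xs)) * ρ
                   + (length X + length (concat Xs)) * suc ρ
      R≤ = ≤-trans
        (∣union∪U∣≤ proj₂ ρ U Y
          (λ m∈ → ≤-reflexive (sizeB (within (proj₁ (∈-filter⁻ _ {xs = M} m∈))))) meets)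
        (+-mono-≤ (*-monoˡ-≤ ρ Y≤) (≤-trans
          (∣union∣≤ proj₂ (suc ρ) F (≤-reflexive ∘ sizeB ∘ inside-F))
          (≤-reflexive (cong (_* suc ρ) (length-++ X)))))
        where
        meets : ∀ {m} → m ∈ Y → Nonempty (proj₂ m ∩ U)
        meets {m} m∈ with find (proj₂ (∈-filter⁻ (λ m → any? (meetsB? m) F) {xs = M} m∈))
        ... | x , x∈ , i , i∈ with x∈p∩q⁻ (proj₂ m) (proj₂ x) i∈
        ...   | i∈m , i∈x = i , x∈p∩q⁺ (i∈m , ∈-union⁺ proj₂ x∈ i∈x)

      blocking⊆touched : length (blocking M (concat Xs)) ≤ length (touchedBy M Xs)
      blocking⊆touched = filter-mono-≤ _ _ M λ _ hit →
        let (x , x∈ , mBx) = find hit ; (Z , x∈Z , Z∈) = ∈-concat⁻′ Xs x∈ in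
        lose Z∈ (lose x∈Z mBx)

      a≤∣S∣ : a ≤ ∣ S ∣ + (length (free M Xs) + length X)
      a≤∣S∣ = begin
        a                        ≤⟨ m≤n+m∸n a ∣ P ∣ ⟩
        ∣ P ∣ + (a ∸ ∣ P ∣)      ≡⟨ +-comm ∣ P ∣ _ ⟩
        (a ∸ ∣ P ∣) + ∣ P ∣      ≡⟨ cong (_+ ∣ P ∣) (sym (∣∁p∣≡n∸∣p∣ P)) ⟩
        ∣ S ∣ + ∣ P ∣            ≤⟨ +-monoʳ-≤ ∣ S ∣ (∣union∣≤ proj₁ 1 (free M Xs ++ X) P-single) ⟩
        ∣ S ∣ + length (free M Xs ++ X) * 1
          ≡⟨ cong (∣ S ∣ +_) (trans (*-identityʳ _) (length-++ (free M Xs))) ⟩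
        ∣ S ∣ + (length (free M Xs) + length X) ∎
        where
        open ≤-Reasoning
        P : Subset a
        P = union proj₁ (free M Xs ++ X)
        P-single : ∀ {f} → f ∈ free M Xs ++ X → ∣ proj₁ f ∣ ≤ 1
        P-single f∈ with ∈-++⁻ (free M Xs) f∈
        ... | inj₁ f∈free = ≤-reflexive (single (within (proj₁ (∈-filter⁻ _ {xs = M} f∈free))))
        ... | inj₂ f∈X    = ≤-reflexive (single (inside f∈X))

      grows : ∀ t → ∣ S ∣ ≡ t → a ≤ length (free M Xs) + length X * g
      -- `Expanding` says nothing of an empty `S`, but then the untouched edges and the new layer
      -- already cover A.
      grows zero eq = begin
        a                                       ≤⟨ a≤∣S∣ ⟩
        ∣ S ∣ + (length (free M Xs) + length X) ≡⟨ cong (_+ (length (free M Xs) + length X)) eq ⟩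
        length (free M Xs) + length X           ≤⟨ +-monoʳ-≤ (length (free M Xs)) (begin
          length X              ≡⟨ sym (*-identityʳ _) ⟩
          length X * 1          ≤⟨ *-monoʳ-≤ (length X) 1≤g ⟩
          length X * g          ∎) ⟩
        length (free M Xs) + length X * g       ∎
        where
        open ≤-Reasoning
        1≤g : 1 ≤ g
        1≤g = ≤-trans (≤-trans (s≤s z≤n) (m≤n+m (suc slope) _)) (m≤m+n C _)
      grows (suc s) eq = begin
        a                                       ≤⟨ a≤s ⟩
        length (free M Xs) + suc (s + length X) ≤⟨ +-monoʳ-≤ (length (free M Xs))
          (growth-bound s (length (concat Xs)) (length X) (length (touchedBy M Xs))
            (length (blocking M X)) (length (immediate M (concat Xs))) ∣ R ∣
            (expanding S s eq R hits) R≤ blocking-X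
            (≤-trans (length≤immediate+blocking (settled-sparse Xs settled))
              (+-monoʳ-≤ (length (immediate M (concat Xs))) blocking⊆touched))
            (settled-immediate Xs settled)
            -- Because of an unmatched vertex, the touched edges are at most `s + length X`,
            -- although |S| is `suc s`. This accounts for the -1 in |S|-1.
            (s≤s⁻¹ (+-cancelˡ-< (length (free M Xs)) _ _
              (≤-trans (≤-trans (s≤s (free+touched≤ M Xs)) |M|<a) a≤s)))) ⟩
        length (free M Xs) + length X * g       ∎
        where
        open ≤-Reasoning
        a≤s : a ≤ length (free M Xs) + suc (s + length X)
        a≤s = begin
          a                                        ≤⟨ a≤∣S∣ ⟩
          ∣ S ∣ + (length (free M Xs) + length X)  ≡⟨ cong (_+ (length (free M Xs) + length X)) eq ⟩
          suc s + (length (free M Xs) + length X)  ≡⟨ solve 3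
            (λ s f x → con 1 :+ s :+ (f :+ x) := f :+ (con 1 :+ (s :+ x)))
            refl s (length (free M Xs)) (length X) ⟩
          length (free M Xs) + suc (s + length X)  ∎
          where open +-*-Solver using (solve; _:+_; _:=_; con)

    greedy-layer : Layer M (greedy M Xs edges) Xs
    greedy-layer = record
      { inside = inside ; apart = apart ; sparse = sparse ; rooted = rooted
      ; separate = separate ; grown = grows ∣ S ∣ refl }

-- Weights

-- What the potential argument requires of a rounded multiple of z^-q. By `w-drop` the weight at
-- least triples when z loses a `K`-th: one part is for the layer itself, one for the discarded
-- layers above it, and one for strictness.
record Weight (a K : ℕ) : Set where
  field
    w     : ℕ → ℕ
    top   : ℕ
    w≤top : ∀ z → w z ≤ top
    w-pos : ∀ {z} → z ≤ a → 1 ≤ w z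
    w-anti : ∀ {y z} → y ≤ z → w z ≤ w y
    w-drop : ∀ {y z d} → 1 ≤ y → y + d ≤ z → z ≤ d * K → 3 * w z ≤ w y

-- Bernoulli's inequality (1 + 1/L)^n ≥ 1 + n/L, cleared of fractions.
bernoulli : ∀ L n → L ^ n * (L + n) ≤ suc L ^ n * L
bernoulli L zero    = ≤-reflexive (cong (1 *_) (+-identityʳ L))
bernoulli L (suc n) = begin
  L * L ^ n * (L + suc n)           ≤⟨ m≤m+n _ (L ^ n * n) ⟩
  L * L ^ n * (L + suc n) + L ^ n * n
    ≡⟨ solve 3 (λ L n p → L :* p :* (L :+ (con 1 :+ n)) :+ p :* n
                        := (con 1 :+ L) :* (p :* (L :+ n))) refl L n (L ^ n) ⟩
  suc L * (L ^ n * (L + n))         ≤⟨ *-monoʳ-≤ (suc L) (bernoulli L n) ⟩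
  suc L * (suc L ^ n * L)           ≡⟨ sym (*-assoc (suc L) (suc L ^ n) L) ⟩
  suc L * suc L ^ n * L             ∎
  where
  open ≤-Reasoning
  open +-*-Solver using (solve; _:+_; _:*_; _:=_; con)

doubling : ∀ L .{{_ : NonZero L}} → 2 * L ^ suc L ≤ suc L ^ suc L
doubling L = *-cancelʳ-≤ (2 * L ^ suc L) (suc L ^ suc L) L (begin
  2 * L ^ suc L * L         ≡⟨ solve 2 (λ L p → con 2 :* p :* L := p :* (L :+ L)) refl L (L ^ suc L) ⟩
  L ^ suc L * (L + L)       ≤⟨ *-monoʳ-≤ (L ^ suc L) (+-monoʳ-≤ L (n≤1+n L)) ⟩
  L ^ suc L * (L + suc L)   ≤⟨ bernoulli L (suc L) ⟩
  suc L ^ suc L * L         ∎)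
  where
  open ≤-Reasoning
  open +-*-Solver using (solve; _:+_; _:*_; _:=_; con)

-- (1 + 1/L)^(L+1) is at least 2, so its square is at least 4, more than the required 3.
exponent : ℕ → ℕ
exponent L = suc L * 2

tripling : ∀ L .{{_ : NonZero L}} → 3 * L ^ exponent L ≤ suc L ^ exponent L
tripling L = begin
  3 * L ^ (suc L * 2)               ≤⟨ *-monoˡ-≤ (L ^ (suc L * 2)) (n≤1+n 3) ⟩
  4 * L ^ (suc L * 2)               ≡⟨ cong (4 *_) (sym (^-*-assoc L (suc L) 2)) ⟩
  4 * (L ^ suc L) ^ 2               ≡⟨ solve 1 (λ p → con 4 :* (p :* (p :* con 1))
                                         := con 2 :* p :* (con 2 :* p :* con 1)) refl (L ^ suc L) ⟩
  (2 * L ^ suc L) ^ 2               ≤⟨ ^-monoˡ-≤ 2 (doubling L) ⟩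
  (suc L ^ suc L) ^ 2               ≡⟨ ^-*-assoc (suc L) (suc L) 2 ⟩
  suc L ^ (suc L * 2)               ∎
  where
  open ≤-Reasoning
  open +-*-Solver using (solve; _:*_; _:=_; con)

^-distrib-* : ∀ x y n → (x * y) ^ n ≡ x ^ n * y ^ n
^-distrib-* x y zero    = refl
^-distrib-* x y (suc n) rewrite ^-distrib-* x y n =
  solve 4 (λ x y p q → x :* y :* (p :* q) := x :* p :* (y :* q)) refl x y (x ^ n) (y ^ n)
  where open +-*-Solver using (solve; _:*_; _:=_)

module Powers (a L : ℕ) where

  private
    q : ℕ
    q = exponent L

    instance
      power-nonZero : ∀ {z} → NonZero (suc z ^ q)
      power-nonZero {z} = m^n≢0 (suc z) q

  -- w 0 is w 1, to avoid a division by zero.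
  w : ℕ → ℕ
  w z = suc a ^ q / suc (pred z) ^ q

  -- The hypotheses give (1 + L) y ≤ L z, so the ratio of the powers is at least (1 + 1/L)^q ≥ 3. As
  -- `3 * w z` is an integer, rounding down in `w y` does no harm.
  w-drop : ∀ {y z d} → 1 ≤ y → y + d ≤ z → z ≤ d * suc L → 3 * w z ≤ w y
  w-drop {suc y} {suc z} {d} _ y+d≤z z≤dK = begin
    3 * (top / suc z ^ q)                       ≡⟨ sym (m*n/n≡m (3 * w (suc z)) (suc y ^ q)) ⟩
    3 * (top / suc z ^ q) * suc y ^ q / suc y ^ q ≤⟨ /-monoˡ-≤ (suc y ^ q) (begin
      3 * w (suc z) * suc y ^ q     ≡⟨ solve 2 (λ u v → con 3 :* u :* v := u :* (con 3 :* v))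
                                         refl (w (suc z)) (suc y ^ q) ⟩
      w (suc z) * (3 * suc y ^ q)   ≤⟨ *-monoʳ-≤ (w (suc z)) (powers L refl) ⟩
      w (suc z) * suc z ^ q         ≤⟨ m/n*n≤m top (suc z ^ q) ⟩
      top                           ∎) ⟩
    top / suc y ^ q ∎
    where
    open ≤-Reasoning
    open +-*-Solver using (solve; _:+_; _:*_; _:=_; con)
    top : ℕ
    top = suc a ^ q
    shrinks : suc L * suc y ≤ L * suc z
    shrinks = +-cancelʳ-≤ (suc z) (suc L * suc y) (L * suc z) (begin
      suc L * suc y + suc z        ≤⟨ +-monoʳ-≤ (suc L * suc y) z≤dK ⟩
      suc L * suc y + d * suc L    ≡⟨ solve 3 (λ L y d → (con 1 :+ L) :* y :+ d :* (con 1 :+ L)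
                                        := (con 1 :+ L) :* (y :+ d)) refl L (suc y) d ⟩
      suc L * (suc y + d)          ≤⟨ *-monoʳ-≤ (suc L) y+d≤z ⟩
      suc L * suc z                ≡⟨ +-comm (suc z) (L * suc z) ⟩
      L * suc z + suc z            ∎)
    powers : ∀ l → l ≡ L → 3 * suc y ^ q ≤ suc z ^ q
    powers zero refl with shrinks
    ... | ()
    powers (suc l) refl = *-cancelˡ-≤ (L ^ q) {{power-nonZero}} (begin
      L ^ q * (3 * suc y ^ q)     ≡⟨ solve 2 (λ u v → u :* (con 3 :* v) := con 3 :* u :* v)
                                       refl (L ^ q) (suc y ^ q) ⟩
      3 * L ^ q * suc y ^ q       ≤⟨ *-monoˡ-≤ (suc y ^ q) (tripling L) ⟩
      suc L ^ q * suc y ^ q       ≡⟨ sym (^-distrib-* (suc L) (suc y) q) ⟩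
      (suc L * suc y) ^ q         ≤⟨ ^-monoˡ-≤ q shrinks ⟩
      (L * suc z) ^ q             ≡⟨ ^-distrib-* L (suc z) q ⟩
      L ^ q * suc z ^ q           ∎)

  weight : Weight a (suc L)
  weight = record
    { w      = w
    ; top    = suc a ^ q
    ; w≤top  = λ z → m/n≤m (suc a ^ q) (suc (pred z) ^ q)
    ; w-pos  = λ {z} z≤a → m≥n⇒m/n>0 (^-monoˡ-≤ q (s≤s (≤-trans pred[n]≤n z≤a)))
    ; w-anti = λ y≤z → /-monoʳ-≤ (suc a ^ q) (^-monoˡ-≤ q (s≤s (pred-mono-≤ y≤z)))
    ; w-drop = λ {y} {z} {d} → w-drop {y} {z} {d}
    }

-- Swaps

module _ {A : Set} {P Q R : A → Set} (P? : ∀ x → Dec (P x)) (Q? : ∀ x → Dec (Q x))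
  (R? : ∀ x → Dec (R x)) where

  filter-filter : ∀ xs → (∀ {x} → x ∈ xs → P x → Q x ⊎ R x) →
    length (filter P? xs) ≤ length (filter P? (filter Q? xs)) + length (filter R? xs)
  filter-filter []       P⇒Q⊎R = z≤n
  filter-filter (x ∷ xs) P⇒Q⊎R with filter-filter xs (P⇒Q⊎R ∘ there) | Q? x | R? x
  ... | ih | yes _ | no _ with P? x
  ...   | yes _ = s≤s ih
  ...   | no _  = ih
  filter-filter (x ∷ xs) P⇒Q⊎R | ih | yes _ | yes _ with P? x
  ...   | yes _ = s≤s (≤-trans ih (+-monoʳ-≤ _ (n≤1+n _)))
  ...   | no _  = ≤-trans ih (+-monoʳ-≤ _ (n≤1+n _))
  filter-filter (x ∷ xs) P⇒Q⊎R | ih | no _  | yes _ with P? x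
  ...   | yes _ = ≤-trans (s≤s ih) (≤-reflexive (sym (+-suc _ _)))
  ...   | no _  = ≤-trans ih (+-monoʳ-≤ _ (n≤1+n _))
  filter-filter (x ∷ xs) P⇒Q⊎R | ih | no ¬q | no ¬r with P? x
  ...   | no _  = ih
  ...   | yes p with P⇒Q⊎R (here refl) p
  ...     | inj₁ q = contradiction q ¬q
  ...     | inj₂ r = contradiction r ¬r

filter-within : ∀ {A : Set} {P Q : A → Set} (P? : ∀ x → Dec (P x)) (Q? : ∀ x → Dec (Q x)) xs →
  (∀ {x} → x ∈ xs → P x → Q x) → length (filter P? xs) ≤ length (filter P? (filter Q? xs))
filter-within P? Q? xs P⇒Q = subst (length (filter P? xs) ≤_)
  (trans (cong (λ l → length (filter P? (filter Q? xs)) + length l)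
      (filter-none {P = λ _ → ⊥} (λ _ → no id) (All.universal (λ _ → id) xs)))
    (+-identityʳ _))
  (filter-filter P? Q? (λ _ → no id) xs (λ x∈ p → inj₁ (P⇒Q x∈ p)))

module Exchange {ρ : ℕ} (H : BipartiteHypergraph (suc (suc ρ))) (g μ : ℕ) where

  open BipartiteHypergraph H
  open Layers H g μ

  record Swappable (M J : List E) : Set where
    field
      inside    : ∀ {x} → x ∈ J → x ∈ edges
      apart     : AllPairs (Disjoint H) J
      unblocked : ∀ {x m} → x ∈ J → m ∈ M → ¬ MeetsB x m

  Clear : List E → Stack → Set
  Clear J Xs = ∀ {x Y y} → x ∈ J → Y ∈ Xs → y ∈ Y → ¬ MeetsB x y

  -- Each edge of `J` is to take the place of an edge of `M` that none of these layers touches. This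
  -- protects them from the swap.
  Anchored : List E → List E → Stack → Set
  Anchored M J Xs = ∀ {x} → x ∈ J → ∃ λ m → m ∈ M × ¬ Touched Xs m × MeetsA x m

  -- Counts, through the complement, the vertices of A that are unmatched or lie in a touched edge.
  Z : List E → Stack → ℕ
  Z M Xs = a ∸ length (free M Xs)

  module _ {M J} (matching : Matching M) (swappable : Swappable M J) where

    open Matching matching
    open Swappable swappable

    private
      M′ removed kept : List E
      M′      = replace M J
      removed = filter (λ m → any? (meetsA? m) J) M
      kept    = filter (λ m → ¬? (any? (meetsA? m) J)) M

    replace⁻ : ∀ {m} → m ∈ M′ → m ∈ J ⊎ (m ∈ M × ¬ Any (MeetsA m) J)
    replace⁻ m∈ with ∈-++⁻ J m∈
    ... | inj₁ m∈J = inj₁ m∈J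
    ... | inj₂ m∈kept = inj₂ (∈-filter⁻ _ {xs = M} m∈kept)

    replace-kept : ∀ {m} → m ∈ M → ¬ Any (MeetsA m) J → m ∈ M′
    replace-kept m∈ ¬rem = ∈-++⁺ʳ J (∈-filter⁺ (λ m → ¬? (any? (meetsA? m) J)) m∈ ¬rem)

    matching′ : Matching M′
    matching′ = record
      { within   = λ m∈ → [ inside , within ∘ proj₁ ]′ (replace⁻ m∈)
      ; disjoint = AllPairs.++⁺ apart (AllPairs.filter⁺ _ disjoint)
          (All.tabulate λ {x} x∈ → All.tabulate λ {m} m∈ →
            let (m∈M , ¬rem) = ∈-filter⁻ (λ m → ¬? (any? (meetsA? m) J)) {xs = M} m∈ in
            (λ xAm → ¬rem (lose x∈ (meetsA-sym {e = x} {m} xAm))) , unblocked x∈ m∈M)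
      }

    removed≤J : length removed ≤ length J
    removed≤J = ≤-trans
      (filter-crossing meetsA? M J
        (AllPairs.map (λ {m} {m′} (¬A , _) {x} x∈ mAx m′Ax → ¬A
          (meetsA-through {f = m} {m′} (inside x∈)
            (meetsA-sym {e = m} {x} mAx) (meetsA-sym {e = m′} {x} m′Ax))) disjoint))
      (length-filter _ J)

    length-replace : length M′ ≡ length J + length kept
    length-replace = length-++ J

    removed+kept : length M ≤ length removed + length kept
    removed+kept = length-cover _ _ M (λ {m} _ → decide (any? (meetsA? m) J))

    replace-≥ : length M ≤ length M′
    replace-≥ = ≤-trans removed+kept (≤-trans (+-monoˡ-≤ (length kept) removed≤J)
      (≤-reflexive (sym length-replace)))

    replace-> : length removed < length J → length M < length M′
    replace-> rem< = ≤-<-trans removed+kept (≤-trans (+-monoˡ-≤ (length kept) rem<)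
      (≤-reflexive (sym length-replace)))

    replace-≤ : (∀ {x} → x ∈ J → Any (MeetsA x) M) → length M′ ≤ length M
    replace-≤ anchored = begin
      length M′                       ≡⟨ length-replace ⟩
      length J + length kept          ≤⟨ +-monoˡ-≤ (length kept) J≤ ⟩
      length removed + length kept    ≤⟨ filter-disjoint (λ _ → yes tt) _ _ M
                                           (λ _ _ → tt) (λ _ _ → tt) (λ _ r ¬r → ¬r r) ⟩
      length (filter (λ _ → yes tt) M) ≤⟨ length-filter _ M ⟩
      length M                        ∎
      where
      open ≤-Reasoning
      J≤ : length J ≤ length removed
      J≤ = begin
        length J ≡⟨ sym (cong length (filter-all (λ x → any? (meetsA? x) M) (All.tabulate anchored))) ⟩
        length (filter (λ x → any? (meetsA? x) M) J)
          ≤⟨ filter-crossing meetsA? J M (AllPairs.map (λ {x} {y} (¬A , _) {m} m∈ xAm yAm → ¬A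
               (meetsA-through {f = x} {y} (within m∈)
                 (meetsA-sym {e = x} {m} xAm) (meetsA-sym {e = y} {m} yAm))) apart) ⟩
        length (filter (λ m → any? (λ x → meetsA? x m) J) M)
          ≤⟨ filter-mono-≤ _ _ M (λ {m} _ hit → let (x , x∈ , xAm) = find hit in
               lose x∈ (meetsA-sym {e = x} {m} xAm)) ⟩
        length removed ∎

    module _ {Xs : Stack} (clear : Clear J Xs) where

      free-replace : length (free M′ Xs) ≡ length J + length (free kept Xs)
      free-replace = trans
        (cong length (filter-++ (λ m → ¬? (touched? Xs m)) J kept))
        (trans (length-++ (free J Xs)) (cong (λ l → length l + length (free kept Xs))
          (filter-all (λ m → ¬? (touched? Xs m)) (All.tabulate λ x∈ t →
            let (Y , Y∈ , hit) = find t ; (y , y∈ , xBy) = find hit in clear x∈ Y∈ y∈ xBy))))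

      -- The edges of `J` are clear of the layers, hence untouched, and make up for the removed
      -- edges. So `Z` does not increase and no weight decreases.
      free-≤ : length (free M Xs) ≤ length (free M′ Xs)
      free-≤ = begin
        length (free M Xs)
          ≤⟨ filter-filter _ _ _ M (λ {m} _ _ → [ inj₂ , inj₁ ]′ (decide (any? (meetsA? m) J))) ⟩
        length (free kept Xs) + length removed  ≤⟨ +-monoʳ-≤ _ removed≤J ⟩
        length (free kept Xs) + length J        ≡⟨ +-comm _ (length J) ⟩
        length J + length (free kept Xs)        ≡⟨ sym free-replace ⟩
        length (free M′ Xs)                     ∎
        where open ≤-Reasoning

      -- If only touched edges are removed, nothing untouched is lost and all of `J` is gained.
      free-gains : (∀ {m} → m ∈ M → Any (MeetsA m) J → Touched Xs m) →
        length J + length (free M Xs) ≤ length (free M′ Xs)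
      free-gains removed-touched = begin
        length J + length (free M Xs)
          ≤⟨ +-monoʳ-≤ (length J) (filter-within _ _ M (λ m∈ ¬t → ¬t ∘ removed-touched m∈)) ⟩
        length J + length (free kept Xs)        ≡⟨ sym free-replace ⟩
        length (free M′ Xs)                     ∎
        where open ≤-Reasoning

      -- The new edges of the matching avoid the layers in B and so cannot bring two layer edges
      -- near.
      near-replace : ∀ {x y Y} → Y ∈ Xs → x ∈ Y → Near M′ x y → Near M x y
      near-replace Y∈ x∈ (inj₁ xBy) = inj₁ xBy
      near-replace {x} Y∈ x∈ (inj₂ both) with find both
      ... | m , m∈ , mBx , mBy with replace⁻ m∈
      ...   | inj₁ m∈J       = contradiction mBx (clear m∈J Y∈ x∈)
      ...   | inj₂ (m∈M , _) = inj₂ (lose m∈M (mBx , mBy))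

    layer-kept : ∀ {X Xs} → Layer M X Xs → Clear J (X ∷ Xs) → Anchored M J Xs → Layer M′ X Xs
    layer-kept {X} {Xs} layer clear anchored = record
      { inside   = L.inside
      ; apart    = L.apart
      ; sparse   = AllPairs-map-∈ L.sparse (λ {x} {y} x∈ ¬near near →
          ¬near (near-replace {Xs = X ∷ Xs} clear {x} {y} (here refl) x∈ near))
      ; rooted   = rooted′
      ; separate = λ {x} {Y} {y} x∈ Y∈ y∈ near →
          L.separate x∈ Y∈ y∈ (near-replace {Xs = X ∷ Xs} clear {x} {y} (here refl) x∈ near)
      ; grown    = ≤-trans L.grown (+-monoˡ-≤ (length X * g)
          (free-≤ {Xs} (λ x∈ Y∈ → clear x∈ (there Y∈))))
      }
      where
      module L = Layer layer
      AllPairs-map-∈ : ∀ {P Q : E → E → Set} {xs} → AllPairs P xs →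
        (∀ {x y} → x ∈ xs → P x y → Q x y) → AllPairs Q xs
      AllPairs-map-∈ []         f = []
      AllPairs-map-∈ (ps ∷ pss) f = All.map (f (here refl)) ps ∷ AllPairs-map-∈ pss (f ∘ there)
      rooted′ : ∀ {x m} → x ∈ X → m ∈ M′ → MeetsA x m → Touched Xs m
      rooted′ {x} {m} x∈ m∈ xAm with replace⁻ m∈
      ... | inj₂ (m∈M , _) = L.rooted x∈ m∈M xAm
      -- The edge of `M` that `m` displaces has the same vertex of A as `x`: it is untouched by
      -- anchoring, but touched by `rooted`.
      ... | inj₁ m∈J with anchored m∈J
      ...   | y , y∈ , ¬t , mAy = contradiction
        (L.rooted x∈ y∈ (meetsA-through {f = x} {y} (inside m∈J) (meetsA-sym {e = x} {m} xAm) mAy)) ¬t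

    anchor-removed : ∀ {Xs m} → Anchored M J Xs → m ∈ M → Any (MeetsA m) J → ¬ Touched Xs m
    anchor-removed {m = m} anchored m∈ hit t with find hit
    ... | x , x∈ , mAx with anchored x∈
    ...   | y , y∈ , ¬t , xAy with unique-partner (inside x∈) m∈ y∈ (meetsA-sym {e = m} {x} mAx) xAy
    ...     | refl = ¬t t

    -- The swap removes only edges of `M` that the layer does not touch, so whatever blocked an edge
    -- of `X` still does.
    immediate-kept : ∀ {X Xs} → Anchored M J (X ∷ Xs) →
      length (immediate M′ X) ≤ length (immediate M X)
    immediate-kept {X} {Xs} anchored = filter-mono-≤ _ _ X λ {x} x∈ ¬blocked blocked →
      let (m , m∈ , xBm) = find blocked in
      ¬blocked (lose (replace-kept m∈ (λ hit → anchor-removed {X ∷ Xs} {m} anchored m∈ hit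
        (here (lose x∈ (meetsB-sym {e = x} {m} xBm))))) xBm)

    anchored-tail : ∀ {X Xs} → Anchored M J (X ∷ Xs) → Anchored M J Xs
    anchored-tail anchored x∈ = let (m , m∈ , ¬t , xAm) = anchored x∈ in m , m∈ , ¬t ∘ there , xAm

    settled-kept : ∀ Xs → Settled M Xs → Clear J Xs → Anchored M J Xs → Settled M′ Xs
    settled-kept []       _ _ _ = tt
    settled-kept (X ∷ Xs) (layer , few , settled) clear anchored =
      layer-kept layer clear (anchored-tail {X} {Xs} anchored) ,
      ≤-<-trans (*-monoˡ-≤ μ (immediate-kept {X} {Xs} anchored)) few ,
      settled-kept Xs settled (λ x∈ Y∈ → clear x∈ (there Y∈)) (anchored-tail {X} {Xs} anchored)

-- Progress of the search

-- The parameter of `Weight` combines two ratios: in a settled layer the reached vertices are at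
-- most `suc (2 * g)` times the blocking edges, and where the walk stops these are at most `μ * g`
-- times the selected edges.
module Progress {ρ : ℕ} (H : BipartiteHypergraph (suc (suc ρ))) (g μ : ℕ) (2≤μ : 2 ≤ μ)
  (weight : Weight (BipartiteHypergraph.a H) (suc (μ * g * suc (2 * g)))) where

  open BipartiteHypergraph H
  open Layers H g μ
  open Exchange H g μ
  open Weight weight

  c : ℕ
  c = μ * g

  Valid : List E → Stack → Set
  Valid M []       = ⊤
  Valid M (X ∷ Xs) = Layer M X Xs × Settled M Xs

  Ψ : List E → Stack → ℕ
  Ψ M []       = 0
  Ψ M (X ∷ Xs) = w (Z M (X ∷ Xs)) + Ψ M Xs

  -- A lexicographic order in one number: by `Ψ≤top`, a further edge in `M` outweighs the loss of
  -- all layers.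
  potential : List E → Stack → ℕ
  potential M Xs = length M * suc top + Ψ M Xs

  layer-length : ∀ {M X Xs} → Layer M X Xs → length X ≤ a
  layer-length {X = X} layer =
    ≤-trans (length≤∣union∣ inside apart) (∣p∣≤n (union proj₁ X))
    where open Layer layer

  blocking-large : ∀ {M X Xs} → Layer M X Xs → length (immediate M X) * μ < length X →
    length X ≤ 2 * length (blocking M X)
  blocking-large {M} {X} layer few = +-cancelˡ-≤ (length X) _ _ (begin
    length X + length X
      ≤⟨ +-mono-≤ covered covered ⟩
    (i + y) + (i + y)
      ≡⟨ solve 2 (λ i y → i :+ y :+ (i :+ y) := i :* con 2 :+ con 2 :* y) refl i y ⟩
    i * 2 + 2 * y
      ≤⟨ +-monoˡ-≤ (2 * y) (≤-trans (*-monoʳ-≤ i 2≤μ) (<⇒≤ few)) ⟩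
    length X + 2 * y ∎)
    where
    open ≤-Reasoning
    open +-*-Solver using (solve; _:+_; _:*_; _:=_; con)
    i = length (immediate M X)
    y = length (blocking M X)
    covered : length X ≤ i + y
    covered = length≤immediate+blocking (Layer.sparse layer)

  -- The tree below is at most `g` times the layer, and the layer at most twice its blocking edges.
  -- The summand 1 is for the blocking edges themselves, which the layer adds to the tree.
  Z-bound : ∀ {M X Xs} → Layer M X Xs → length (immediate M X) * μ < length X →
    Z M (X ∷ Xs) ≤ length (blocking M X) * suc (2 * g)
  Z-bound {M} {X} {Xs} layer few = m≤n+o⇒m∸n≤o a (length (free M (X ∷ Xs))) (begin
    a                                           ≤⟨ Layer.grown layer ⟩
    length (free M Xs) + length X * g           ≤⟨ +-mono-≤ (free-cover M X Xs)
                                                     (*-monoˡ-≤ g (blocking-large layer few)) ⟩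
    (length (free M (X ∷ Xs)) + y) + 2 * y * g  ≡⟨ solve 3 (λ f y g →
      f :+ y :+ con 2 :* y :* g := f :+ y :* (con 1 :+ con 2 :* g)) refl (length (free M (X ∷ Xs))) y g ⟩
    length (free M (X ∷ Xs)) + y * suc (2 * g)  ∎)
    where
    open ≤-Reasoning
    open +-*-Solver using (solve; _:+_; _:*_; _:=_; con)
    y = length (blocking M X)

  ∸-shift : ∀ {m n f f′} → f ≤ n → m + f′ ≤ f → (n ∸ f) + m ≤ n ∸ f′
  ∸-shift {m} {n} {f} {f′} f≤n m+f′≤f = m+n≤o⇒m≤o∸n _ (begin
    (n ∸ f) + m + f′    ≡⟨ +-assoc (n ∸ f) m f′ ⟩
    (n ∸ f) + (m + f′)  ≤⟨ +-monoʳ-≤ (n ∸ f) m+f′≤f ⟩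
    (n ∸ f) + f         ≡⟨ m∸n+n≡m f≤n ⟩
    n                   ∎)
    where open ≤-Reasoning

  module _ {M} (matching : Matching M) (|M|<a : length M < a) where

    open Matching matching

    free<a : ∀ Xs → length (free M Xs) < a
    free<a Xs = ≤-<-trans (length-filter _ M) |M|<a

    Z-pos : ∀ Xs → 1 ≤ Z M Xs
    Z-pos Xs = m<n⇒0<n∸m (free<a Xs)

    weight-drop : ∀ {X Xs} → Layer M X Xs → length (immediate M X) * μ < length X →
      3 * w (Z M (X ∷ Xs)) ≤ w (Z M Xs)
    weight-drop {X} {Xs} layer few = w-drop {d = length (blocking M X)} (Z-pos Xs)
      (∸-shift {length (blocking M X)} (<⇒≤ (free<a Xs)) (≤-trans (≤-reflexive (+-comm (length (blocking M X)) _))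
        (free-shrinks layer)))
      (≤-trans (Z-bound layer few) (*-monoʳ-≤ (length (blocking M X)) (s≤s 2g≤K)))
      where
      open ≤-Reasoning
      2g≤K : 2 * g ≤ μ * g * suc (2 * g)
      2g≤K = begin
        2 * g                 ≤⟨ *-monoˡ-≤ g 2≤μ ⟩
        μ * g                 ≤⟨ m≤m*n (μ * g) (suc (2 * g)) ⟩
        μ * g * suc (2 * g)   ∎

    -- The weights decrease geometrically along the stack, so removing layers costs little.
    pop : ∀ {X Xs} → Layer M X Xs → length (immediate M X) * μ < length X →
      Ψ M (X ∷ Xs) + w (Z M (X ∷ Xs)) ≤ Ψ M Xs + w (Z M Xs)
    pop {X} {Xs} layer few = begin
      ω + Ψ M Xs + ω           ≡⟨ solve 2 (λ u v → u :+ v :+ u := v :+ con 2 :* u) refl ω (Ψ M Xs) ⟩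
      Ψ M Xs + 2 * ω           ≤⟨ +-monoʳ-≤ (Ψ M Xs)
          (≤-trans (*-monoˡ-≤ ω (n≤1+n 2)) (weight-drop layer few)) ⟩
      Ψ M Xs + w (Z M Xs)      ∎
      where
      open ≤-Reasoning
      open +-*-Solver using (solve; _:+_; _:*_; _:=_; con)
      ω = w (Z M (X ∷ Xs))

    -- Repeated use of `pop` shifts the whole sum onto the weight of the empty stack.
    settled-Ψ : ∀ Xs → Settled M Xs → Ψ M Xs + w (Z M Xs) ≤ top
    settled-Ψ []       _                     = w≤top _
    settled-Ψ (X ∷ Xs) (layer , few , settled) = ≤-trans (pop layer few) (settled-Ψ Xs settled)

    -- The top layer need not be settled, so `weight-drop` does not apply to it; that the tree only
    -- grows is enough.
    Ψ-top : ∀ X Xs → Ψ M (X ∷ Xs) ≤ Ψ M Xs + w (Z M Xs)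
    Ψ-top X Xs = ≤-trans (≤-reflexive (+-comm _ (Ψ M Xs)))
      (+-monoʳ-≤ (Ψ M Xs) (w-anti (∸-monoʳ-≤ a (filter-mono-≤ _ _ M (λ _ ¬t t → ¬t (there t))))))

    Ψ≤top : ∀ Xs → Valid M Xs → Ψ M Xs ≤ top
    Ψ≤top []       _ = z≤n
    Ψ≤top (X ∷ Xs) (_ , settled) = ≤-trans (Ψ-top X Xs) (settled-Ψ Xs settled)

    settled-length : ∀ Xs → Settled M Xs → length Xs ≤ length (touchedBy M Xs)
    settled-length []       _ = z≤n
    settled-length (X ∷ Xs) (layer , few , settled) =
      ≤-trans (+-mono-≤ blocked (settled-length Xs settled)) (touched-grows layer)
      where
      blocked : 1 ≤ length (blocking M X)
      blocked with length (blocking M X) | blocking-large layer few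
      ... | zero  | X≤0 = contradiction (<-≤-trans few X≤0) λ ()
      ... | suc _ | _   = s≤s z≤n

    valid-length : ∀ Xs → Valid M Xs → length Xs ≤ a
    valid-length []       _ = z≤n
    valid-length (X ∷ Xs) (_ , settled) = ≤-trans
      (s≤s (≤-trans (settled-length Xs settled) (length-filter _ M))) |M|<a

    module _ {I} (swappable : Swappable M I) where

      open Swappable swappable

      Expelled : Stack → E → Set
      Expelled Xs m = Any (MeetsA m) I × Touched Xs m

      expelled? : ∀ Xs m → Dec (Expelled Xs m)
      expelled? Xs m = any? (meetsA? m) I ×-dec touched? Xs m

      -- `collapsed` records that the discarded settled layers, together with `w (Z M Zs)` for the
      -- unsettled one on top, weigh no more than the layer kept. `exhausted` adds up the thresholds
      -- that all layers missed.
      data Outcome (Zs : Stack) : List E × Stack → Set where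
        collapsed : ∀ {X Xs} → Settled M (X ∷ Xs) → Clear I (X ∷ Xs) →
          length (blocking M X) ≤ length (select M I X) * c →
          Ψ M Zs + w (Z M Zs) ≤ Ψ M (X ∷ Xs) + w (Z M (X ∷ Xs)) →
          Outcome Zs (select M I X , X ∷ Xs)
        exhausted : length (filter (expelled? Zs) M) * c ≤ length (touchedBy M Zs) →
          Outcome Zs (I , [])

      walk-outcome : ∀ Zs → Settled M Zs → Clear I Zs → Outcome Zs (walk M c I Zs)
      walk-outcome [] _ _ = exhausted
        (subst (λ l → l * c ≤ length (touchedBy M []))
          (sym (cong length (filter-none (expelled? []) (All.universal (λ _ ()) M)))) z≤n)
      walk-outcome (X ∷ Xs) settled@(layer , few , below) clear =
        by-cases (length (blocking M X) ≤? length (select M I X) * c)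
          (walk-outcome Xs below (λ x∈ Y∈ → clear x∈ (there Y∈)))
        where
        open ≤-Reasoning

        expelled-X : length (filter (λ m → any? (meetsA? m) I) (blocking M X)) ≤ length (select M I X)
        expelled-X = ≤-trans
          (filter-crossing meetsA? (blocking M X) I
            (AllPairs.map (λ {m} {m′} (¬A , _) {x} x∈ mAx m′Ax → ¬A
              (meetsA-through {f = m} {m′} (inside x∈)
                (meetsA-sym {e = m} {x} mAx) (meetsA-sym {e = m′} {x} m′Ax)))
              (AllPairs.filter⁺ _ disjoint)))
          (filter-mono-≤ _ _ I (λ {x} _ hit → let (m , m∈ , mAx) = find hit in
            lose m∈ (meetsA-sym {e = m} {x} mAx)))

        expelled-cover : length (filter (expelled? (X ∷ Xs)) M) ≤
          length (select M I X) + length (filter (expelled? Xs) M)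
        expelled-cover = ≤-trans
          (filter-cover (expelled? (X ∷ Xs)) (λ m → any? (meetsA? m) I ×-dec any? (meetsB? m) X)
            (expelled? Xs) M
            (λ { _ (meets , here hit) → inj₁ (meets , hit) ; _ (meets , there t) → inj₂ (meets , t) }))
          (+-monoˡ-≤ _ (≤-trans both expelled-X))
          where
          both : length (filter (λ m → any? (meetsA? m) I ×-dec any? (meetsB? m) X) M) ≤
            length (filter (λ m → any? (meetsA? m) I) (blocking M X))
          both = begin
            length (filter (λ m → any? (meetsA? m) I ×-dec any? (meetsB? m) X) M)
              ≤⟨ filter-within _ (λ m → any? (meetsB? m) X) M (λ _ → proj₂) ⟩
            length (filter (λ m → any? (meetsA? m) I ×-dec any? (meetsB? m) X) (blocking M X))
              ≤⟨ filter-mono-≤ _ _ (blocking M X) (λ _ → proj₁) ⟩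
            length (filter (λ m → any? (meetsA? m) I) (blocking M X)) ∎

        by-cases : ∀ {r} (d : Dec (length (blocking M X) ≤ length (select M I X) * c)) →
          Outcome Xs r → Outcome (X ∷ Xs) (Bool.if does d then (select M I X , X ∷ Xs) else r)
        by-cases (yes many) _ = collapsed settled clear many ≤-refl
        by-cases (no _) (collapsed settled′ clear′ many Ψ≤) =
          collapsed settled′ clear′ many (≤-trans (pop layer few) Ψ≤)
        by-cases (no ¬many) (exhausted expelled≤) = exhausted
          (begin
            length (filter (expelled? (X ∷ Xs)) M) * c
              ≤⟨ *-monoˡ-≤ c expelled-cover ⟩
            (length (select M I X) + length (filter (expelled? Xs) M)) * c
              ≡⟨ *-distribʳ-+ c (length (select M I X)) _ ⟩
            length (select M I X) * c + length (filter (expelled? Xs) M) * c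
              ≤⟨ +-mono-≤ (<⇒≤ (≰⇒> ¬many)) expelled≤ ⟩
            length (blocking M X) + length (touchedBy M Xs)
              ≤⟨ touched-grows layer ⟩
            length (touchedBy M (X ∷ Xs)) ∎)

  Improves : List E → Stack → List E × Stack → Set
  Improves M Xs (M′ , Xs′) = Matching M′ × Valid M′ Xs′ × potential M Xs < potential M′ Xs′

  module _ {M} (matching : Matching M) (|M|<a : length M < a) where

    open Matching matching

    push-improves : ∀ {X} Xs → Layer M X Xs → Settled M Xs → Improves M Xs (M , X ∷ Xs)
    push-improves {X} Xs layer settled = matching , (layer , settled) ,
      +-monoʳ-< (length M * suc top) (m<n+m (Ψ M Xs) (w-pos (m∸n≤m a (length (free M (X ∷ Xs))))))

    module _ {X Xs} (layer : Layer M X Xs) (settled : Settled M Xs)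
      (many : length X ≤ length (immediate M X) * μ) where

      private
        module L = Layer layer
        I : List E
        I = immediate M X

        I⊆X : ∀ {x} → x ∈ I → x ∈ X
        I⊆X x∈ = proj₁ (∈-filter⁻ (λ x → ¬? (any? (meetsB? x) M)) {xs = X} x∈)

        clear : Clear I Xs
        clear x∈ Y∈ y∈ xBy = L.separate (I⊆X x∈) Y∈ y∈ (inj₁ xBy)

        swappable : Swappable M I
        swappable = record
          { inside    = L.inside ∘ I⊆X
          ; apart     = AllPairs.filter⁺ _
              (AllPairs.zip (L.apart , AllPairs.map (λ ¬near xBy → ¬near (inj₁ xBy)) L.sparse))
          ; unblocked = λ x∈ m∈ xBm →
              proj₂ (∈-filter⁻ (λ x → ¬? (any? (meetsB? x) M)) {xs = X} x∈) (lose m∈ xBm)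
          }

        module Collapsed {X′ Xs′} (settled′ : Settled M (X′ ∷ Xs′)) (clear′ : Clear I (X′ ∷ Xs′))
          (many′ : length (blocking M X′) ≤ length (select M I X′) * c)
          (Ψ≤ : Ψ M Xs + w (Z M Xs) ≤ Ψ M (X′ ∷ Xs′) + w (Z M (X′ ∷ Xs′))) where

          layer′ : Layer M X′ Xs′
          layer′ = proj₁ settled′

          J M′ : List E
          J  = select M I X′
          M′ = replace M J

          J⁻ : ∀ {x} → x ∈ J → x ∈ I × Any (MeetsA x) (blocking M X′)
          J⁻ = ∈-filter⁻ (λ x → any? (meetsA? x) (blocking M X′)) {xs = I}

          anchor : ∀ {x} → x ∈ J → ∃ λ m → m ∈ M × Any (MeetsB m) X′ × MeetsA x m
          anchor x∈ =
            let (m , m∈ , xAm) = find (proj₂ (J⁻ x∈))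
                (m∈M , hit) = ∈-filter⁻ (λ m → any? (meetsB? m) X′) {xs = M} m∈
            in m , m∈M , hit , xAm

          anchored : Anchored M J Xs′
          anchored x∈ = let (m , m∈ , hit , xAm) = anchor x∈ in
            m , m∈ , blocking-untouched layer′ m∈ hit , xAm

          clear-J : Clear J (X′ ∷ Xs′)
          clear-J x∈ = clear′ (proj₁ (J⁻ x∈))

          swappable-J : Swappable M J
          swappable-J = record
            { inside    = Swappable.inside swappable ∘ proj₁ ∘ J⁻
            ; apart     = AllPairs.filter⁺ _ (Swappable.apart swappable)
            ; unblocked = Swappable.unblocked swappable ∘ proj₁ ∘ J⁻ }

          removed-touched : ∀ {m} → m ∈ M → Any (MeetsA m) J → Touched (X′ ∷ Xs′) m
          removed-touched {m} m∈ hit with find hit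
          ... | x , x∈ , mAx with anchor x∈
          ...   | y , y∈ , hit′ , xAy
            with unique-partner (Swappable.inside swappable-J x∈) m∈ y∈ (meetsA-sym {e = m} {x} mAx) xAy
          ...     | refl = here hit′

          matching-M′ : Matching M′
          matching-M′ = matching′ matching swappable-J

          same-length : length M′ ≡ length M
          same-length = ≤-antisym
            (replace-≤ matching swappable-J (λ x∈ → let (m , m∈ , _ , xAm) = anchor x∈ in lose m∈ xAm))
            (replace-≥ matching swappable-J)

          |M′|<a : length M′ < a
          |M′|<a = subst (_< a) (sym same-length) |M|<a

          Ψ-kept : ∀ Ys → Clear J Ys → Ψ M Ys ≤ Ψ M′ Ys
          Ψ-kept []       _ = z≤n
          Ψ-kept (Y ∷ Ys) clear-Y = +-mono-≤
            (w-anti (∸-monoʳ-≤ a (free-≤ matching swappable-J {Y ∷ Ys} clear-Y)))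
            (Ψ-kept Ys (λ x∈ Y∈ → clear-Y x∈ (there Y∈)))

          ω : ℕ
          ω = w (Z M (X′ ∷ Xs′))

          -- The selected edges replace touched edges by untouched ones, which frees at least a
          -- fixed fraction of the vertices reached.
          weight-gain : 3 * ω ≤ w (Z M′ (X′ ∷ Xs′))
          weight-gain = w-drop {d = length J} (Z-pos matching-M′ |M′|<a (X′ ∷ Xs′))
            (∸-shift {length J} (<⇒≤ (free<a matching-M′ |M′|<a (X′ ∷ Xs′)))
              (free-gains matching swappable-J {X′ ∷ Xs′} clear-J removed-touched))
            (begin
              Z M (X′ ∷ Xs′)                              ≤⟨ Z-bound layer′ (proj₁ (proj₂ settled′)) ⟩
              length (blocking M X′) * suc (2 * g)        ≤⟨ *-monoˡ-≤ (suc (2 * g)) many′ ⟩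
              length J * c * suc (2 * g)                  ≡⟨ *-assoc (length J) c (suc (2 * g)) ⟩
              length J * (c * suc (2 * g))                ≤⟨ *-monoʳ-≤ (length J) (n≤1+n _) ⟩
              length J * suc (c * suc (2 * g))            ∎)
            where open ≤-Reasoning

          Ψ-increases : Ψ M (X ∷ Xs) < Ψ M′ (X′ ∷ Xs′)
          Ψ-increases = begin-strict
            Ψ M (X ∷ Xs)                      ≤⟨ Ψ-top matching |M|<a X Xs ⟩
            Ψ M Xs + w (Z M Xs)               ≤⟨ Ψ≤ ⟩
            ω + Ψ M Xs′ + ω                   <⟨ m<m+n _ (w-pos (m∸n≤m a (length (free M (X′ ∷ Xs′))))) ⟩
            ω + Ψ M Xs′ + ω + ω               ≡⟨ solve 2 (λ u v → u :+ v :+ u :+ u := con 3 :* u :+ v)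
                                                   refl ω (Ψ M Xs′) ⟩
            3 * ω + Ψ M Xs′                   ≤⟨ +-mono-≤ weight-gain
                                                   (Ψ-kept Xs′ (λ x∈ Y∈ → clear-J x∈ (there Y∈))) ⟩
            Ψ M′ (X′ ∷ Xs′) ∎
            where
            open ≤-Reasoning
            open +-*-Solver using (solve; _:+_; _:*_; _:=_; con)

          improves : Improves M (X ∷ Xs) (M′ , X′ ∷ Xs′)
          improves = matching-M′ ,
            ( layer-kept matching swappable-J layer′ clear-J anchored
            , settled-kept matching swappable-J Xs′ (proj₂ (proj₂ settled′))
                (λ x∈ Y∈ → clear-J x∈ (there Y∈)) anchored) ,
            subst (λ l → potential M (X ∷ Xs) < l * suc top + Ψ M′ (X′ ∷ Xs′)) (sym same-length)
              (+-monoʳ-< (length M * suc top) Ψ-increases)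

        module Exhausted (expelled≤ : length (filter (expelled? matching |M|<a swappable Xs) M) * c
                                        ≤ length (touchedBy M Xs)) where

          M′ : List E
          M′ = replace M I

          removed : List E
          removed = filter (λ m → any? (meetsA? m) I) M

          -- By `rooted` every edge removed for `I` is touched, so the missed thresholds allow only
          -- a `c`-th of the touched edges. These are fewer than `length X * g`, by `grown` and an
          -- unmatched vertex, hence fewer than `length I * c`: this is why `c` is `μ * g`.
          removed<I : length removed < length I
          removed<I = *-cancelʳ-< c (length removed) (length I) (begin-strict
            length removed * c
              ≤⟨ *-monoˡ-≤ c (filter-mono-≤ _ (expelled? matching |M|<a swappable Xs) M
                   (λ {m} m∈ hit → hit , (let (x , x∈ , mAx) = find hit in
                     L.rooted (I⊆X x∈) m∈ (meetsA-sym {e = m} {x} mAx)))) ⟩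
            length (filter (expelled? matching |M|<a swappable Xs) M) * c
              ≤⟨ expelled≤ ⟩
            length (touchedBy M Xs)
              <⟨ +-cancelˡ-< (length (free M Xs)) _ _
                   (<-≤-trans (≤-<-trans (free+touched≤ M Xs) |M|<a) L.grown) ⟩
            length X * g         ≤⟨ *-monoˡ-≤ g many ⟩
            length I * μ * g     ≡⟨ *-assoc (length I) μ g ⟩
            length I * c         ∎)
            where open ≤-Reasoning

          improves : Improves M (X ∷ Xs) (M′ , [])
          improves = matching′ matching swappable , tt , (begin-strict
            length M * suc top + Ψ M (X ∷ Xs)
              ≤⟨ +-monoʳ-≤ (length M * suc top) (Ψ≤top matching |M|<a (X ∷ Xs) (layer , settled)) ⟩
            length M * suc top + top
              <⟨ +-monoʳ-< (length M * suc top) (n<1+n top) ⟩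
            length M * suc top + suc top
              ≡⟨ +-comm (length M * suc top) (suc top) ⟩
            suc (length M) * suc top
              ≤⟨ *-monoˡ-≤ (suc top) (replace-> matching swappable removed<I) ⟩
            length M′ * suc top
              ≡⟨ sym (+-identityʳ _) ⟩
            length M′ * suc top + 0 ∎)
            where open ≤-Reasoning

      collapse-improves : Improves M (X ∷ Xs) (collapse M c I Xs)
      collapse-improves = by-outcome (walk-outcome matching |M|<a swappable Xs settled clear)
        where
        by-outcome : ∀ {r} → Outcome matching |M|<a swappable Xs r →
          Improves M (X ∷ Xs) (replace M (proj₁ r) , proj₂ r)
        by-outcome (collapsed settled′ clear′ many′ Ψ≤) =
          Collapsed.improves settled′ clear′ many′ Ψ≤
        by-outcome (exhausted expelled≤) = Exhausted.improves expelled≤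

    step-improves : (∀ {Xs} → Settled M Xs → Layer M (greedy M Xs edges) Xs) →
      ∀ Xs → Valid M Xs → Improves M Xs (step μ c edges M Xs)
    step-improves grow []       _ = push-improves [] (grow tt) tt
    step-improves grow (X ∷ Xs) (layer , settled) =
      by-cases (length X ≤? length (immediate M X) * μ)
      where
      by-cases : (d : Dec (length X ≤ length (immediate M X) * μ)) →
        Improves M (X ∷ Xs) (Bool.if does d then collapse M c (immediate M X) Xs
          else (M , greedy M (X ∷ Xs) edges ∷ X ∷ Xs))
      by-cases (yes many) = collapse-improves layer settled many
      by-cases (no ¬many) = push-improves (X ∷ Xs) (grow settled′) settled′
        where
        settled′ : Settled M (X ∷ Xs)
        settled′ = layer , ≰⇒> ¬many , settled

-- From the real hypothesis to an inequality of natural numbers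

open import Data.Integer using (+_; +[1+_]; _-_)

natural : ℕ → ℚ
natural n = + n ℚ./ 1

toℚᵘ-natural : ∀ n → toℚᵘ (natural n) ℚᵘ.≃ mkℚᵘ (+ n) 0
toℚᵘ-natural n = ℚₚ.toℚᵘ-fromℚᵘ (mkℚᵘ (+ n) 0)

denominator : ℚ → ℕ
denominator (mkℚ _ d-1 _) = suc d-1

-- A positive numerator is at least 1, so δ is at least the inverse of its denominator, by which
-- everything is multiplied.
clear-denominator : ∀ {δ} → 0ℚ ℚ.< δ → ∀ A s τ →
  (natural A ℚ.+ δ) ℚ.* natural s ℚ.< natural τ →
  suc (denominator δ * A) * s < denominator δ * τ
clear-denominator {δ} 0<δ A s τ lt with δ | ℚ.positive 0<δ | lt
... | mkℚ +[1+ p ] d cop | _ | lt = begin-strict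
  suc (suc d * A) * s             ≤⟨ *-monoˡ-≤ s (≤-trans (m≤m+n _ p) (≤-reflexive
    (solve 3 (λ d A p → con 1 :+ (con 1 :+ d) :* A :+ p
       := A :* (con 1 :+ d) :+ (con 1 :+ p) :* con 1) refl d A p))) ⟩
  (A * suc d + suc p * 1) * s     ≡⟨ sym (*-identityʳ _) ⟩
  (A * suc d + suc p * 1) * s * 1 <⟨ ℤₚ.drop‿+<+ (subst₂ ℤ._<_ lhs rhs (ℚᵘₚ.drop-*<* lt′)) ⟩
  τ * suc ((d + 0) * 1)           ≡⟨ solve 2 (λ τ d → τ :* (con 1 :+ (d :+ con 0) :* con 1)
                                        := (con 1 :+ d) :* τ) refl τ d ⟩
  suc d * τ                       ∎
  where
  open ≤-Reasoning
  open +-*-Solver using (solve; _:+_; _:*_; _:=_; con)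
  q : ℚ
  q = mkℚ +[1+ p ] d cop
  lt′ : (mkℚᵘ (+ A) 0 ℚᵘ.+ mkℚᵘ +[1+ p ] d) ℚᵘ.* mkℚᵘ (+ s) 0 ℚᵘ.< mkℚᵘ (+ τ) 0
  lt′ = ℚᵘₚ.<-respʳ-≃ (toℚᵘ-natural τ) (ℚᵘₚ.<-respˡ-≃
    (ℚᵘₚ.≃-trans (ℚₚ.toℚᵘ-homo-* (natural A ℚ.+ q) (natural s))
      (ℚᵘₚ.*-cong (ℚᵘₚ.≃-trans (ℚₚ.toℚᵘ-homo-+ (natural A) q)
        (ℚᵘₚ.+-cong (toℚᵘ-natural A) (ℚᵘₚ.≃-refl {mkℚᵘ +[1+ p ] d}))) (toℚᵘ-natural s)))
    (ℚₚ.toℚᵘ-mono-< lt))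
  lhs : (+ A ℤ.* + suc d ℤ.+ + suc p ℤ.* + 1) ℤ.* + s ℤ.* + 1 ≡ + ((A * suc d + suc p * 1) * s * 1)
  lhs rewrite sym (ℤₚ.pos-* A (suc d)) | sym (ℤₚ.pos-* (suc p) 1)
    | sym (ℤₚ.pos-* (A * suc d + suc p * 1) s) | sym (ℤₚ.pos-* ((A * suc d + suc p * 1) * s) 1) = refl
  rhs : + τ ℤ.* + suc ((d + 0) * 1) ≡ + (τ * suc ((d + 0) * 1))
  rhs = sym (ℤₚ.pos-* τ (suc ((d + 0) * 1)))

-- Haxell's condition for the existence of a perfect matching, with the additional slack ε.
Haxell : ∀ {r} → ℝ → BipartiteHypergraph r → Set
Haxell {r} ε H = ∀ (S : Subset (BipartiteHypergraph.a H)) → ∃ λ τ →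
  IsTransversalNumber H (incident H S) τ ×
  (fromℤ (+ (2 * r) - + 3) +ℝ ε) · (+ ∣ S ∣ - + 1) <ℝ fromℤ (+ τ)

2r-3 : ∀ ρ → + (2 * suc (suc ρ)) - + 3 ≡ + (2 * ρ + 1)
2r-3 ρ = trans (cong (λ n → + n - + 3) (solve 1 (λ ρ → con 2 :* (con 2 :+ ρ)
    := con 3 :+ (con 2 :* ρ :+ con 1)) refl ρ))
  (ℤₚ.⊖-≥ (m≤m+n 3 (2 * ρ + 1)))
  where open +-*-Solver using (solve; _:+_; _:*_; _:=_; con)

-- The bound δ on ε and the gap in the hypothesis hold from certain indices on, and τ is a constant
-- sequence. A single index beyond both thresholds gives an inequality of rationals.
haxell⇒expanding : ∀ {ρ ε δ N} → 0ℚ ℚ.< δ → (∀ n → N ≤ n → 0ℚ ℚ.+ δ ℚ.≤ ε .seq n) →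
  (H : BipartiteHypergraph (suc (suc ρ))) → Haxell ε H → Growth.Expanding H (denominator δ)
haxell⇒expanding {ρ} {ε} {δ} {N} 0<δ δ≤ε H haxell S s ∣S∣≡ R hits
  with haxell S
... | τ , (_ , minimal) , δ′ , 0<δ′ , N′ , gap = <-≤-trans
  (clear-denominator 0<δ (2 * ρ + 1) s τ (begin-strict
    (natural (2 * ρ + 1) ℚ.+ δ) ℚ.* natural s
      ≤⟨ ℚₚ.*-monoʳ-≤-nonNeg (natural s) {{ℚₚ.normalize-nonNeg s 1}}
           (ℚₚ.+-monoʳ-≤ (natural (2 * ρ + 1)) (subst (ℚ._≤ ε .seq n) (ℚₚ.+-identityˡ δ)
             (δ≤ε n (m≤m⊔n N N′)))) ⟩
    (natural (2 * ρ + 1) ℚ.+ ε .seq n) ℚ.* natural s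
      ≡⟨ sym (ℚₚ.+-identityʳ _) ⟩
    (natural (2 * ρ + 1) ℚ.+ ε .seq n) ℚ.* natural s ℚ.+ 0ℚ
      <⟨ ℚₚ.+-monoʳ-< ((natural (2 * ρ + 1) ℚ.+ ε .seq n) ℚ.* natural s) 0<δ′ ⟩
    (natural (2 * ρ + 1) ℚ.+ ε .seq n) ℚ.* natural s ℚ.+ δ′
      ≡⟨ cong₂ (λ z y → ((z ℚ./ 1) ℚ.+ ε .seq n) ℚ.* (y ℚ./ 1) ℚ.+ δ′) (sym (2r-3 ρ))
           (sym (cong (λ t → + t - + 1) ∣S∣≡)) ⟩
    (((+ (2 * suc (suc ρ)) - + 3) ℚ./ 1) ℚ.+ ε .seq n) ℚ.* ((+ ∣ S ∣ - + 1) ℚ./ 1) ℚ.+ δ′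
      ≤⟨ gap n (m≤n⊔m N N′) ⟩
    natural τ ∎))
  (*-monoʳ-≤ (denominator δ) (minimal R hits))
  where
  open ℚₚ.≤-Reasoning
  n : ℕ
  n = N ⊔ N′

-- The algorithm for fixed r and ε: termination, running time and correctness

length<listTree : ∀ ts → length ts < size (listTree ts)
length<listTree []       = s≤s z≤n
length<listTree (t ∷ ts) = s≤s (≤-trans (length<listTree ts) (m≤n+m _ (size t)))

leaves : ℕ → List Tree
leaves n = replicate n nil

1≤denominator : ∀ δ → 1 ≤ denominator δ
1≤denominator (mkℚ _ _ _) = s≤s z≤n

does-true : ∀ {P : Set} (P? : Dec P) → does P? ≡ true → P
does-true (yes p) _ = p

does-false : ∀ {P : Set} (P? : Dec P) → does P? ≡ false → ¬ P
does-false (no ¬p) _ = ¬p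

module Algorithm (ρ k : ℕ) (1≤k : 1 ≤ k) where

  open Constants ρ k

  private
    L : ℕ
    L = μ * g * suc (2 * g)

    2≤μ : 2 ≤ μ
    2≤μ = s≤s (≤-trans (*-mono-≤ 1≤k (s≤s (z≤n {ρ}))) (m≤m+n (k * suc ρ) _))

  -- The expansion property belongs to the index and to no tree: the program receives the hypergraph
  -- alone.
  Input : Set
  Input = Σ (BipartiteHypergraph (suc (suc ρ))) (λ H → Growth.Expanding H k)

  graph : Input → BipartiteHypergraph (suc (suc ρ))
  graph = proj₁

  module I (p : Input) where
    open BipartiteHypergraph (graph p) public
    open Layers (graph p) g μ public
    open Progress (graph p) g μ 2≤μ (Powers.weight a L) public

  N : Input → ℕ
  N p = size (hypergraphTree (graph p))

  record State (p : Input) : Set where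
    constructor state
    open I p
    field
      {M}      : List (Edge a b)
      {Xs}     : Stack
      matching : Matching M
      valid    : Valid M Xs

  open State

  -- Takes the form that `covers-realizes` decides: |A| is available to the program as the length of
  -- a unary tree.
  done? : ∀ {p} (s : State p) → Dec (length (leaves (I.a p)) ≤ length (s .M) * 1)
  done? {p} s = length (leaves (I.a p)) ≤? length (s .M) * 1

  continue : ∀ {p} → State p → Bool
  continue s = not (does (done? s))

  unfinished : ∀ {p} (s : State p) → continue s ≡ true → length (s .M) < I.a p
  unfinished {p} s c = subst (_< I.a p) (*-identityʳ _) (subst (length (s .M) * 1 <_)
    (length-replicate (I.a p)) (≰⇒> (does-false (done? s) (not-injective c))))

  finished : ∀ {p} (s : State p) → continue s ≡ false → I.a p ≤ length (s .M)
  finished {p} s c = subst (I.a p ≤_) (*-identityʳ _) (subst (_≤ length (s .M) * 1)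
    (length-replicate (I.a p)) (does-true (done? s) (not-injective c)))

  improvement : ∀ {p} (s : State p) → continue s ≡ true →
    I.Improves p (s .M) (s .Xs) (step μ c (I.edges p) (s .M) (s .Xs))
  improvement {p} s cont = I.step-improves p (s .matching) (unfinished s cont)
    (Growth.greedy-layer (graph p) k (proj₂ p) (s .matching) (unfinished s cont))
    (s .Xs) (s .valid)

  next : ∀ {p} (s : State p) → continue s ≡ true → State p
  next s cont = let (matching , valid , _) = improvement s cont in state matching valid

  -- The potential stays below (|M| + 1)(`top` + 1). The exponent is a constant of the algorithm, so
  -- this bound is polynomial.
  ceiling : ℕ → ℕ
  ceiling n = suc n * suc (suc n ^ exponent L)

  rank : ∀ {p} → State p → ℕ
  rank {p} s = ceiling (I.a p) ∸ I.potential p (s .M) (s .Xs)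

  -- Keeps the truncated subtraction in `rank` positive, so that a larger potential means a strictly
  -- smaller rank.
  below-ceiling : ∀ {p} (s : State p) → continue s ≡ true →
    I.potential p (s .M) (s .Xs) < ceiling (I.a p)
  below-ceiling {p} s cont = begin-strict
    length (s .M) * suc top + I.Ψ p (s .M) (s .Xs)
      ≤⟨ +-monoʳ-≤ (length (s .M) * suc top)
           (I.Ψ≤top p (s .matching) (unfinished s cont) (s .Xs) (s .valid)) ⟩
    length (s .M) * suc top + top
      <⟨ +-monoʳ-< (length (s .M) * suc top) (n<1+n top) ⟩
    length (s .M) * suc top + suc top
      ≡⟨ +-comm (length (s .M) * suc top) (suc top) ⟩
    suc (length (s .M)) * suc top
      ≤⟨ *-monoˡ-≤ (suc top) (m<n⇒m<1+n (unfinished s cont)) ⟩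
    suc (I.a p) * suc top ∎
    where
    open ≤-Reasoning
    top : ℕ
    top = suc (I.a p) ^ exponent L

  decreases : ∀ {p} (s : State p) cont → rank (next s cont) < rank s
  decreases {p} s cont = ≤-<-trans
    (∸-monoʳ-≤ (ceiling (I.a p)) (proj₂ (proj₂ (improvement s cont))))
    (∸-monoʳ-< (n<1+n _) (below-ceiling s cont))

  open Iteration {Input} {State} continue next rank decreases

  stateTree : ∀ p → State p → Tree
  stateTree p s = cons (unaryTree (I.a p)) (cons (edgesTree (I.edges p)) (pairTree (s .M , s .Xs)))

  a≤N : ∀ p → I.a p ≤ N p
  a≤N p = begin
    I.a p                                         ≡⟨ sym (length-replicate (I.a p)) ⟩
    length (leaves (I.a p))                ≤⟨ <⇒≤ (length<listTree (leaves (I.a p))) ⟩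
    size (unaryTree (I.a p))                      ≤⟨ m≤n⇒m≤1+n (m≤m+n _ _) ⟩
    N p                                           ∎
    where open ≤-Reasoning

  b≤N : ∀ p → I.b p ≤ N p
  b≤N p = begin
    I.b p                                         ≡⟨ sym (length-replicate (I.b p)) ⟩
    length (leaves (I.b p))                ≤⟨ <⇒≤ (length<listTree (leaves (I.b p))) ⟩
    size (unaryTree (I.b p))                      ≤⟨ m≤n⇒m≤1+n (m≤m+n _ _) ⟩
    suc (size (unaryTree (I.b p)) + size (edgesTree (I.edges p)))
                                                  ≤⟨ m≤n⇒m≤1+n (m≤n+m _ (size (unaryTree (I.a p)))) ⟩
    N p                                           ∎
    where open ≤-Reasoning

  edges≤N : ∀ p → length (I.edges p) ≤ N p
  edges≤N p = begin
    length (I.edges p)                            ≡⟨ sym (length-map edgeTree (I.edges p)) ⟩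
    length (map edgeTree (I.edges p))             ≤⟨ <⇒≤ (length<listTree (map edgeTree (I.edges p))) ⟩
    size (edgesTree (I.edges p))                  ≤⟨ m≤n+m _ (suc (size (unaryTree (I.b p)))) ⟩
    suc (size (unaryTree (I.b p)) + size (edgesTree (I.edges p)))
                                                  ≤⟨ m≤n⇒m≤1+n (m≤n+m _ (size (unaryTree (I.a p)))) ⟩
    N p                                           ∎
    where open ≤-Reasoning

  M≤N : ∀ p (s : State p) → length (s .M) ≤ N p
  M≤N p s = ≤-trans (I.Matching.length≤a p (s .matching)) (a≤N p)

  test : Realizes {Σ Input State} (N ∘ proj₁) (λ (p , s) → stateTree p s)
    (λ (_ , s) → boolTree (continue s))
  test = negate
    (pair ⌜ x₀ ₂ ₂ ₁ ⌝
      (retarget (λ (p , _) → cong listTree (sym (map-id (leaves (I.a p))))) ⌜ x₀ ₁ ⌝) ⟫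
    covers-realizes 1 edgeTree id (λ (_ , s) → s .M) (λ (p , _) → leaves (I.a p))
      (λ (p , s) → M≤N p s))

  body : Realizes {Σ Input (λ p → Σ (State p) (λ s → continue s ≡ true))} (N ∘ proj₁)
    (λ (p , s , _) → stateTree p s) (λ (p , s , cont) → stateTree p (next s cont))
  body = pair ⌜ x₀ ₁ ⌝ (pair ⌜ x₀ ₂ ₁ ⌝ (⌜ x₀ ₂ ⌝ ⟫
    step-realizes (a≤N ∘ proj₁) (b≤N ∘ proj₁)
      (λ (_ , s , _) → s .M) (λ (p , s , _) → M≤N p s)
      (λ (_ , s , _) → s .Xs)
      ( (λ (p , s , cont) → ≤-trans
          (I.valid-length p (s .matching) (unfinished s cont) (s .Xs) (s .valid)) (a≤N p))
      , (λ (p , s , _) X∈ → ≤-trans (stack-layer p (s .Xs) (s .valid) X∈) (a≤N p)))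
      (I.edges ∘ proj₁) (edges≤N ∘ proj₁) μ c))
    where
    settled-layer : ∀ p {M} Xs → I.Settled p M Xs → ∀ {X} → X ∈ Xs → length X ≤ I.a p
    settled-layer p (X ∷ Xs) (layer , _)       (here refl) = I.layer-length p layer
    settled-layer p (X ∷ Xs) (_ , _ , settled) (there X∈)  = settled-layer p Xs settled X∈

    stack-layer : ∀ p {M} Xs → I.Valid p M Xs → ∀ {X} → X ∈ Xs → length X ≤ I.a p
    stack-layer p (X ∷ Xs) (layer , _)   (here refl) = I.layer-length p layer
    stack-layer p (X ∷ Xs) (_ , settled) (there X∈)  = settled-layer p Xs settled X∈

  start : ∀ p → State p
  start p = state {M = []} {Xs = []} (record { within = λ () ; disjoint = [] }) tt

  answer : ∀ p → List (Edge (I.a p) (I.b p))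
  answer p = iterate (start p) .M

  program : Realizes N (hypergraphTree ∘ graph) (edgesTree ∘ answer)
  program =
    ⌜ cons (x₀ ₁) (cons (x₀ ₂ ₂) (cons nil nil)) ⌝ ⟫
    reindex (λ p → p , start p)
      (iterate-realizes stateTree {ceiling}
        ((constant 1 ⊕ identity) ⊗ (constant 1 ⊕ power (constant 1 ⊕ identity) (exponent L)))
        (λ {p} s → ≤-trans (m∸n≤m (ceiling (I.a p)) (I.potential p (s .M) (s .Xs)))
          (*-mono-≤ (s≤s (a≤N p)) (s≤s (^-monoˡ-≤ (exponent L) (s≤s (a≤N p))))))
        test body) ⟫
    ⌜ x₀ ₂ ₂ ₁ ⌝

  perfect : ∀ p → IsPerfectMatching (graph p) (answer p)
  perfect p = record
    { subset   = All.tabulate within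
    ; disjoint = disjoint
    ; covers   = λ v → let (e , e∈ , v∈e) = ∈-union⁻ proj₁ F (subst (v ∈ₛ_) (sym everything) ∈⊤) in
        e , (e∈ , v∈e) , λ {f} (f∈ , v∈f) → unique-partner (within e∈) e∈ f∈
          (I.meetsA-refl p (within e∈)) (v , x∈p∩q⁺ (v∈e , v∈f))
    }
    where
    s : State p
    s = iterate (start p)
    F : List (Edge (I.a p) (I.b p))
    F = answer p
    open I.Matching p (s .matching)
    -- The edges found have different vertices in A, and there are at least |A| of them.
    everything : union proj₁ F ≡ full
    everything = ∣p∣≡n⇒p≡⊤ (≤-antisym (∣p∣≤n (union proj₁ F))
      (≤-trans (finished s (iterate-stops (start p))) length≤union))

theorem1p3 : (ε : ℝ) → fromℤ (+ 0) <ℝ ε → (r : ℕ) → 2 ≤ r →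
    ∃ λ (𝒜 : Command) → ∃ λ (p : Polynomial) →
    (H : BipartiteHypergraph r) →
    (∀ (S : Subset (BipartiteHypergraph.a H)) →
    ∃ λ (τ : ℕ) → IsTransversalNumber H (incident H S) τ ×
    (fromℤ (+ (2 * r) - + 3) +ℝ ε) · (+ ∣ S ∣ - + 1) <ℝ fromℤ (+ τ)) →
    ∃ λ (M : List (Edge (BipartiteHypergraph.a H) (BipartiteHypergraph.b H))) →
    IsPerfectMatching H M ×
    Computes 𝒜 From hypergraphTree H To edgesTree M
    Within ⟦ p ⟧ (size (hypergraphTree H))
-- Of ε the algorithm knows only the denominator of a rational lower bound δ, fixed before any
-- hypergraph is given.
theorem1p3 ε (δ , 0<δ , _ , δ≤ε) (suc (suc ρ)) _ =
  program .code 0 , proj₁ (program .isPoly) , λ H haxell →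
    let p = H , haxell⇒expanding {ε = ε} 0<δ δ≤ε H haxell
        mkRun {σ} {t} exec result _ within = program .runs 0 p (initial (hypergraphTree H)) refl
    in answer p , perfect p ,
       σ , t , exec , result , ≤-trans within (≤-reflexive (proj₂ (program .isPoly) (N p)))
  where open Algorithm ρ (denominator δ) (1≤denominator δ)
theorem1p3 ε _ (suc zero) (s≤s ())
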